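{- Let $\mathscr D=([n],\mathcal J)$ be a discrete polymatroid, and let $\omega:[n]\to\mathbb R_{>0}$ be a positive weight function. For every $t\in[0,1]$ and every $1\le k<\mathrm{rk}(\mathscr D)$, we have $$\mathrm J_{\omega,t}(k)^2\ \ge\ \Bigl(1+\frac1k\Bigr)\Bigl(1+\frac{1-t}{p(k-1)-1+t}\Bigr)\,\mathrm J_{\omega,t}(k-1)\,\mathrm J_{\omega,t}(k+1).$$ (In the degenerate case $t=0$, $p(k-1)=1$, one has $\mathrm J_{\omega,0}(k+1)=0$ and the right-hand side is read as $0$.)
   Context: A discrete polymatroid $\mathscr D=([n],\mathcal J)$ consists of $[n]=\{1,\dots,n\}$ and a nonempty finite set $\mathcal J\subset\mathbb N^n$ (with $0\in\mathbb N$) such that: (hereditary) $a\in\mathcal J$, $b\in\mathbb N^n$, $b\le a$ componentwise imply $b\in\mathcal J$; (exchange) $a,b\in\mathcal J$, $|a|<|b|$ imply there is $i\in[n]$ with $a_i<b_i$ and $a+e_i\in\mathcal J$. Here $|a|=a_1+\dots+a_n$ and $e_1,\dots,e_n$ is the standard basis. $\mathrm{rk}(\mathscr D)=\max\{|a|:a\in\mathcal J\}$ and $\mathcal J_k=\{a\in\mathcal J:|a|=k\}$. Put $\omega(a)=\prod_i\omega(i)^{a_i}$, $a!=\prod_i a_i!$, $\pi(a)=\sum_{i=1}^n\binom{a_i}{2}$, and $$\mathrm J_{\omega,t}(k)=\sum_{a\in\mathcal J_k}t^{\pi(a)}\,\frac{\omega(a)}{a!}\qquad(0^0=1).$$ For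 $a\in\mathcal J$ let $\mathrm{Cont}(a)=\{i\in[n]:a+e_i\in\mathcal J\}$; for $i,j\in\mathrm{Cont}(a)$ write $i\sim_a j$ if $i=j$ or $a+e_i+e_j\notin\mathcal J$. This is an equivalence relation on $\mathrm{Cont}(a)$; $\mathrm{Par}(a)$ is the set of its equivalence classes. For $0\le k<\mathrm{rk}(\mathscr D)$, $p(k)=\max\{|\mathrm{Par}(a)|:a\in\mathcal J_k\}$. -}

module Defs where

open import Data.Bool.Properties using () renaming (_≟_ to _≟ᵇ_)
open import Data.Fin using (Fin)
open import Data.Fin.Properties using () renaming (_≟_ to _≟ᶠ_)
open import Data.Fin.Subset using (Subset)
open import Data.Integer using (+_)
open import Data.List using (List; []; _∷_; map; filter; length; foldr; allFin; deduplicate)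
open import Data.List.Extrema.Nat using (max)
open import Data.List.Membership.Propositional using (_∈_; _∉_)
import Data.List.Membership.DecPropositional as DecMembership
open import Data.List.Relation.Unary.Unique.Propositional using (Unique)
open import Data.Nat as ℕ using (ℕ; zero; suc; _!)
import Data.Nat.Properties as ℕ
open import Data.Nat.Combinatorics using (_C_)
open import Data.Product using (∃-syntax; _×_; _,_; proj₁; proj₂)
open import Data.Rational as ℚ using (ℚ; 0ℚ; 1ℚ; ½; ∣_∣; 1/_)
import Data.Rational.Properties as ℚ
import Data.Rational.Solver as ℚ
open import Data.Sum using (_⊎_)
open import Data.Vec as Vec using (Vec; lookup; _[_]%=_; tabulate)
import Data.Vec.Functional as VecF
open import Data.Vec.Properties using (≡-dec)
open import Data.Vec.Relation.Binary.Pointwise.Inductive using (Pointwise)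
open import Function using (_∘_)
open import Relation.Binary.PropositionalEquality
  using (_≡_; _≢_; refl; sym; trans; cong; cong₂; subst)
open import Relation.Nullary using (Dec; yes; no; does; ¬?; contradiction; _×-dec_; _⊎-dec_)

-- The real numbers: Cauchy sequences of rationals, with the setoid
-- equality _≈_.  All operations are pointwise.  Division needs a positive
-- divisor, witnessed by a rational lower bound.

record ℝ : Set where
  constructor mkℝ
  field
    seq    : ℕ → ℚ
    cauchy : ∀ ε → 0ℚ ℚ.< ε →
             ∃[ N ] (∀ m n → N ℕ.≤ m → N ℕ.≤ n → ∣ seq m ℚ.- seq n ∣ ℚ.< ε)

open ℝ public

infix 4 _≈_ _<_ _≤_

_≈_ : ℝ → ℝ → Set
x ≈ y = ∀ ε → 0ℚ ℚ.< ε → ∃[ N ] (∀ m → N ℕ.≤ m → ∣ seq x m ℚ.- seq y m ∣ ℚ.< ε)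

_<_ : ℝ → ℝ → Set
x < y = ∃[ ε ] (0ℚ ℚ.< ε × ∃[ N ] (∀ m → N ℕ.≤ m → seq x m ℚ.+ ε ℚ.≤ seq y m))

_≤_ : ℝ → ℝ → Set
x ≤ y = ∀ ε → 0ℚ ℚ.< ε → ∃[ N ] (∀ m → N ℕ.≤ m → seq x m ℚ.≤ seq y m ℚ.+ ε)

private
  module S = ℚ.+-*-Solver

  *-pos : ∀ {p q} → 0ℚ ℚ.< p → 0ℚ ℚ.< q → 0ℚ ℚ.< p ℚ.* q
  *-pos {p} {q} 0<p 0<q = subst (ℚ._< p ℚ.* q) (ℚ.*-zeroʳ p)
    (ℚ.*-monoʳ-<-pos p {{ℚ.positive 0<p}} 0<q)

  halves : ∀ ε → ½ ℚ.* ε ℚ.+ ½ ℚ.* ε ≡ ε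
  halves ε = trans (sym (ℚ.*-distribʳ-+ ε ½ ½)) (ℚ.*-identityˡ ε)

  half-pos : ∀ {ε} → 0ℚ ℚ.< ε → 0ℚ ℚ.< ½ ℚ.* ε
  half-pos = *-pos (ℚ.positive⁻¹ ½)

  inv : ∀ {p} → 0ℚ ℚ.< p → ℚ
  inv {p} 0<p = (1/ p) {{ℚ.>-nonZero 0<p}}

  inv-pos : ∀ {p} (0<p : 0ℚ ℚ.< p) → 0ℚ ℚ.< inv 0<p
  inv-pos {p} 0<p = ℚ.positive⁻¹ _ {{ℚ.1/pos⇒pos p {{ℚ.positive 0<p}}}}

  inv-cancel : ∀ {p} (0<p : 0ℚ ℚ.< p) → p ℚ.* inv 0<p ≡ 1ℚ
  inv-cancel {p} 0<p = ℚ.*-inverseʳ p {{ℚ.>-nonZero 0<p}}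

  *-mono-≤ : ∀ {p q r s} → 0ℚ ℚ.≤ p → 0ℚ ℚ.≤ s → p ℚ.≤ q → r ℚ.≤ s → p ℚ.* r ℚ.≤ q ℚ.* s
  *-mono-≤ {p} {q} {r} {s} 0≤p 0≤s p≤q r≤s = ℚ.≤-trans
    (ℚ.*-monoˡ-≤-nonNeg p {{ℚ.nonNegative 0≤p}} r≤s)
    (ℚ.*-monoʳ-≤-nonNeg s {{ℚ.nonNegative 0≤s}} p≤q)

bounded : ∀ x → ∃[ B ] (0ℚ ℚ.< B × ∃[ N ] (∀ m → N ℕ.≤ m → ∣ seq x m ∣ ℚ.≤ B))
bounded x with cauchy x 1ℚ (ℚ.positive⁻¹ 1ℚ)
... | N , close = 1ℚ ℚ.+ b , 0<B , N , bound
  where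
  b : ℚ
  b = ∣ seq x N ∣
  0<B : 0ℚ ℚ.< 1ℚ ℚ.+ b
  0<B = ℚ.+-mono-<-≤ (ℚ.positive⁻¹ 1ℚ) (ℚ.0≤∣p∣ (seq x N))
  split : ∀ p q → p ≡ (p ℚ.- q) ℚ.+ q
  split = S.solve 2 (λ p q → p S.:= (p S.:- q) S.:+ q) refl
  bound : ∀ m → N ℕ.≤ m → ∣ seq x m ∣ ℚ.≤ 1ℚ ℚ.+ b
  bound m N≤m = begin
    ∣ seq x m ∣                                    ≡⟨ cong ∣_∣ (split (seq x m) (seq x N)) ⟩
    ∣ (seq x m ℚ.- seq x N) ℚ.+ seq x N ∣          ≤⟨ ℚ.∣p+q∣≤∣p∣+∣q∣ (seq x m ℚ.- seq x N) (seq x N) ⟩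
    ∣ seq x m ℚ.- seq x N ∣ ℚ.+ b                  ≤⟨ ℚ.+-monoˡ-≤ b (ℚ.<⇒≤ (close m N N≤m ℕ.≤-refl)) ⟩
    1ℚ ℚ.+ b                                       ∎
    where open ℚ.≤-Reasoning

fromℚ : ℚ → ℝ
fromℚ q = mkℝ (λ _ → q) λ ε 0<ε → 0 , λ _ _ _ _ →
  subst (ℚ._< ε) (sym (cong ∣_∣ (ℚ.+-inverseʳ q))) 0<ε

fromℕ : ℕ → ℝ
fromℕ k = fromℚ ((+ k) ℚ./ 1)

0ℝ 1ℝ : ℝ
0ℝ = fromℚ 0ℚ
1ℝ = fromℚ 1ℚ

infixl 6 _+_ _-_
infixl 7 _*_ _÷_[_]
infix  8 -_
infixr 8 _^_

_+_ : ℝ → ℝ → ℝ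
x + y = mkℝ (λ n → seq x n ℚ.+ seq y n) isCauchy
  where
  rearrange : ∀ a b c d → (a ℚ.+ b) ℚ.- (c ℚ.+ d) ≡ (a ℚ.- c) ℚ.+ (b ℚ.- d)
  rearrange = S.solve 4 (λ a b c d →
    (a S.:+ b) S.:- (c S.:+ d) S.:= (a S.:- c) S.:+ (b S.:- d)) refl
  isCauchy : ∀ ε → 0ℚ ℚ.< ε → ∃[ N ] (∀ m n → N ℕ.≤ m → N ℕ.≤ n →
    ∣ (seq x m ℚ.+ seq y m) ℚ.- (seq x n ℚ.+ seq y n) ∣ ℚ.< ε)
  isCauchy ε 0<ε with cauchy x _ (half-pos 0<ε) | cauchy y _ (half-pos 0<ε)
  ... | M , px | N , py = M ℕ.⊔ N , λ m n m≥ n≥ → begin-strict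
    ∣ (seq x m ℚ.+ seq y m) ℚ.- (seq x n ℚ.+ seq y n) ∣
      ≡⟨ cong ∣_∣ (rearrange (seq x m) (seq y m) (seq x n) (seq y n)) ⟩
    ∣ (seq x m ℚ.- seq x n) ℚ.+ (seq y m ℚ.- seq y n) ∣
      ≤⟨ ℚ.∣p+q∣≤∣p∣+∣q∣ (seq x m ℚ.- seq x n) (seq y m ℚ.- seq y n) ⟩
    ∣ seq x m ℚ.- seq x n ∣ ℚ.+ ∣ seq y m ℚ.- seq y n ∣
      <⟨ ℚ.+-mono-< (px m n (ℕ.m⊔n≤o⇒m≤o M N m≥) (ℕ.m⊔n≤o⇒m≤o M N n≥))
                    (py m n (ℕ.m⊔n≤o⇒n≤o M N m≥) (ℕ.m⊔n≤o⇒n≤o M N n≥)) ⟩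
    ½ ℚ.* ε ℚ.+ ½ ℚ.* ε
      ≡⟨ halves ε ⟩
    ε ∎
    where open ℚ.≤-Reasoning

-_ : ℝ → ℝ
- x = mkℝ (λ n → ℚ.- seq x n) isCauchy
  where
  rearrange : ∀ a b → ℚ.- (a ℚ.- b) ≡ (ℚ.- a) ℚ.- (ℚ.- b)
  rearrange = S.solve 2 (λ a b → S.:- (a S.:- b) S.:= (S.:- a) S.:- (S.:- b)) refl
  isCauchy : ∀ ε → 0ℚ ℚ.< ε → ∃[ N ] (∀ m n → N ℕ.≤ m → N ℕ.≤ n →
    ∣ (ℚ.- seq x m) ℚ.- (ℚ.- seq x n) ∣ ℚ.< ε)
  isCauchy ε 0<ε with cauchy x ε 0<ε
  ... | N , px = N , λ m n m≥ n≥ → subst (ℚ._< ε)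
    (trans (sym (ℚ.∣-p∣≡∣p∣ (seq x m ℚ.- seq x n)))
           (cong ∣_∣ (rearrange (seq x m) (seq x n))))
    (px m n m≥ n≥)

_-_ : ℝ → ℝ → ℝ
x - y = x + (- y)

_*_ : ℝ → ℝ → ℝ
x * y = mkℝ (λ n → seq x n ℚ.* seq y n) isCauchy
  where
  rearrange : ∀ a b c d → (a ℚ.* b) ℚ.- (c ℚ.* d) ≡ a ℚ.* (b ℚ.- d) ℚ.+ d ℚ.* (a ℚ.- c)
  rearrange = S.solve 4 (λ a b c d →
    (a S.:* b) S.:- (c S.:* d) S.:= a S.:* (b S.:- d) S.:+ d S.:* (a S.:- c)) refl
  cancel : ∀ {p} (0<p : 0ℚ ℚ.< p) q → p ℚ.* (inv 0<p ℚ.* q) ≡ q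
  cancel {p} 0<p q = trans (sym (ℚ.*-assoc p (inv 0<p) q))
    (trans (cong (ℚ._* q) (inv-cancel 0<p)) (ℚ.*-identityˡ q))
  term : ∀ {B} (0<B : 0ℚ ℚ.< B) {η} p q → ∣ p ∣ ℚ.≤ B → ∣ q ∣ ℚ.< inv 0<B ℚ.* η →
         ∣ p ℚ.* q ∣ ℚ.≤ η
  term {B} 0<B {η} p q p≤ q< = begin
    ∣ p ℚ.* q ∣           ≡⟨ ℚ.∣p*q∣≡∣p∣*∣q∣ p q ⟩
    ∣ p ∣ ℚ.* ∣ q ∣       ≤⟨ *-mono-≤ (ℚ.0≤∣p∣ p) (ℚ.≤-trans (ℚ.0≤∣p∣ q) (ℚ.<⇒≤ q<)) p≤ (ℚ.<⇒≤ q<) ⟩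
    B ℚ.* (inv 0<B ℚ.* η) ≡⟨ cancel 0<B η ⟩
    η                     ∎
    where open ℚ.≤-Reasoning
  isCauchy : ∀ ε → 0ℚ ℚ.< ε → ∃[ N ] (∀ m n → N ℕ.≤ m → N ℕ.≤ n →
    ∣ (seq x m ℚ.* seq y m) ℚ.- (seq x n ℚ.* seq y n) ∣ ℚ.< ε)
  isCauchy ε 0<ε = N , close
    where
    bx = bounded x
    by = bounded y
    0<Bx = proj₁ (proj₂ bx)
    0<By = proj₁ (proj₂ by)
    -- a quarter of ε, so that the two error terms add up to less than ε
    η = ½ ℚ.* (½ ℚ.* ε)
    0<η : 0ℚ ℚ.< η
    0<η = half-pos (half-pos 0<ε)
    cx = cauchy x (inv 0<By ℚ.* η) (*-pos (inv-pos 0<By) 0<η)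
    cy = cauchy y (inv 0<Bx ℚ.* η) (*-pos (inv-pos 0<Bx) 0<η)
    N₁ = proj₁ (proj₂ (proj₂ bx))
    N₂ = proj₁ (proj₂ (proj₂ by))
    N₃ = proj₁ cx
    N₄ = proj₁ cy
    N = (N₁ ℕ.⊔ N₂) ℕ.⊔ (N₃ ℕ.⊔ N₄)
    half<ε : ½ ℚ.* ε ℚ.< ε
    half<ε = begin-strict
      ½ ℚ.* ε               ≡⟨ ℚ.+-identityʳ (½ ℚ.* ε) ⟨
      ½ ℚ.* ε ℚ.+ 0ℚ        <⟨ ℚ.+-monoʳ-< (½ ℚ.* ε) (half-pos 0<ε) ⟩
      ½ ℚ.* ε ℚ.+ ½ ℚ.* ε   ≡⟨ halves ε ⟩
      ε                     ∎
      where open ℚ.≤-Reasoning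
    close : ∀ m n → N ℕ.≤ m → N ℕ.≤ n →
      ∣ (seq x m ℚ.* seq y m) ℚ.- (seq x n ℚ.* seq y n) ∣ ℚ.< ε
    close m n m≥ n≥ = begin-strict
      ∣ (xm ℚ.* ym) ℚ.- (xn ℚ.* yn) ∣
        ≡⟨ cong ∣_∣ (rearrange xm ym xn yn) ⟩
      ∣ xm ℚ.* (ym ℚ.- yn) ℚ.+ yn ℚ.* (xm ℚ.- xn) ∣
        ≤⟨ ℚ.∣p+q∣≤∣p∣+∣q∣ (xm ℚ.* (ym ℚ.- yn)) (yn ℚ.* (xm ℚ.- xn)) ⟩
      ∣ xm ℚ.* (ym ℚ.- yn) ∣ ℚ.+ ∣ yn ℚ.* (xm ℚ.- xn) ∣
        ≤⟨ ℚ.+-mono-≤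
             (term 0<Bx xm (ym ℚ.- yn)
               (proj₂ (proj₂ (proj₂ bx)) m (ℕ.m⊔n≤o⇒m≤o N₁ N₂ (left m≥)))
               (proj₂ cy m n (ℕ.m⊔n≤o⇒n≤o N₃ N₄ (right m≥)) (ℕ.m⊔n≤o⇒n≤o N₃ N₄ (right n≥))))
             (term 0<By yn (xm ℚ.- xn)
               (proj₂ (proj₂ (proj₂ by)) n (ℕ.m⊔n≤o⇒n≤o N₁ N₂ (left n≥)))
               (proj₂ cx m n (ℕ.m⊔n≤o⇒m≤o N₃ N₄ (right m≥)) (ℕ.m⊔n≤o⇒m≤o N₃ N₄ (right n≥)))) ⟩
      η ℚ.+ η     ≡⟨ halves (½ ℚ.* ε) ⟩
      ½ ℚ.* ε     <⟨ half<ε ⟩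
      ε           ∎
      where
      open ℚ.≤-Reasoning
      xm = seq x m
      xn = seq x n
      ym = seq y m
      yn = seq y n
      left : ∀ {k} → N ℕ.≤ k → N₁ ℕ.⊔ N₂ ℕ.≤ k
      left = ℕ.m⊔n≤o⇒m≤o (N₁ ℕ.⊔ N₂) (N₃ ℕ.⊔ N₄)
      right : ∀ {k} → N ℕ.≤ k → N₃ ℕ.⊔ N₄ ℕ.≤ k
      right = ℕ.m⊔n≤o⇒n≤o (N₁ ℕ.⊔ N₂) (N₃ ℕ.⊔ N₄)

_^_ : ℝ → ℕ → ℝ
x ^ zero  = 1ℝ
x ^ suc k = x * x ^ k

-- The value at 0 only affects finitely many terms of reciprocal below.
recip : ℚ → ℚ
recip q with q ℚ.≟ 0ℚ
... | yes _   = 0ℚ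
... | no q≢0  = (1/ q) {{ℚ.≢-nonZero q≢0}}

recip-inverse : ∀ q → 0ℚ ℚ.< q → q ℚ.* recip q ≡ 1ℚ
recip-inverse q 0<q with q ℚ.≟ 0ℚ
... | yes q≡0 = contradiction (sym q≡0) (ℚ.<⇒≢ 0<q)
... | no q≢0  = ℚ.*-inverseʳ q {{ℚ.≢-nonZero q≢0}}

reciprocal : (x : ℝ) → 0ℝ < x → ℝ
reciprocal x (δ , 0<δ , M , x≥δ) = mkℝ (recip ∘ seq x) isCauchy
  where
  d = inv 0<δ
  0<d = inv-pos 0<δ
  δ≤ : ∀ m → M ℕ.≤ m → δ ℚ.≤ seq x m
  δ≤ m m≥ = subst (ℚ._≤ seq x m) (ℚ.+-identityˡ δ) (x≥δ m m≥)
  0<x : ∀ m → M ℕ.≤ m → 0ℚ ℚ.< seq x m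
  0<x m m≥ = ℚ.<-≤-trans 0<δ (δ≤ m m≥)
  recip-pos : ∀ q → 0ℚ ℚ.< q → 0ℚ ℚ.≤ recip q
  recip-pos q 0<q = ℚ.*-cancelˡ-≤-pos q {{ℚ.positive 0<q}} (begin
    q ℚ.* 0ℚ        ≡⟨ ℚ.*-zeroʳ q ⟩
    0ℚ              ≤⟨ ℚ.<⇒≤ (ℚ.positive⁻¹ 1ℚ) ⟩
    1ℚ              ≡⟨ recip-inverse q 0<q ⟨
    q ℚ.* recip q   ∎)
    where open ℚ.≤-Reasoning
  recip≤d : ∀ q → δ ℚ.≤ q → recip q ℚ.≤ d
  recip≤d q δ≤q = ℚ.*-cancelˡ-≤-pos q {{ℚ.positive 0<q}} (begin
    q ℚ.* recip q   ≡⟨ recip-inverse q 0<q ⟩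
    1ℚ              ≡⟨ inv-cancel 0<δ ⟨
    δ ℚ.* d         ≤⟨ ℚ.*-monoʳ-≤-nonNeg d {{ℚ.nonNegative (ℚ.<⇒≤ 0<d)}} δ≤q ⟩
    q ℚ.* d         ∎)
    where
    open ℚ.≤-Reasoning
    0<q = ℚ.<-≤-trans 0<δ δ≤q
  rearrange : ∀ a b u v → a ℚ.* u ≡ 1ℚ → b ℚ.* v ≡ 1ℚ → u ℚ.- v ≡ (u ℚ.* v) ℚ.* (b ℚ.- a)
  rearrange a b u v au≡1 bv≡1 = begin
    u ℚ.- v
      ≡⟨ cong₂ ℚ._-_ (ℚ.*-identityʳ u) (ℚ.*-identityʳ v) ⟨
    u ℚ.* 1ℚ ℚ.- v ℚ.* 1ℚ
      ≡⟨ cong₂ (λ p q → u ℚ.* p ℚ.- v ℚ.* q) bv≡1 au≡1 ⟨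
    u ℚ.* (b ℚ.* v) ℚ.- v ℚ.* (a ℚ.* u)
      ≡⟨ S.solve 4 (λ a b u v → u S.:* (b S.:* v) S.:- v S.:* (a S.:* u)
                     S.:= (u S.:* v) S.:* (b S.:- a)) refl a b u v ⟩
    (u ℚ.* v) ℚ.* (b ℚ.- a) ∎
    where open Relation.Binary.PropositionalEquality.≡-Reasoning
  isCauchy : ∀ ε → 0ℚ ℚ.< ε → ∃[ N ] (∀ m n → N ℕ.≤ m → N ℕ.≤ n →
    ∣ recip (seq x m) ℚ.- recip (seq x n) ∣ ℚ.< ε)
  isCauchy ε 0<ε with cauchy x ((δ ℚ.* δ) ℚ.* ε) (*-pos (*-pos 0<δ 0<δ) 0<ε)
  ... | N , px = M ℕ.⊔ N , λ m n m≥ n≥ →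
    let M≤m = ℕ.m⊔n≤o⇒m≤o M N m≥
        M≤n = ℕ.m⊔n≤o⇒m≤o M N n≥
        xm = seq x m
        xn = seq x n
        u  = recip xm
        v  = recip xn
        0≤u = recip-pos xm (0<x m M≤m)
        0≤v = recip-pos xn (0<x n M≤n)
        0≤uv = subst (ℚ._≤ u ℚ.* v) (ℚ.*-zeroʳ u)
                 (ℚ.*-monoˡ-≤-nonNeg u {{ℚ.nonNegative 0≤u}} 0≤v)
    in begin-strict
    ∣ u ℚ.- v ∣
      ≡⟨ cong ∣_∣ (rearrange xm xn u v (recip-inverse xm (0<x m M≤m)) (recip-inverse xn (0<x n M≤n))) ⟩
    ∣ (u ℚ.* v) ℚ.* (xn ℚ.- xm) ∣
      ≡⟨ ℚ.∣p*q∣≡∣p∣*∣q∣ (u ℚ.* v) (xn ℚ.- xm) ⟩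
    ∣ u ℚ.* v ∣ ℚ.* ∣ xn ℚ.- xm ∣
      ≡⟨ cong (ℚ._* ∣ xn ℚ.- xm ∣) (ℚ.0≤p⇒∣p∣≡p 0≤uv) ⟩
    (u ℚ.* v) ℚ.* ∣ xn ℚ.- xm ∣
      ≤⟨ ℚ.*-monoʳ-≤-nonNeg ∣ xn ℚ.- xm ∣ {{ℚ.∣-∣-nonNeg (xn ℚ.- xm)}}
           (*-mono-≤ 0≤u (ℚ.<⇒≤ 0<d) (recip≤d xm (δ≤ m M≤m)) (recip≤d xn (δ≤ n M≤n))) ⟩
    (d ℚ.* d) ℚ.* ∣ xn ℚ.- xm ∣
      <⟨ ℚ.*-monoʳ-<-pos (d ℚ.* d) {{ℚ.positive (*-pos 0<d 0<d)}}
           (px n m (ℕ.m⊔n≤o⇒n≤o M N n≥) (ℕ.m⊔n≤o⇒n≤o M N m≥)) ⟩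
    (d ℚ.* d) ℚ.* ((δ ℚ.* δ) ℚ.* ε)
      ≡⟨ S.solve 3 (λ d δ ε → (d S.:* d) S.:* ((δ S.:* δ) S.:* ε)
                     S.:= (δ S.:* d) S.:* ((δ S.:* d) S.:* ε)) refl d δ ε ⟩
    (δ ℚ.* d) ℚ.* ((δ ℚ.* d) ℚ.* ε)
      ≡⟨ cong (λ q → q ℚ.* (q ℚ.* ε)) (inv-cancel 0<δ) ⟩
    1ℚ ℚ.* (1ℚ ℚ.* ε)
      ≡⟨ trans (ℚ.*-identityˡ (1ℚ ℚ.* ε)) (ℚ.*-identityˡ ε) ⟩
    ε ∎
    where open ℚ.≤-Reasoning

_÷_[_] : ℝ → (y : ℝ) → 0ℝ < y → ℝ
x ÷ y [ 0<y ] = x * reciprocal y 0<y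

infixl 6 _+e_

_+e_ : ∀ {n} → Vec ℕ n → Fin n → Vec ℕ n
a +e i = a [ i ]%= suc

record DiscretePolymatroid (n : ℕ) : Set where
  field
    𝒥          : List (Vec ℕ n)
    unique     : Unique 𝒥
    nonempty   : ∃[ a ] a ∈ 𝒥
    hereditary : ∀ {a b} → a ∈ 𝒥 → Pointwise ℕ._≤_ b a → b ∈ 𝒥
    exchange   : ∀ {a b} → a ∈ 𝒥 → b ∈ 𝒥 → Vec.sum a ℕ.< Vec.sum b →
                 ∃[ i ] (lookup a i ℕ.< lookup b i × a +e i ∈ 𝒥)

  -- Below, the maxima are over lists that are nonempty wherever the notion is
  -- used (rk always, p k for k ≤ rk), so the default value 0 is harmless.
  rk : ℕ
  rk = max 0 (map Vec.sum 𝒥)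

  level : ℕ → List (Vec ℕ n)
  level k = filter (λ a → Vec.sum a ℕ.≟ k) 𝒥

  _∈𝒥? : (a : Vec ℕ n) → Dec (a ∈ 𝒥)
  a ∈𝒥? = a ∈? 𝒥
    where open DecMembership (≡-dec ℕ._≟_) using (_∈?_)

  Cont : Vec ℕ n → List (Fin n)
  Cont a = filter (λ i → (a +e i) ∈𝒥?) (allFin n)

  _∼[_]_ : Fin n → Vec ℕ n → Fin n → Set
  i ∼[ a ] j = i ≡ j ⊎ (a +e i +e j) ∉ 𝒥

  _∼[_]?_ : ∀ i a j → Dec (i ∼[ a ] j)
  i ∼[ a ]? j = (i ≟ᶠ j) ⊎-dec ¬? ((a +e i +e j) ∈𝒥?)

  -- The equivalence class of i in Cont a.  As a Subset it is determined by
  -- its elements, so deduplicating in Par leaves each class exactly once.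
  class : Vec ℕ n → Fin n → Subset n
  class a i = tabulate (λ j → does ((a +e j) ∈𝒥? ×-dec i ∼[ a ]? j))

  Par : Vec ℕ n → List (Subset n)
  Par a = deduplicate (≡-dec _≟ᵇ_) (map (class a) (Cont a))

  p : ℕ → ℕ
  p k = max 0 (map (length ∘ Par) (level k))

_!ᵛ : ∀ {n} → Vec ℕ n → ℕ
a !ᵛ = Vec.foldr′ (λ m r → m ! ℕ.* r) 1 a

_!ᵛ≢0 : ∀ {n} (a : Vec ℕ n) → ℕ.NonZero (a !ᵛ)
Vec.[]      !ᵛ≢0 = _
(m Vec.∷ a) !ᵛ≢0 = ℕ.m*n≢0 (m !) (a !ᵛ) {{m ℕ.!≢0}} {{a !ᵛ≢0}}

π : ∀ {n} → Vec ℕ n → ℕ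
π a = Vec.sum (Vec.map (_C 2) a)

weight : ∀ {n} → (Fin n → ℝ) → Vec ℕ n → ℝ
weight ω a = VecF.foldr _*_ 1ℝ (λ i → ω i ^ lookup a i)

∑ : List ℝ → ℝ
∑ = foldr _+_ 0ℝ

1/ℕ : (m : ℕ) .{{_ : ℕ.NonZero m}} → ℝ
1/ℕ m = fromℚ ((+ 1) ℚ./ m)

J : ∀ {n} → DiscretePolymatroid n → (Fin n → ℝ) → ℝ → ℕ → ℝ
J D ω t k = ∑ (map (λ a → t ^ π a * (weight ω a * 1/ℕ (a !ᵛ) {{a !ᵛ≢0}})) (level k))
  where open DiscretePolymatroid D using (level)

-- Rescale the variables so that ω becomes the all-ones point 1, let S m b be m!
-- times the b-th derivative at 1 of the degree |b| + m part of the generating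
-- polynomial of 𝒥, and put c = p / (p - 1 + t) with p = p(k-1).  For
-- |b| + m = k - 1 consider the quadratic form whose matrix has entries
-- S m (b+eᵢ+eⱼ), bordered by the vector S m (b+eᵢ) and the corner c · S m b.
-- The theorem is the reversed Cauchy-Schwarz inequality for this form at b = 0,
-- for the point 1 and the corner direction.  It is proved for all b by induction
-- on m.
--
-- For m = 0 the exchange property makes the matrix block-like along Par b, and
-- c is the largest corner for which Cauchy-Schwarz over the at most p classes
-- leaves only one positive direction.  For m > 0 the form is the sum of the
-- forms at b+eᵢ.  If v is orthogonal to 1 for the form, shift v by the solution of a
-- Laplace equation on the graph of the matrix, which is connected by the exchange
-- property; the reversed Cauchy-Schwarz inequalities at the b+eᵢ then add up to
-- show that the form is nonpositive at v.  This replaces the usual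
-- Perron-Frobenius argument and works over ℚ.
--
-- All operations on ℝ are pointwise, so the theorem follows from its rational
-- case after replacing t by an equal real with approximations in (0, 1].

module Submission where

-- Why the Laplace shift closes the induction: pairing the form at b + eᵢ with the all-ones vector
-- gives the i-th component of the gradient of the form at b, so the inequality there reads
-- `row i * qᵢ u ≤ (grad u i)²`. These bounds add up well only at a point u where grad u i = row i *
-- y i, for then they bound q u by E, the sum of row i * (y i)². Asking for this with y = u - v is a
-- Laplace equation for u, solvable because orthogonality to 1 makes its right-hand side sum to
-- zero. Returning from u to v contributes -2E from the gradient and at most E from the A-block, and
-- E - 2E + E = 0. Eigenvectors, which may be irrational, never occur.
--
-- The corner keeps the same c throughout because S (m+1) b is the sum of the S m (b+eᵢ); the
-- normalisation by m! is chosen for this. The second factor of the theorem, 1 + (1-t)/(p-1+t),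
-- equals c, and 1 + 1/k is what remains of the factorials: (k+1)! (k-1)! / (k!)².

module Arithmetic where
  open import Algebra.Bundles using (CommutativeRing)
  open import Data.Fin using (Fin; zero; suc)
  open import Data.Maybe using (nothing)
  open import Data.Nat using (zero; suc)
  open import Data.Product using (∃; _,_; proj₁; proj₂)
  open import Data.Rational
  open import Data.Rational.Properties
  open import Data.Sum using (_⊎_; inj₁; inj₂)
  open import Function using (_∘_)
  open import Relation.Binary.PropositionalEquality
  open import Relation.Nullary using (contradiction)
  open import Relation.Nullary.Decidable using (dec⇒maybe)
  open import Relation.Binary.Definitions using (tri<; tri≈; tri>)
  import Level
  open import Tactic.RingSolver using (solve-∀)
  open import Tactic.RingSolver.Core.AlmostCommutativeRing using (AlmostCommutativeRing; fromCommutativeRing)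
  open import Algebra.Properties.Semiring.Sum (CommutativeRing.semiring +-*-commutativeRing) using (sum; sum-cong-≗; ∑-distrib-+; *-distribˡ-sum; *-distribʳ-sum)
  open import Defs using (recip; recip-inverse)

  -- Ordered-field facts, finite sums and the graph Laplacian over `ℚ`.

  ringℚ : AlmostCommutativeRing Level.0ℓ Level.0ℓ
  ringℚ = fromCommutativeRing +-*-commutativeRing λ p → dec⇒maybe (0ℚ ≟ p)

  0≤q-p⇒p≤q : ∀ {p q} → 0ℚ ≤ q - p → p ≤ q
  0≤q-p⇒p≤q {p} {q} 0≤ = subst₂ _≤_ (+-identityˡ p) (cancel q p) (+-monoˡ-≤ p 0≤)
    where
    cancel : ∀ q p → q - p + p ≡ q
    cancel = solve-∀ ringℚ

  p≤q⇒0≤q-p : ∀ {p q} → p ≤ q → 0ℚ ≤ q - p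
  p≤q⇒0≤q-p {p} {q} p≤q = subst (_≤ q - p) (+-inverseʳ p) (+-monoˡ-≤ (- p) p≤q)

  +-nonneg : ∀ {p q} → 0ℚ ≤ p → 0ℚ ≤ q → 0ℚ ≤ p + q
  +-nonneg = +-mono-≤

  *-nonneg : ∀ {p q} → 0ℚ ≤ p → 0ℚ ≤ q → 0ℚ ≤ p * q
  *-nonneg {p} {q} 0≤p 0≤q = nonNegative⁻¹ (p * q)
    {{nonNeg*nonNeg⇒nonNeg p {{nonNegative 0≤p}} q {{nonNegative 0≤q}}}}

  *-positive : ∀ {p q} → 0ℚ < p → 0ℚ < q → 0ℚ < p * q
  *-positive {p} {q} 0<p 0<q = positive⁻¹ (p * q) {{pos*pos⇒pos p {{positive 0<p}} q {{positive 0<q}}}}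

  square-nonneg : ∀ p → 0ℚ ≤ p * p
  square-nonneg p with ≤-total 0ℚ p
  ... | inj₁ 0≤p = *-nonneg 0≤p 0≤p
  ... | inj₂ p≤0 = subst (0ℚ ≤_) (neg*neg p) (*-nonneg (neg-antimono-≤ p≤0) (neg-antimono-≤ p≤0))
    where
    neg*neg : ∀ p → - p * - p ≡ p * p
    neg*neg = solve-∀ ringℚ

  cancel-*-≤ : ∀ r {p q} → 0ℚ < r → r * p ≤ r * q → p ≤ q
  cancel-*-≤ r 0<r = *-cancelˡ-≤-pos r {{positive 0<r}}

  0≤p⇒p≡0⊎0<p : ∀ {p} → 0ℚ ≤ p → p ≡ 0ℚ ⊎ 0ℚ < p
  0≤p⇒p≡0⊎0<p {p} 0≤p with <-cmp 0ℚ p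
  ... | tri< 0<p _ _ = inj₂ 0<p
  ... | tri≈ _ 0≡p _ = inj₁ (sym 0≡p)
  ... | tri> _ _ p<0 = contradiction (<-≤-trans p<0 0≤p) (<-irrefl refl)

  square≡0⇒≡0 : ∀ {p} → p * p ≡ 0ℚ → p ≡ 0ℚ
  square≡0⇒≡0 {p} pp≡0 with <-cmp p 0ℚ
  ... | tri≈ _ p≡0 _ = p≡0
  ... | tri> _ _ 0<p = contradiction (sym pp≡0) (<⇒≢ (*-positive 0<p 0<p))
  ... | tri< p<0 _ _ = contradiction (sym pp≡0) (<⇒≢ (positive⁻¹ (p * p) {{neg*neg⇒pos p {{negative p<0}} p {{negative p<0}}}}))

  recip-nonneg : ∀ {q} → 0ℚ ≤ q → 0ℚ ≤ recip q
  recip-nonneg {q} 0≤q with 0≤p⇒p≡0⊎0<p 0≤q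
  ... | inj₁ refl = ≤-refl
  ... | inj₂ 0<q  = cancel-*-≤ q 0<q (subst₂ _≤_ (sym (*-zeroʳ q)) (sym (recip-inverse q 0<q)) (nonNegative⁻¹ 1ℚ))

  recip-positive : ∀ {q} → 0ℚ < q → 0ℚ < recip q
  recip-positive {q} 0<q with 0≤p⇒p≡0⊎0<p (recip-nonneg (<⇒≤ 0<q))
  ... | inj₂ 0<r = 0<r
  ... | inj₁ r≡0 = contradiction (trans (sym (*-zeroʳ q)) (trans (cong (q *_) (sym r≡0)) (recip-inverse q 0<q))) λ ()

  sum-zero : ∀ {n} {f : Fin n → ℚ} → (∀ i → f i ≡ 0ℚ) → sum f ≡ 0ℚ
  sum-zero {zero}  f≡0 = refl
  sum-zero {suc n} f≡0 = cong₂ _+_ (f≡0 zero) (sum-zero (f≡0 ∘ suc))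

  sum-mono-≤ : ∀ {n} {f g : Fin n → ℚ} → (∀ i → f i ≤ g i) → sum f ≤ sum g
  sum-mono-≤ {zero}  f≤g = ≤-refl
  sum-mono-≤ {suc n} f≤g = +-mono-≤ (f≤g zero) (sum-mono-≤ (f≤g ∘ suc))

  sum-nonneg : ∀ {n} {f : Fin n → ℚ} → (∀ i → 0ℚ ≤ f i) → 0ℚ ≤ sum f
  sum-nonneg {n} {f} 0≤f = subst (_≤ sum f) (sum-zero {n} (λ _ → refl)) (sum-mono-≤ 0≤f)

  term≤sum : ∀ {n} {f : Fin n → ℚ} → (∀ i → 0ℚ ≤ f i) → ∀ i → f i ≤ sum f
  term≤sum {f = f} 0≤f zero = subst (_≤ sum f) (+-identityʳ (f zero)) (+-monoʳ-≤ (f zero) (sum-nonneg (0≤f ∘ suc)))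
  term≤sum {f = f} 0≤f (suc i) = ≤-trans (term≤sum (0≤f ∘ suc) i)
    (subst (_≤ sum f) (+-identityˡ (sum (f ∘ suc))) (+-monoˡ-≤ (sum (f ∘ suc)) (0≤f zero)))

  sum-distrib-- : ∀ {n} (f g : Fin n → ℚ) → sum (λ i → f i - g i) ≡ sum f - sum g
  sum-distrib-- f g = begin
    sum (λ i → f i - g i)              ≡⟨ ∑-distrib-+ f (-_ ∘ g) ⟩
    sum f + sum (λ i → - g i)          ≡⟨ cong (sum f +_) (sum-cong-≗ (neg≡ ∘ g)) ⟩
    sum f + sum (λ i → - 1ℚ * g i)     ≡⟨ cong (sum f +_) (*-distribˡ-sum (- 1ℚ) g) ⟨
    sum f + - 1ℚ * sum g               ≡⟨ cong (sum f +_) (neg≡ (sum g)) ⟨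
    sum f - sum g                      ∎
    where
    open ≡-Reasoning
    neg≡ : ∀ p → - p ≡ - 1ℚ * p
    neg≡ = solve-∀ ringℚ

  -- The Fredholm alternative for the Laplacian of a weighted graph (diagonal
  -- weights are irrelevant), by eliminating one vertex at a time.  Here
  -- recip 0 = 0 is convenient: it makes the elimination of an isolated vertex
  -- change nothing.
  laplacian-solve : ∀ {n} (W : Fin n → Fin n → ℚ) →
    (∀ i j → W i j ≡ W j i) → (∀ i j → 0ℚ ≤ W i j) → (r : Fin n → ℚ) →
    (∀ (f : Fin n → ℚ) → (∀ i j → 0ℚ < W i j → f i ≡ f j) → sum (λ i → f i * r i) ≡ 0ℚ) →
    ∃ λ (u : Fin n → ℚ) → ∀ i → sum (λ j → W i j * (u i - u j)) ≡ r i
  laplacian-solve {zero}  W W-sym 0≤W r r⊥ = (λ ()) , λ ()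
  laplacian-solve {suc n} W W-sym 0≤W r r⊥ = u , solves
    where
    w : Fin n → ℚ
    w j = W zero (suc j)
    δ d r₀ : ℚ
    δ  = sum w
    d  = recip δ
    r₀ = r zero
    0≤w : ∀ j → 0ℚ ≤ w j
    0≤w j = 0≤W zero (suc j)
    0≤δ : 0ℚ ≤ δ
    0≤δ = sum-nonneg 0≤w
    0≤d : 0ℚ ≤ d
    0≤d = recip-nonneg 0≤δ

    -- Although `δ * d` is 0 at an isolated vertex, it still acts as the identity on every quantity
    -- that vanishes along with `δ`, so both cases share one computation.
    unit : ∀ {p} → (δ ≡ 0ℚ → p ≡ 0ℚ) → δ * d * p ≡ p
    unit {p} p-zero with 0≤p⇒p≡0⊎0<p 0≤δ
    ... | inj₁ δ≡0 = trans (cong (δ * d *_) (p-zero δ≡0)) (trans (*-zeroʳ (δ * d)) (sym (p-zero δ≡0)))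
    ... | inj₂ 0<δ = trans (cong (_* p) (recip-inverse δ 0<δ)) (*-identityˡ p)

    w-zero : δ ≡ 0ℚ → ∀ j → w j ≡ 0ℚ
    w-zero δ≡0 j = ≤-antisym (subst (w j ≤_) δ≡0 (term≤sum 0≤w j)) (0≤w j)

    -- An isolated vertex is a component by itself, so its indicator `f` is an admissible test
    -- function.
    r₀-zero : δ ≡ 0ℚ → r₀ ≡ 0ℚ
    r₀-zero δ≡0 = trans expand (r⊥ f f-const)
      where
      f : Fin (suc n) → ℚ
      f zero    = 1ℚ
      f (suc _) = 0ℚ
      f-const : ∀ i j → 0ℚ < W i j → f i ≡ f j
      f-const zero    zero    _   = refl
      f-const (suc _) (suc _) _   = refl
      f-const zero    (suc j) 0<W = contradiction (sym (w-zero δ≡0 j)) (<⇒≢ 0<W)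
      f-const (suc j) zero    0<W = contradiction (sym (trans (W-sym (suc j) zero) (w-zero δ≡0 j))) (<⇒≢ 0<W)
      expand : r₀ ≡ sum (λ i → f i * r i)
      expand = sym (trans (cong₂ _+_ (*-identityˡ r₀) (sum-zero (λ i → *-zeroˡ (r (suc i))))) (+-identityʳ r₀))

    -- Schur complement at vertex `zero`: any two of its neighbours gain an edge of weight w i * w j
    -- / δ, and `r₀` is passed on to the neighbours in proportion to `w`. The diagonal weights
    -- created here are multiplied by u i - u i.
    W′ : Fin n → Fin n → ℚ
    W′ i j = W (suc i) (suc j) + w i * w j * d
    r′ : Fin n → ℚ
    r′ i = r (suc i) + w i * (d * r₀)
    W′-sym : ∀ i j → W′ i j ≡ W′ j i
    W′-sym i j = cong₂ _+_ (W-sym (suc i) (suc j)) (cong (_* d) (*-comm (w i) (w j)))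
    0≤W′ : ∀ i j → 0ℚ ≤ W′ i j
    0≤W′ i j = +-nonneg (0≤W (suc i) (suc j)) (*-nonneg (*-nonneg (0≤w i) (0≤w j)) 0≤d)

    r′⊥ : ∀ (f : Fin n → ℚ) → (∀ i j → 0ℚ < W′ i j → f i ≡ f j) → sum (λ i → f i * r′ i) ≡ 0ℚ
    r′⊥ f f-const = trans regroup (r⊥ g g-const)
      where
      open ≡-Reasoning
      -- A test function for `W′` is extended to the eliminated vertex by its weighted mean over the
      -- neighbours. These are pairwise adjacent under `W′`, so the mean is their common value.
      f₀ : ℚ
      f₀ = d * sum (λ j → w j * f j)
      g : Fin (suc n) → ℚ
      g zero    = f₀
      g (suc i) = f i
      0<⇒W′ : ∀ {i j} → 0ℚ < w i → 0ℚ < w j → 0ℚ < W′ i j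
      0<⇒W′ {i} {j} 0<wi 0<wj = +-mono-≤-< (0≤W (suc i) (suc j))
        (*-positive (*-positive 0<wi 0<wj) (recip-positive (<-≤-trans 0<wi (term≤sum 0≤w i))))
      f₀≡ : ∀ i → 0ℚ < w i → f₀ ≡ f i
      f₀≡ i 0<wi = begin
        d * sum (λ j → w j * f j) ≡⟨ cong (d *_) (sum-cong-≗ same) ⟩
        d * sum (λ j → w j * f i) ≡⟨ cong (d *_) (*-distribʳ-sum (f i) w) ⟨
        d * (δ * f i)             ≡⟨ move d δ (f i) ⟩
        δ * d * f i               ≡⟨ unit (λ δ≡0 → contradiction (sym (w-zero δ≡0 i)) (<⇒≢ 0<wi)) ⟩
        f i                       ∎
        where
        move : ∀ d δ p → d * (δ * p) ≡ δ * d * p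
        move = solve-∀ ringℚ
        same : ∀ j → w j * f j ≡ w j * f i
        same j with 0≤p⇒p≡0⊎0<p (0≤w j)
        ... | inj₁ wj≡0 = trans (cong (_* f j) wj≡0) (trans (*-zeroˡ (f j)) (sym (trans (cong (_* f i) wj≡0) (*-zeroˡ (f i)))))
        ... | inj₂ 0<wj = cong (w j *_) (f-const j i (0<⇒W′ 0<wj 0<wi))
      g-const : ∀ i j → 0ℚ < W i j → g i ≡ g j
      g-const zero    zero    _   = refl
      g-const zero    (suc j) 0<W = f₀≡ j 0<W
      g-const (suc i) zero    0<W = sym (f₀≡ i (subst (0ℚ <_) (W-sym (suc i) zero) 0<W))
      g-const (suc i) (suc j) 0<W = f-const i j
        (+-mono-<-≤ 0<W (*-nonneg (*-nonneg (0≤w i) (0≤w j)) 0≤d))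
      regroup : sum (λ i → f i * r′ i) ≡ f₀ * r₀ + sum (λ i → f i * r (suc i))
      regroup = begin
        sum (λ i → f i * r′ i)
          ≡⟨ sum-cong-≗ (λ i → split (f i) (r (suc i)) (w i) d r₀) ⟩
        sum (λ i → w i * f i * (d * r₀) + f i * r (suc i))
          ≡⟨ ∑-distrib-+ (λ i → w i * f i * (d * r₀)) (λ i → f i * r (suc i)) ⟩
        sum (λ i → w i * f i * (d * r₀)) + sum (λ i → f i * r (suc i))
          ≡⟨ cong (_+ sum (λ i → f i * r (suc i))) (*-distribʳ-sum (d * r₀) (λ i → w i * f i)) ⟨
        sum (λ i → w i * f i) * (d * r₀) + sum (λ i → f i * r (suc i))
          ≡⟨ cong (_+ sum (λ i → f i * r (suc i))) (move (sum (λ i → w i * f i)) d r₀) ⟩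
        f₀ * r₀ + sum (λ i → f i * r (suc i)) ∎
        where
        split : ∀ f r w d r₀ → f * (r + w * (d * r₀)) ≡ w * f * (d * r₀) + f * r
        split = solve-∀ ringℚ
        move : ∀ s d r₀ → s * (d * r₀) ≡ d * s * r₀
        move = solve-∀ ringℚ

    rec : ∃ λ (u : Fin n → ℚ) → ∀ i → sum (λ j → W′ i j * (u i - u j)) ≡ r′ i
    rec = laplacian-solve W′ W′-sym 0≤W′ r′ r′⊥
    v : Fin n → ℚ
    v = proj₁ rec
    wv : ℚ
    wv = sum (λ j → w j * v j)
    -- Back-substitution: the equation at vertex `zero` says δ * u zero = r₀ + wv.
    u : Fin (suc n) → ℚ
    u zero    = d * (r₀ + wv)
    u (suc i) = v i

    sum-w-diff : ∀ p → sum (λ j → w j * (p - v j)) ≡ δ * p - wv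
    sum-w-diff p = begin
      sum (λ j → w j * (p - v j))       ≡⟨ sum-cong-≗ (λ j → expand (w j) p (v j)) ⟩
      sum (λ j → w j * p - w j * v j)   ≡⟨ sum-distrib-- (λ j → w j * p) (λ j → w j * v j) ⟩
      sum (λ j → w j * p) - wv          ≡⟨ cong (_- wv) (*-distribʳ-sum p w) ⟨
      δ * p - wv                        ∎
      where
      open ≡-Reasoning
      expand : ∀ w p v → w * (p - v) ≡ w * p - w * v
      expand = solve-∀ ringℚ

    solves : ∀ i → sum (λ j → W i j * (u i - u j)) ≡ r i
    solves zero = begin
      W zero zero * (u zero - u zero) + sum (λ j → w j * (u zero - v j))
        ≡⟨ cong (W zero zero * (u zero - u zero) +_) (sum-w-diff (u zero)) ⟩
      W zero zero * (u zero - u zero) + (δ * u zero - wv)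
        ≡⟨ expand (W zero zero) (u zero) δ d r₀ wv ⟩
      δ * d * r₀ + δ * d * wv - wv
        ≡⟨ cong₂ (λ p q → p + q - wv) (unit r₀-zero) (unit λ δ≡0 → sum-zero λ j → trans (cong (_* v j) (w-zero δ≡0 j)) (*-zeroˡ (v j))) ⟩
      r₀ + wv - wv
        ≡⟨ cancel r₀ wv ⟩
      r₀ ∎
      where
      open ≡-Reasoning
      expand : ∀ W₀ u₀ δ d r₀ wv → W₀ * (u₀ - u₀) + (δ * (d * (r₀ + wv)) - wv) ≡ δ * d * r₀ + δ * d * wv - wv
      expand = solve-∀ ringℚ
      cancel : ∀ p q → p + q - q ≡ p
      cancel = solve-∀ ringℚ
    solves (suc i) = begin
      W (suc i) zero * (v i - u zero) + s
        ≡⟨ cong₂ (λ p q → p * (v i - u zero) + q) (W-sym (suc i) zero) s≡ ⟩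
      w i * (v i - u zero) + (r′ i - w i * d * (δ * v i - wv))
        ≡⟨ expand (w i) (v i) d r₀ wv (r (suc i)) δ ⟩
      w i * v i - δ * d * w i * v i + r (suc i)
        ≡⟨ cong (λ p → w i * v i - p * v i + r (suc i)) (unit (λ δ≡0 → w-zero δ≡0 i)) ⟩
      w i * v i - w i * v i + r (suc i)
        ≡⟨ cancel (w i * v i) (r (suc i)) ⟩
      r (suc i) ∎
      where
      open ≡-Reasoning
      s : ℚ
      s = sum (λ j → W (suc i) (suc j) * (v i - v j))
      expand : ∀ w v d r₀ wv r δ → w * (v - d * (r₀ + wv)) + (r + w * (d * r₀) - w * d * (δ * v - wv))
               ≡ w * v - δ * d * w * v + r
      expand = solve-∀ ringℚ
      cancel : ∀ p q → p - p + q ≡ q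
      cancel = solve-∀ ringℚ
      split : ∀ a b c d p → a * p ≡ (a + b * c * d) * p - b * d * (c * p)
      split = solve-∀ ringℚ
      s≡ : s ≡ r′ i - w i * d * (δ * v i - wv)
      s≡ = begin
        s
          ≡⟨ sum-cong-≗ (λ j → split (W (suc i) (suc j)) (w i) (w j) d (v i - v j)) ⟩
        sum (λ j → W′ i j * (v i - v j) - w i * d * (w j * (v i - v j)))
          ≡⟨ sum-distrib-- (λ j → W′ i j * (v i - v j)) (λ j → w i * d * (w j * (v i - v j))) ⟩
        sum (λ j → W′ i j * (v i - v j)) - sum (λ j → w i * d * (w j * (v i - v j)))
          ≡⟨ cong₂ _-_ (proj₂ rec i) (sym (*-distribˡ-sum (w i * d) (λ j → w j * (v i - v j)))) ⟩
        r′ i - w i * d * sum (λ j → w j * (v i - v j))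
          ≡⟨ cong (λ p → r′ i - w i * d * p) (sum-w-diff (v i)) ⟩
        r′ i - w i * d * (δ * v i - wv) ∎

-- Bordered quadratic forms and the reversed Cauchy-Schwarz inequality.

module Forms where
  open import Data.Fin using (Fin)
  open import Data.Nat using (ℕ)
  open import Data.Product using (_,_; proj₁; proj₂)
  open import Data.Rational
  open import Data.Rational.Properties
  open import Data.Sum using (inj₁; inj₂)
  open import Relation.Binary.PropositionalEquality
  open import Relation.Nullary using (contradiction)
  open import Tactic.RingSolver using (solve-∀)
  open import Algebra.Bundles using (CommutativeRing)
  open import Algebra.Properties.Semiring.Sum (CommutativeRing.semiring +-*-commutativeRing) using (sum; sum-cong-≗; ∑-distrib-+; ∑-comm; *-distribˡ-sum; *-distribʳ-sum)
  open Arithmetic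

  2ℚ : ℚ
  2ℚ = 1ℚ + 1ℚ

  -- The quadratic form of the symmetric matrix with blocks γ, b, A, evaluated
  -- at (v₀ , v).  The all-ones vector of the A-block plays the role of the
  -- point at which Hessians are taken.
  module BorderedForm {n : ℕ} (γ : ℚ) (b : Fin n → ℚ) (A : Fin n → Fin n → ℚ) where

    row : Fin n → ℚ
    row i = sum (A i)

    X : ℚ
    X = sum row

    grad : ℚ → (Fin n → ℚ) → Fin n → ℚ
    grad v₀ v i = v₀ * b i + sum (λ j → A i j * v j)

    ℓ : ℚ → (Fin n → ℚ) → ℚ
    ℓ v₀ v = sum (grad v₀ v)

    q : ℚ → (Fin n → ℚ) → ℚ
    q v₀ v = v₀ * (γ * v₀ + sum (λ i → b i * v i)) + sum (λ i → v i * grad v₀ v i)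

    qA : (Fin n → ℚ) → ℚ
    qA y = sum (λ i → y i * sum (λ j → A i j * y j))

    module _ (A-sym : ∀ i j → A i j ≡ A j i) where

      A-adjoint : ∀ (u v : Fin n → ℚ) → sum (λ i → u i * sum (λ j → A i j * v j)) ≡ sum (λ i → v i * sum (λ j → A i j * u j))
      A-adjoint u v = begin
        sum (λ i → u i * sum (λ j → A i j * v j))
          ≡⟨ sum-cong-≗ (λ i → *-distribˡ-sum (u i) (λ j → A i j * v j)) ⟩
        sum (λ i → sum (λ j → u i * (A i j * v j)))
          ≡⟨ ∑-comm (λ i j → u i * (A i j * v j)) ⟩
        sum (λ j → sum (λ i → u i * (A i j * v j)))
          ≡⟨ sum-cong-≗ (λ j → sum-cong-≗ (λ i → trans (cong (λ p → u i * (p * v j)) (A-sym i j)) (swap (u i) (A j i) (v j)))) ⟩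
        sum (λ j → sum (λ i → v j * (A j i * u i)))
          ≡⟨ sum-cong-≗ (λ j → *-distribˡ-sum (v j) (λ i → A j i * u i)) ⟨
        sum (λ j → v j * sum (λ i → A j i * u i)) ∎
        where
        open ≡-Reasoning
        swap : ∀ u a v → u * (a * v) ≡ v * (a * u)
        swap = solve-∀ ringℚ

      -- The shift `y` has border coordinate 0, so its own contribution is the value `qA y` of the
      -- A-block alone. The difference is described pointwise because function extensionality is not
      -- assumed.
      polarise : ∀ v₀ v y w → (∀ i → w i ≡ v i - y i) →
        q v₀ w ≡ q v₀ v - 2ℚ * sum (λ i → y i * grad v₀ v i) + qA y
      polarise v₀ v y w w≡ = begin
        v₀ * (γ * v₀ + sum (λ i → b i * w i)) + sum (λ i → w i * grad v₀ w i)
          ≡⟨ cong₂ (λ p r → v₀ * (γ * v₀ + p) + r) bw≡ ww≡ ⟩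
        v₀ * (γ * v₀ + (bv - byy)) + ((vg - vAy) - (yg - qA y))
          ≡⟨ cong (λ p → v₀ * (γ * v₀ + (bv - byy)) + ((vg - p) - (yg - qA y))) vAy≡ ⟩
        v₀ * (γ * v₀ + (bv - byy)) + ((vg - (yg - v₀ * byy)) - (yg - qA y))
          ≡⟨ collect v₀ γ bv byy vg yg (qA y) ⟩
        v₀ * (γ * v₀ + bv) + vg - 2ℚ * yg + qA y ∎
        where
        open ≡-Reasoning
        bv byy vg yg vAy : ℚ
        bv  = sum (λ i → b i * v i)
        byy = sum (λ i → b i * y i)
        vg  = sum (λ i → v i * grad v₀ v i)
        yg  = sum (λ i → y i * grad v₀ v i)
        Ay : Fin n → ℚ
        Ay i = sum (λ j → A i j * y j)
        vAy = sum (λ i → v i * Ay i)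
        distrib : ∀ a b c → a * (b - c) ≡ a * b - a * c
        distrib = solve-∀ ringℚ
        collect : ∀ v₀ γ bv by vg yg r →
          v₀ * (γ * v₀ + (bv - by)) + ((vg - (yg - v₀ * by)) - (yg - r)) ≡ v₀ * (γ * v₀ + bv) + vg - (1ℚ + 1ℚ) * yg + r
        collect = solve-∀ ringℚ
        bw≡ : sum (λ i → b i * w i) ≡ bv - byy
        bw≡ = trans (sum-cong-≗ (λ i → trans (cong (b i *_) (w≡ i)) (distrib (b i) (v i) (y i))))
                    (sum-distrib-- (λ i → b i * v i) (λ i → b i * y i))
        regroup : ∀ p s t → p + (s - t) ≡ p + s - t
        regroup = solve-∀ ringℚ
        grad-w : ∀ i → grad v₀ w i ≡ grad v₀ v i - Ay i
        grad-w i = trans (cong (v₀ * b i +_)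
          (trans (sum-cong-≗ (λ j → trans (cong (A i j *_) (w≡ j)) (distrib (A i j) (v j) (y j))))
                 (sum-distrib-- (λ j → A i j * v j) (λ j → A i j * y j))))
          (regroup (v₀ * b i) (sum (λ j → A i j * v j)) (Ay i))
        expand : ∀ v y g a → (v - y) * (g - a) ≡ (v * g - v * a) - (y * g - y * a)
        expand = solve-∀ ringℚ
        ww≡ : sum (λ i → w i * grad v₀ w i) ≡ (vg - vAy) - (yg - qA y)
        ww≡ = begin
          sum (λ i → w i * grad v₀ w i)
            ≡⟨ sum-cong-≗ (λ i → trans (cong₂ _*_ (w≡ i) (grad-w i)) (expand (v i) (y i) (grad v₀ v i) (Ay i))) ⟩
          sum (λ i → (v i * grad v₀ v i - v i * Ay i) - (y i * grad v₀ v i - y i * Ay i))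
            ≡⟨ sum-distrib-- (λ i → v i * grad v₀ v i - v i * Ay i) (λ i → y i * grad v₀ v i - y i * Ay i) ⟩
          sum (λ i → v i * grad v₀ v i - v i * Ay i) - sum (λ i → y i * grad v₀ v i - y i * Ay i)
            ≡⟨ cong₂ _-_ (sum-distrib-- (λ i → v i * grad v₀ v i) (λ i → v i * Ay i))
                         (sum-distrib-- (λ i → y i * grad v₀ v i) (λ i → y i * Ay i)) ⟩
          (vg - vAy) - (yg - qA y) ∎
        peel : ∀ y v₀ b s → y * s ≡ y * (v₀ * b + s) - v₀ * (b * y)
        peel = solve-∀ ringℚ
        vAy≡ : vAy ≡ yg - v₀ * byy
        vAy≡ = begin
          vAy
            ≡⟨ A-adjoint v y ⟩
          sum (λ i → y i * sum (λ j → A i j * v j))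
            ≡⟨ sum-cong-≗ (λ i → peel (y i) v₀ (b i) (sum (λ j → A i j * v j))) ⟩
          sum (λ i → y i * grad v₀ v i - v₀ * (b i * y i))
            ≡⟨ sum-distrib-- (λ i → y i * grad v₀ v i) (λ i → v₀ * (b i * y i)) ⟩
          yg - sum (λ i → v₀ * (b i * y i))
            ≡⟨ cong (λ p → yg - p) (*-distribˡ-sum v₀ (λ i → b i * y i)) ⟨
          yg - v₀ * byy ∎

      -- For the form at b + eᵢ the right-hand side unfolds to the i-th entry of `grad` for the form
      -- at b with one more degree. This is what makes the induction hypothesis usable in
      -- `local-to-global`.
      ℓ-as-row : ∀ v₀ v → ℓ v₀ v ≡ v₀ * sum b + sum (λ i → row i * v i)
      ℓ-as-row v₀ v = begin
        sum (λ i → v₀ * b i + sum (λ j → A i j * v j))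
          ≡⟨ ∑-distrib-+ (λ i → v₀ * b i) (λ i → sum (λ j → A i j * v j)) ⟩
        sum (λ i → v₀ * b i) + sum (λ i → sum (λ j → A i j * v j))
          ≡⟨ cong₂ _+_ (sym (*-distribˡ-sum v₀ b)) (∑-comm (λ i j → A i j * v j)) ⟩
        v₀ * sum b + sum (λ j → sum (λ i → A i j * v j))
          ≡⟨ cong (v₀ * sum b +_) (sum-cong-≗ (λ j →
               trans (sum-cong-≗ (λ i → cong (_* v j) (A-sym i j))) (sym (*-distribʳ-sum (v j) (A j))))) ⟩
        v₀ * sum b + sum (λ j → row j * v j) ∎
        where open ≡-Reasoning

      grad-scale : ∀ a v₀ v i → grad (a * v₀) (λ j → a * v j) i ≡ a * grad v₀ v i
      grad-scale a v₀ v i = trans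
        (cong (a * v₀ * b i +_) (trans (sum-cong-≗ (λ j → pull (A i j) a (v j))) (sym (*-distribˡ-sum a (λ j → A i j * v j)))))
        (join a v₀ (b i) (sum (λ j → A i j * v j)))
        where
        pull : ∀ b a v → b * (a * v) ≡ a * (b * v)
        pull = solve-∀ ringℚ
        join : ∀ a v₀ b s → a * v₀ * b + a * s ≡ a * (v₀ * b + s)
        join = solve-∀ ringℚ

      scale : ∀ a v₀ v → q (a * v₀) (λ i → a * v i) ≡ a * a * q v₀ v
      scale a v₀ v = begin
        a * v₀ * (γ * (a * v₀) + sum (λ i → b i * (a * v i))) + sum (λ i → a * v i * grad (a * v₀) (λ j → a * v j) i)
          ≡⟨ cong₂ (λ p r → a * v₀ * (γ * (a * v₀) + p) + r)
               (trans (sum-cong-≗ (λ i → pull (b i) a (v i))) (sym (*-distribˡ-sum a (λ i → b i * v i))))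
               (trans (sum-cong-≗ (λ i → trans (cong (a * v i *_) (grad-scale a v₀ v i)) (pull₂ a (v i) (grad v₀ v i))))
                      (sym (*-distribˡ-sum (a * a) (λ i → v i * grad v₀ v i)))) ⟩
        a * v₀ * (γ * (a * v₀) + a * sum (λ i → b i * v i)) + a * a * sum (λ i → v i * grad v₀ v i)
          ≡⟨ collect a v₀ γ (sum (λ i → b i * v i)) (sum (λ i → v i * grad v₀ v i)) ⟩
        a * a * q v₀ v ∎
        where
        open ≡-Reasoning
        pull : ∀ b a v → b * (a * v) ≡ a * (b * v)
        pull = solve-∀ ringℚ
        pull₂ : ∀ a v g → a * v * (a * g) ≡ a * a * (v * g)
        pull₂ = solve-∀ ringℚ
        collect : ∀ a v₀ γ s t → a * v₀ * (γ * (a * v₀) + a * s) + a * a * t ≡ a * a * (v₀ * (γ * v₀ + s) + t)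
        collect = solve-∀ ringℚ

      ℓ-scale : ∀ a v₀ v → ℓ (a * v₀) (λ i → a * v i) ≡ a * ℓ v₀ v
      ℓ-scale a v₀ v = trans (sum-cong-≗ (grad-scale a v₀ v)) (sym (*-distribˡ-sum a (grad v₀ v)))

      qA-const : ∀ d → qA (λ _ → d) ≡ d * d * X
      qA-const d = trans
        (sum-cong-≗ (λ i → trans (cong (d *_) (sym (*-distribʳ-sum d (A i)))) (move d (row i))))
        (sym (*-distribˡ-sum (d * d) row))
        where
        move : ∀ d r → d * (r * d) ≡ d * d * r
        move = solve-∀ ringℚ

      q-along-ones : ∀ a d v₀ v →
        q (a * v₀) (λ i → a * v i - d) ≡ a * a * q v₀ v - 2ℚ * (d * (a * ℓ v₀ v)) + d * d * X
      q-along-ones a d v₀ v = begin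
        q (a * v₀) (λ i → a * v i - d)
          ≡⟨ polarise (a * v₀) (λ i → a * v i) (λ _ → d) (λ i → a * v i - d) (λ _ → refl) ⟩
        q (a * v₀) (λ i → a * v i) - 2ℚ * sum (λ i → d * grad (a * v₀) (λ j → a * v j) i) + qA (λ _ → d)
          ≡⟨ cong₂ _+_ (cong₂ (λ p r → p - 2ℚ * r) (scale a v₀ v)
               (trans (sym (*-distribˡ-sum d (grad (a * v₀) (λ j → a * v j)))) (cong (d *_) (ℓ-scale a v₀ v))))
               (qA-const d) ⟩
        a * a * q v₀ v - 2ℚ * (d * (a * ℓ v₀ v)) + d * d * X ∎
        where open ≡-Reasoning

      -- Apply the hypothesis to the combination of v and the all-ones vector that
      -- lies in the hyperplane.
      reversed-CS : 0ℚ ≤ X → (β : ℚ) (w : Fin n → ℚ) →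
        (∀ v₀ v → v₀ * β + sum (λ i → w i * v i) ≡ 0ℚ → q v₀ v ≤ 0ℚ) →
        ∀ v₀ v → X * q v₀ v ≤ ℓ v₀ v * ℓ v₀ v
      reversed-CS 0≤X β w q≤0 v₀ v with 0≤p⇒p≡0⊎0<p 0≤X
      ... | inj₁ X≡0 = subst (_≤ ℓ v₀ v * ℓ v₀ v) (sym (trans (cong (_* q v₀ v) X≡0) (*-zeroˡ (q v₀ v))))
                         (square-nonneg (ℓ v₀ v))
      ... | inj₂ 0<X = cancel-*-≤ (a * a) 0<aa (0≤q-p⇒p≤q (subst (0ℚ ≤_) (rearrange a d X (q v₀ v) (ℓ v₀ v)) (+-nonneg (*-nonneg 0≤X 0≤-Q) (square-nonneg (d * X - a * ℓ v₀ v)))))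
        where
        -- The values of the functional (β, w) at the all-ones vector and at (v₀, v): a times the
        -- second vector minus d times the first lies in its kernel.
        a d : ℚ
        a = sum w
        d = v₀ * β + sum (λ i → w i * v i)
        Q : ℚ
        Q = a * a * q v₀ v - 2ℚ * (d * (a * ℓ v₀ v)) + d * d * X
        hyperplane : a * v₀ * β + sum (λ i → w i * (a * v i - d)) ≡ 0ℚ
        hyperplane = begin
          a * v₀ * β + sum (λ i → w i * (a * v i - d))
            ≡⟨ cong (a * v₀ * β +_) (trans (sum-cong-≗ (λ i → expand (w i) a (v i) d))
                 (sum-distrib-- (λ i → a * (w i * v i)) (λ i → w i * d))) ⟩
          a * v₀ * β + (sum (λ i → a * (w i * v i)) - sum (λ i → w i * d))
            ≡⟨ cong₂ (λ x y → a * v₀ * β + (x - y)) (sym (*-distribˡ-sum a (λ i → w i * v i))) (sym (*-distribʳ-sum d w)) ⟩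
          a * v₀ * β + (a * sum (λ i → w i * v i) - a * d)
            ≡⟨ cancel a v₀ β (sum (λ i → w i * v i)) ⟩
          0ℚ ∎
          where
          open ≡-Reasoning
          expand : ∀ w a v d → w * (a * v - d) ≡ a * (w * v) - w * d
          expand = solve-∀ ringℚ
          cancel : ∀ a v₀ β s → a * v₀ * β + (a * s - a * (v₀ * β + s)) ≡ 0ℚ
          cancel = solve-∀ ringℚ
        0≤-Q : 0ℚ ≤ - Q
        0≤-Q = neg-antimono-≤ (subst (_≤ 0ℚ) (q-along-ones a d v₀ v)
                 (q≤0 (a * v₀) (λ i → a * v i - d) hyperplane))
        -- Completing the square: X * (-Q) + (d X - a ℓ)² = a² (ℓ² - X q), and both terms on the
        -- left are nonnegative.
        rearrange : ∀ a d X V β → X * - (a * a * V - (1ℚ + 1ℚ) * (d * (a * β)) + d * d * X) + (d * X - a * β) * (d * X - a * β)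
                    ≡ a * a * (β * β) - a * a * (X * V)
        rearrange = solve-∀ ringℚ
        X-as-q : q 0ℚ (λ _ → 1ℚ) ≡ X
        X-as-q = trans (drop₀ (γ * 0ℚ + sum (λ i → b i * 1ℚ)) (sum (λ i → 1ℚ * grad 0ℚ (λ _ → 1ℚ) i)))
          (sum-cong-≗ λ i → trans (drop₁ (b i) (sum (λ j → A i j * 1ℚ))) (sum-cong-≗ λ j → *-identityʳ (A i j)))
          where
          drop₀ : ∀ s t → 0ℚ * s + t ≡ t
          drop₀ = solve-∀ ringℚ
          drop₁ : ∀ s t → 1ℚ * (0ℚ * s + t) ≡ t
          drop₁ = solve-∀ ringℚ
        -- If `a` were zero, the all-ones vector itself would lie in the hyperplane, and the
        -- hypothesis would give X ≤ 0.
        0<aa : 0ℚ < a * a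
        0<aa with 0≤p⇒p≡0⊎0<p (square-nonneg a)
        ... | inj₂ 0<aa = 0<aa
        ... | inj₁ aa≡0 = contradiction (<-≤-trans 0<X (subst (_≤ 0ℚ) X-as-q (q≤0 0ℚ (λ _ → 1ℚ) at-ones))) (<-irrefl refl)
          where
          at-ones : 0ℚ * β + sum (λ i → w i * 1ℚ) ≡ 0ℚ
          at-ones = trans (cong₂ _+_ (*-zeroˡ β) (sum-cong-≗ (λ i → *-identityʳ (w i)))) (trans (+-identityˡ a) (square≡0⇒≡0 aa≡0))

      module _ (0≤A : ∀ i j → 0ℚ ≤ A i j) where

        -- The Laplacian of the weights `A` is positive semidefinite: weight 2 yᵢ yⱼ ≤ yᵢ² + yⱼ² by
        -- A i j and sum. By symmetry both squares produce the same total.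
        qA≤row : ∀ y → qA y ≤ sum (λ i → row i * (y i * y i))
        qA≤row y = cancel-*-≤ 2ℚ (positive⁻¹ 2ℚ) (begin
          2ℚ * qA y
            ≡⟨ trans (cong (2ℚ *_) (sum-cong-≗ (λ i → *-distribˡ-sum (y i) (λ j → A i j * y j))))
                 (trans (*-distribˡ-sum 2ℚ (λ i → sum (λ j → y i * (A i j * y j))))
                   (sum-cong-≗ (λ i → *-distribˡ-sum 2ℚ (λ j → y i * (A i j * y j))))) ⟩
          sum (λ i → sum (λ j → 2ℚ * (y i * (A i j * y j))))
            ≤⟨ sum-mono-≤ (λ i → sum-mono-≤ (λ j → 0≤q-p⇒p≤q (subst (0ℚ ≤_) (amgm (A i j) (y i) (y j))
                 (*-nonneg (0≤A i j) (square-nonneg (y i - y j)))))) ⟩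
          sum (λ i → sum (λ j → A i j * (y i * y i) + A i j * (y j * y j)))
            ≡⟨ trans (sum-cong-≗ (λ i → ∑-distrib-+ (λ j → A i j * (y i * y i)) (λ j → A i j * (y j * y j))))
                 (∑-distrib-+ (λ i → sum (λ j → A i j * (y i * y i))) (λ i → sum (λ j → A i j * (y j * y j)))) ⟩
          D + sum (λ i → sum (λ j → A i j * (y j * y j)))
            ≡⟨ cong (D +_) (trans (∑-comm (λ i j → A i j * (y j * y j)))
                 (sum-cong-≗ (λ j → sum-cong-≗ (λ i → cong (_* (y j * y j)) (A-sym i j))))) ⟩
          D + D
            ≡⟨ double D ⟩
          2ℚ * D
            ≡⟨ cong (2ℚ *_) (sum-cong-≗ (λ i → *-distribʳ-sum (y i * y i) (A i))) ⟨
          2ℚ * sum (λ i → row i * (y i * y i)) ∎)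
          where
          open ≤-Reasoning
          D : ℚ
          D = sum (λ i → sum (λ j → A i j * (y i * y i)))
          double : ∀ d → d + d ≡ (1ℚ + 1ℚ) * d
          double = solve-∀ ringℚ
          amgm : ∀ a x y → a * ((x - y) * (x - y)) ≡ a * (x * x) + a * (y * y) - (1ℚ + 1ℚ) * (x * (a * y))
          amgm = solve-∀ ringℚ

        -- Solving the Laplace equation moves v to a vector u with
        -- grad u = row · (u - v); summing the reversed Cauchy-Schwarz inequalities
        -- of the qᵢ at u bounds q u, and polarisation carries the bound back to v.
        local-to-global : (qᵢ : Fin n → ℚ → (Fin n → ℚ) → ℚ) →
          (∀ v₀ v → q v₀ v ≡ sum (λ i → qᵢ i v₀ v)) →
          (∀ i v₀ v → row i * qᵢ i v₀ v ≤ grad v₀ v i * grad v₀ v i) →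
          (∀ i v₀ v → row i ≡ 0ℚ → qᵢ i v₀ v ≡ 0ℚ) →
          ∀ v₀ v →
          (∀ (f : Fin n → ℚ) → (∀ i j → 0ℚ < A i j → f i ≡ f j) → sum (λ i → f i * (row i * v i + v₀ * b i)) ≡ 0ℚ) →
          q v₀ v ≤ 0ℚ
        local-to-global qᵢ q-sum local zero-row v₀ v orth = begin
          q v₀ v
            ≡⟨ polarise v₀ u y v (λ i → back (u i) (v i)) ⟩
          q v₀ u - 2ℚ * sum (λ i → y i * grad v₀ u i) + qA y
            ≡⟨ cong (λ p → q v₀ u - 2ℚ * p + qA y) (sum-cong-≗ (λ i → trans (cong (y i *_) (grad-u i)) (move (y i) (row i)))) ⟩
          q v₀ u - 2ℚ * E + qA y
            ≤⟨ +-mono-≤ (+-monoˡ-≤ (- (2ℚ * E)) q≤E) (qA≤row y) ⟩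
          E - 2ℚ * E + E
            ≡⟨ cancel E ⟩
          0ℚ ∎
          where
          open ≤-Reasoning
          sol = laplacian-solve A A-sym 0≤A (λ i → row i * v i + v₀ * b i) orth
          u y : Fin n → ℚ
          u = proj₁ sol
          y i = u i - v i
          E : ℚ
          E = sum (λ i → row i * (y i * y i))
          back : ∀ u v → v ≡ u - (u - v)
          back = solve-∀ ringℚ
          move : ∀ y r → y * (r * y) ≡ r * (y * y)
          move = solve-∀ ringℚ
          cancel : ∀ e → e - (1ℚ + 1ℚ) * e + e ≡ 0ℚ
          cancel = solve-∀ ringℚ
          Au : Fin n → ℚ
          Au i = sum (λ j → A i j * u j)
          lap : ∀ i → row i * u i - Au i ≡ row i * v i + v₀ * b i
          lap i = trans (sym (trans (sum-cong-≗ (λ j → distrib (A i j) (u i) (u j)))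
                    (trans (sum-distrib-- (λ j → A i j * u i) (λ j → A i j * u j))
                           (cong (_- Au i) (sym (*-distribʳ-sum (u i) (A i))))))) (proj₂ sol i)
            where
            distrib : ∀ a b c → a * (b - c) ≡ a * b - a * c
            distrib = solve-∀ ringℚ
          grad-u : ∀ i → grad v₀ u i ≡ row i * y i
          grad-u i = trans (isolate (v₀ * b i) (Au i) (row i) (v i))
                       (trans (cong (λ p → p + Au i - row i * v i) (sym (lap i))) (tidy (row i) (u i) (Au i) (v i)))
            where
            isolate : ∀ s a r v → s + a ≡ (r * v + s) + a - r * v
            isolate = solve-∀ ringℚ
            tidy : ∀ r u a v → r * u - a + a - r * v ≡ r * (u - v)
            tidy = solve-∀ ringℚ
          q≤E : q v₀ u ≤ E
          q≤E = subst (_≤ E) (sym (q-sum v₀ u)) (sum-mono-≤ bound)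
            where
            0≤row : ∀ i → 0ℚ ≤ row i
            0≤row i = sum-nonneg (0≤A i)
            square : ∀ r y → (r * y) * (r * y) ≡ r * (r * (y * y))
            square = solve-∀ ringℚ
            -- `local` can be divided by `row i` only when that is positive; for a zero row the
            -- bound has to come from `zero-row`.
            bound : ∀ i → qᵢ i v₀ u ≤ row i * (y i * y i)
            bound i with 0≤p⇒p≡0⊎0<p (0≤row i)
            ... | inj₁ r≡0 = subst (_≤ row i * (y i * y i)) (sym (zero-row i v₀ u r≡0)) (*-nonneg (0≤row i) (square-nonneg (y i)))
            ... | inj₂ 0<r = cancel-*-≤ (row i) 0<r (subst (row i * qᵢ i v₀ u ≤_)
                               (trans (cong₂ _*_ (grad-u i) (grad-u i)) (square (row i) (y i))) (local i v₀ u))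

  open BorderedForm

  -- The value of the form is linear in the coefficients (γ, b, A). Besides splitting a form into
  -- summands, the case `N = 0` says that zero coefficients give the zero form.
  q-sum : ∀ {n N} {γ b} {A : Fin n → Fin n → ℚ} (γᵢ : Fin N → ℚ) (bᵢ : Fin N → Fin n → ℚ) (Aᵢ : Fin N → Fin n → Fin n → ℚ) →
    γ ≡ sum γᵢ → (∀ l → b l ≡ sum (λ i → bᵢ i l)) → (∀ l j → A l j ≡ sum (λ i → Aᵢ i l j)) →
    ∀ v₀ v → q γ b A v₀ v ≡ sum (λ i → q (γᵢ i) (bᵢ i) (Aᵢ i) v₀ v)
  q-sum {γ = γ} {b} {A} γᵢ bᵢ Aᵢ γ≡ b≡ A≡ v₀ v = sym (begin
    sum (λ i → v₀ * (γᵢ i * v₀ + bv i) + sum (λ l → v l * g i l))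
      ≡⟨ ∑-distrib-+ (λ i → v₀ * (γᵢ i * v₀ + bv i)) (λ i → sum (λ l → v l * g i l)) ⟩
    sum (λ i → v₀ * (γᵢ i * v₀ + bv i)) + sum (λ i → sum (λ l → v l * g i l))
      ≡⟨ cong₂ _+_ border (trans (∑-comm (λ i l → v l * g i l)) (sum-cong-≗ body)) ⟩
    q γ b A v₀ v ∎)
    where
    open ≡-Reasoning
    bv : _ → ℚ
    bv i = sum (λ l → bᵢ i l * v l)
    g : _ → _ → ℚ
    g i l = grad (γᵢ i) (bᵢ i) (Aᵢ i) v₀ v l
    border : sum (λ i → v₀ * (γᵢ i * v₀ + bv i)) ≡ v₀ * (γ * v₀ + sum (λ l → b l * v l))
    border = begin
      sum (λ i → v₀ * (γᵢ i * v₀ + bv i))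
        ≡⟨ *-distribˡ-sum v₀ (λ i → γᵢ i * v₀ + bv i) ⟨
      v₀ * sum (λ i → γᵢ i * v₀ + bv i)
        ≡⟨ cong (v₀ *_) (∑-distrib-+ (λ i → γᵢ i * v₀) bv) ⟩
      v₀ * (sum (λ i → γᵢ i * v₀) + sum bv)
        ≡⟨ cong₂ (λ x y → v₀ * (x + y)) (trans (sym (*-distribʳ-sum v₀ γᵢ)) (cong (_* v₀) (sym γ≡)))
             (trans (∑-comm (λ i l → bᵢ i l * v l))
               (sum-cong-≗ (λ l → trans (sym (*-distribʳ-sum (v l) (λ i → bᵢ i l))) (cong (_* v l) (sym (b≡ l)))))) ⟩
      v₀ * (γ * v₀ + sum (λ l → b l * v l)) ∎
    body : ∀ l → sum (λ i → v l * g i l) ≡ v l * grad γ b A v₀ v l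
    body l = trans (sym (*-distribˡ-sum (v l) (λ i → g i l))) (cong (v l *_)
      (trans (∑-distrib-+ (λ i → v₀ * bᵢ i l) (λ i → sum (λ j → Aᵢ i l j * v j)))
        (cong₂ _+_ (trans (sym (*-distribˡ-sum v₀ (λ i → bᵢ i l))) (cong (v₀ *_) (sym (b≡ l))))
          (trans (∑-comm (λ i j → Aᵢ i l j * v j))
            (sum-cong-≗ (λ j → trans (sym (*-distribʳ-sum (v j) (λ i → Aᵢ i l j))) (cong (_* v j) (sym (A≡ l j)))))))))

-- Exchange, and the equivalence classes of one-step continuations.

module Exchange where
  open import Data.Bool using (true)
  import Data.Bool.Properties as Boolₚ
  open import Data.Fin as Fin using (Fin; zero; suc; inject≤)
  open import Data.Fin.Properties using () renaming (_≟_ to _≟ᶠ_)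
  import Data.Fin.Properties as Finₚ
  open import Data.Fin.Subset using (Subset)
  open import Data.Empty using (⊥)
  open import Data.List using (map; length)
  import Data.List as List
  open import Data.List.Extrema.Nat using (xs≤max; argmax-sel)
  open import Data.List.Membership.Propositional using (_∈_; _∉_)
  open import Data.List.Membership.Propositional.Properties using (∈-map⁺; ∈-map⁻; ∈-filter⁺; ∈-deduplicate⁺; ∈-allFin)
  import Data.List.Membership.DecPropositional as DecMembership
  import Data.List.Relation.Unary.All as All
  import Data.List.Relation.Unary.Any as Any
  open import Data.List.Relation.Unary.Any.Properties using (lookup-index)
  open import Data.Nat using (ℕ; zero; suc; _+_; _*_; _≤_; _<_; _!; s≤s; z≤n)
  open import Data.Nat.Combinatorics using (_C_; nCk+nC[k+1]≡[n+1]C[k+1]; nC1≡n)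
  open import Data.Nat.Properties
  open import Data.Nat.Tactic.RingSolver using (solve-∀)
  open import Data.Product using (∃; _×_; _,_)
  open import Data.Sum using (_⊎_; inj₁; inj₂)
  open import Data.Vec as Vec using (Vec; _∷_; lookup)
  open import Data.Vec.Properties using (≡-dec; lookup∘updateAt; lookup∘updateAt′; updateAt-commutes; lookup∘tabulate; tabulate-cong)
  open import Data.Vec.Relation.Binary.Pointwise.Inductive using (Pointwise; _∷_)
  import Data.Vec.Relation.Binary.Pointwise.Inductive as Pointwise
  open import Function using (_∘_; mk⇔)
  open import Relation.Binary.PropositionalEquality
  open import Relation.Nullary using (Dec; yes; no; does; contradiction; _×-dec_)
  open import Relation.Nullary.Decidable using (dec-true; does-⇔)
  open import Defs using (DiscretePolymatroid; _+e_; _!ᵛ; π)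

  lookup-+e : ∀ {n} (a : Vec ℕ n) i → lookup (a +e i) i ≡ suc (lookup a i)
  lookup-+e a i = lookup∘updateAt i a

  lookup-+e-≢ : ∀ {n} (a : Vec ℕ n) {i j} → i ≢ j → lookup (a +e j) i ≡ lookup a i
  lookup-+e-≢ a {i} {j} i≢j = lookup∘updateAt′ i j i≢j a

  lookup-≤-+e : ∀ {n} (a : Vec ℕ n) i j → lookup a i ≤ lookup (a +e j) i
  lookup-≤-+e a i j with i ≟ᶠ j
  ... | yes refl = ≤-trans (n≤1+n (lookup a i)) (≤-reflexive (sym (lookup-+e a i)))
  ... | no i≢j   = ≤-reflexive (sym (lookup-+e-≢ a i≢j))

  +e-comm : ∀ {n} (a : Vec ℕ n) i j → a +e i +e j ≡ a +e j +e i
  +e-comm a i j with i ≟ᶠ j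
  ... | yes refl = refl
  ... | no i≢j   = updateAt-commutes j i (i≢j ∘ sym) a

  ≤-+e : ∀ {n} (a : Vec ℕ n) i → Pointwise _≤_ a (a +e i)
  ≤-+e (x ∷ a) zero    = n≤1+n x ∷ Pointwise.refl ≤-refl
  ≤-+e (x ∷ a) (suc i) = ≤-refl ∷ ≤-+e a i

  sum-+e : ∀ {n} (a : Vec ℕ n) i → Vec.sum (a +e i) ≡ suc (Vec.sum a)
  sum-+e (x ∷ a) zero    = refl
  sum-+e (x ∷ a) (suc i) = trans (cong (x +_) (sum-+e a i)) (+-suc x (Vec.sum a))

  π-+e : ∀ {n} (a : Vec ℕ n) i → π (a +e i) ≡ lookup a i + π a
  π-+e (x ∷ a) zero    = trans (cong (_+ π a) (trans (sym (nCk+nC[k+1]≡[n+1]C[k+1] x 1)) (cong (_+ x C 2) (nC1≡n x))))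
                               (+-assoc x (x C 2) (π a))
  π-+e (x ∷ a) (suc i) = trans (cong (x C 2 +_) (π-+e a i)) (rotate (x C 2) (lookup a i) (π a))
    where
    rotate : ∀ p q r → p + (q + r) ≡ q + (p + r)
    rotate = solve-∀

  !ᵛ-+e : ∀ {n} (a : Vec ℕ n) i → (a +e i) !ᵛ ≡ suc (lookup a i) * a !ᵛ
  !ᵛ-+e (x ∷ a) zero    = *-assoc (suc x) (x !) (a !ᵛ)
  !ᵛ-+e (x ∷ a) (suc i) = trans (cong (x ! *_) (!ᵛ-+e a i)) (rotate (x !) (suc (lookup a i)) (a !ᵛ))
    where
    rotate : ∀ p q r → p * (q * r) ≡ q * (p * r)
    rotate = solve-∀

  -e : ∀ {n} (a : Vec ℕ n) i {m} → lookup a i ≡ suc m → ∃ λ b → a ≡ b +e i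
  -e (suc x ∷ a) zero    _  = x ∷ a , refl
  -e (x ∷ a)     (suc i) eq with -e a i eq
  ... | b , refl = x ∷ b , refl

  positive-entry : ∀ {n} (a : Vec ℕ n) {m} → Vec.sum a ≡ suc m → ∃ λ b → ∃ λ i → a ≡ b +e i
  positive-entry (suc x ∷ a) _  = x ∷ a , zero , refl
  positive-entry (zero ∷ a)  eq with positive-entry a eq
  ... | b , i , refl = zero ∷ b , suc i , refl

  module Polymatroid {n : ℕ} (D : DiscretePolymatroid n) where
    open DiscretePolymatroid D

    lower : ∀ {a i} → a +e i ∈ 𝒥 → a ∈ 𝒥
    lower {a} {i} a+i∈ = hereditary a+i∈ (≤-+e a i)

    swap : ∀ {a i j} → a +e i +e j ∈ 𝒥 → a +e j +e i ∈ 𝒥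
    swap {a} {i} {j} = subst (_∈ 𝒥) (+e-comm a i j)

    -- Exchange from the larger vector raises some coordinate of `a +e j` in which `a +e i +e l` is
    -- strictly larger. Away from i and l the latter agrees with `a`, so the coordinate is i or l.
    exchange₂ : ∀ {a i j l} → a +e j ∈ 𝒥 → a +e i +e l ∈ 𝒥 → a +e j +e i ∈ 𝒥 ⊎ a +e j +e l ∈ 𝒥
    exchange₂ {a} {i} {j} {l} a+j∈ a+i+l∈
      with exchange a+j∈ a+i+l∈ (≤-reflexive (trans (cong suc (sum-+e a j)) (sym (trans (sum-+e (a +e i) l) (cong suc (sum-+e a i))))))
    ... | m , lt , a+j+m∈ with m ≟ᶠ i | m ≟ᶠ l
    ... | yes refl | _        = inj₁ a+j+m∈
    ... | no _     | yes refl = inj₂ a+j+m∈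
    ... | no m≢i   | no m≢l   = contradiction lt (≤⇒≯ (≤-trans
            (≤-reflexive (trans (lookup-+e-≢ (a +e i) m≢l) (lookup-+e-≢ a m≢i))) (lookup-≤-+e a m j)))

    extend : ∀ {a} → a ∈ 𝒥 → Vec.sum a < rk → ∃ λ i → a +e i ∈ 𝒥
    extend {a} a∈ lt with argmax-sel (λ x → x) 0 (map Vec.sum 𝒥)
    -- The maximum may be its default value 0, but no size is below 0; otherwise it is attained by
    -- some `b`, into which `a` can be extended.
    ... | inj₁ rk≡0 = contradiction (subst (Vec.sum a <_) rk≡0 lt) λ ()
    ... | inj₂ rk∈  with ∈-map⁻ Vec.sum rk∈
    ... | b , b∈ , rk≡ with exchange a∈ b∈ (subst (Vec.sum a <_) rk≡ lt)
    ... | i , _ , a+i∈ = i , a+i∈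

    ∼-refl : ∀ {a i} → i ∼[ a ] i
    ∼-refl = inj₁ refl

    ∼-sym : ∀ {a i j} → i ∼[ a ] j → j ∼[ a ] i
    ∼-sym (inj₁ refl) = inj₁ refl
    ∼-sym (inj₂ ∉)    = inj₂ (∉ ∘ swap)

    -- By contraposition: if i and l could be added together, `exchange₂` would let j be added
    -- together with i or with l.
    ∼-trans : ∀ {a i j l} → a +e j ∈ 𝒥 → i ∼[ a ] j → j ∼[ a ] l → i ∼[ a ] l
    ∼-trans _ (inj₁ refl) j∼l = j∼l
    ∼-trans _ i∼j (inj₁ refl) = i∼j
    ∼-trans {a} {i} {j} {l} a+j∈ (inj₂ ∉ij) (inj₂ ∉jl) = inj₂ λ a+i+l∈ → case (exchange₂ a+j∈ a+i+l∈)
      where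
      case : a +e j +e i ∈ 𝒥 ⊎ a +e j +e l ∈ 𝒥 → ⊥
      case (inj₁ ∈ji) = ∉ij (swap ∈ji)
      case (inj₂ ∈jl) = ∉jl ∈jl

    class-≡⇒∼ : ∀ {a i j} → a +e j ∈ 𝒥 → class a i ≡ class a j → i ∼[ a ] j
    class-≡⇒∼ {a} {i} {j} a+j∈ eq = witness ((a +e j) ∈𝒥? ×-dec i ∼[ a ]? j) (begin
      does ((a +e j) ∈𝒥? ×-dec i ∼[ a ]? j)  ≡⟨ lookup∘tabulate _ j ⟨
      lookup (class a i) j                    ≡⟨ cong (λ c → lookup c j) eq ⟩
      lookup (class a j) j                    ≡⟨ lookup∘tabulate _ j ⟩
      does ((a +e j) ∈𝒥? ×-dec j ∼[ a ]? j)  ≡⟨ dec-true ((a +e j) ∈𝒥? ×-dec j ∼[ a ]? j) (a+j∈ , ∼-refl {a} {j}) ⟩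
      true                                    ∎)
      where
      open ≡-Reasoning
      witness : (d : Dec (a +e j ∈ 𝒥 × i ∼[ a ] j)) → does d ≡ true → i ∼[ a ] j
      witness (yes (_ , i∼j)) _ = i∼j

    ∼⇒class-≡ : ∀ {a i j} → a +e i ∈ 𝒥 → a +e j ∈ 𝒥 → i ∼[ a ] j → class a i ≡ class a j
    ∼⇒class-≡ {a} {i} {j} a+i∈ a+j∈ i∼j = tabulate-cong λ l →
      does-⇔ (mk⇔ (λ (l∈ , i∼l) → l∈ , ∼-trans {a} {j} {i} {l} a+i∈ (∼-sym {a} {i} {j} i∼j) i∼l)
                  (λ (l∈ , j∼l) → l∈ , ∼-trans {a} {i} {j} {l} a+j∈ i∼j j∼l))
        ((a +e l) ∈𝒥? ×-dec i ∼[ a ]? l) ((a +e l) ∈𝒥? ×-dec j ∼[ a ]? l)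

    open DecMembership (≡-dec {n = n} Boolₚ._≟_) using (_∈?_)

    class∈Par : ∀ {a i} → a +e i ∈ 𝒥 → class a i ∈ Par a
    class∈Par {a} {i} a+i∈ = ∈-deduplicate⁺ (≡-dec Boolₚ._≟_)
      (∈-map⁺ (class a) (∈-filter⁺ (λ i → (a +e i) ∈𝒥?) (∈-allFin i) a+i∈))

    -- The decision is an argument so that proofs about `label` can match on it separately for each
    -- of the two indices they compare.
    position : ∀ {a P} → length (Par a) ≤ suc P → (K : Subset n) → Dec (K ∈ Par a) → Fin (suc P)
    position ≤P K (yes K∈) = inject≤ (Any.index K∈) ≤P
    position ≤P K (no _)   = zero

    -- The number of the class of i; junk value zero when i is not in Cont a.
    label : ∀ {a P} → length (Par a) ≤ suc P → Fin n → Fin (suc P)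
    label {a} ≤P i = position {a} ≤P (class a i) (class a i ∈? Par a)

    label-≡⇒∼ : ∀ {a P i j} (≤P : length (Par a) ≤ suc P) → a +e i ∈ 𝒥 → a +e j ∈ 𝒥 →
      label {a} ≤P i ≡ label {a} ≤P j → i ∼[ a ] j
    label-≡⇒∼ {a} {P} {i} {j} ≤P a+i∈ a+j∈ = from (class a i ∈? Par a) (class a j ∈? Par a)
      where
      from : (d : Dec (class a i ∈ Par a)) (e : Dec (class a j ∈ Par a)) →
        position {a} ≤P (class a i) d ≡ position {a} ≤P (class a j) e → i ∼[ a ] j
      from (no i∉)  _        _  = contradiction (class∈Par a+i∈) i∉
      from (yes _)  (no j∉)  _  = contradiction (class∈Par a+j∈) j∉
      from (yes i∈) (yes j∈) eq = class-≡⇒∼ a+j∈ (trans (lookup-index i∈)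
        (trans (cong (List.lookup (Par a)) (Finₚ.inject≤-injective ≤P ≤P (Any.index i∈) (Any.index j∈) eq)) (sym (lookup-index j∈))))

    ∼⇒label-≡ : ∀ {a P i j} (≤P : length (Par a) ≤ suc P) → a +e i ∈ 𝒥 → a +e j ∈ 𝒥 →
      i ∼[ a ] j → label {a} ≤P i ≡ label {a} ≤P j
    ∼⇒label-≡ {a} ≤P a+i∈ a+j∈ i∼j =
      cong (λ K → position {a} ≤P K (K ∈? Par a)) (∼⇒class-≡ a+i∈ a+j∈ i∼j)

    ∈-level : ∀ {a k} → a ∈ 𝒥 → Vec.sum a ≡ k → a ∈ level k
    ∈-level {k = k} a∈ eq = ∈-filter⁺ (λ a → Vec.sum a ≟ k) a∈ eq

    Par≤p : ∀ {a k} → a ∈ 𝒥 → Vec.sum a ≡ k → length (Par a) ≤ p k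
    Par≤p {a} {k} a∈ eq = All.lookup (xs≤max 0 (map (length ∘ Par) (level k))) (∈-map⁺ (length ∘ Par) (∈-level a∈ eq))

    -- Removing two units from distinct coordinates i, j of a would leave i and j
    -- in different classes.
    π-positive : ∀ {a m} → p m ≡ 1 → a ∈ 𝒥 → Vec.sum a ≡ suc (suc m) → 0 < π a
    π-positive {a} {m} p≡1 a∈ eq with positive-entry a eq
    ... | a′ , i , refl with positive-entry a′ (suc-injective (trans (sym (sum-+e a′ i)) eq))
    ... | b , j , refl with j ≟ᶠ i
    ... | yes refl = ≤-trans (s≤s z≤n) (≤-reflexive (sym (trans (π-+e (b +e j) j) (cong (_+ π (b +e j)) (lookup-+e b j)))))
    ... | no j≢i   = contradiction (label-≡⇒∼ {b} ≤1 b+j∈ b+i∈ (fin1 _ _)) λ where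
        (inj₁ j≡i) → j≢i j≡i
        (inj₂ ∉)   → ∉ a∈
      where
      b+j∈ : b +e j ∈ 𝒥
      b+j∈ = lower a∈
      b+i∈ : b +e i ∈ 𝒥
      b+i∈ = lower (swap a∈)
      ≤1 : length (Par b) ≤ 1
      ≤1 = subst (length (Par b) ≤_) p≡1 (Par≤p (lower b+j∈)
             (suc-injective (trans (sym (sum-+e b j)) (suc-injective (trans (sym (sum-+e (b +e j) i)) eq)))))
      fin1 : ∀ (x y : Fin 1) → x ≡ y
      fin1 zero zero = refl

-- The weighted forms and the induction on the degree.

module Hyperbolicity where
  open import Data.Bool using (if_then_else_)
  open import Data.Fin using (Fin; zero; suc)
  open import Data.Fin.Properties using () renaming (_≟_ to _≟ᶠ_)
  open import Data.List using (length)
  open import Data.List.Membership.Propositional using (_∈_; _∉_)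
  open import Data.Nat as ℕ using (ℕ; zero; suc)
  import Data.Nat.Properties as ℕ
  open import Data.Product using (∃; _,_; proj₁; proj₂)
  open import Data.Rational
  open import Data.Rational.Properties
  open import Data.Sum using (inj₁; inj₂)
  open import Data.Vec as Vec using (Vec; []; _∷_; lookup)
  import Data.Vec.Functional as VecF
  open import Function using (_∘_)
  open import Relation.Binary.PropositionalEquality
  open import Relation.Nullary using (Dec; yes; no; does; ¬_)
  open import Relation.Nullary.Decidable using (dec-true; dec-false)
  open import Tactic.RingSolver using (solve-∀)
  open import Algebra.Bundles using (CommutativeRing)
  open import Algebra.Properties.Semiring.Sum (CommutativeRing.semiring +-*-commutativeRing) using (sum; sum-cong-≗; ∑-distrib-+; ∑-comm; *-distribˡ-sum; *-distribʳ-sum)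
  open import Algebra.Properties.Semiring.Exp (CommutativeRing.semiring +-*-commutativeRing) using (_^_; ^-homo-*)
  open Arithmetic
  open Forms
  open Exchange
  open import Defs using (DiscretePolymatroid; _+e_; π)

  ind : ∀ {P : Set} → Dec P → ℚ
  ind d = if does d then 1ℚ else 0ℚ

  ind-yes : ∀ {P : Set} (d : Dec P) → P → ind d ≡ 1ℚ
  ind-yes d p = cong (if_then 1ℚ else 0ℚ) (dec-true d p)

  ind-no : ∀ {P : Set} (d : Dec P) → ¬ P → ind d ≡ 0ℚ
  ind-no d ¬p = cong (if_then 1ℚ else 0ℚ) (dec-false d ¬p)

  δ : ∀ {N} → Fin N → Fin N → ℚ
  δ k c = ind (k ≟ᶠ c)

  sum-δ : ∀ {N} (k : Fin N) (f : Fin N → ℚ) → sum (λ c → δ k c * f c) ≡ f k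
  sum-δ zero    f = trans (cong₂ _+_ (*-identityˡ (f zero)) (sum-zero (λ c → *-zeroˡ (f (suc c))))) (+-identityʳ (f zero))
  sum-δ (suc k) f = trans (cong₂ _+_ (*-zeroˡ (f zero)) (sum-δ k (f ∘ suc))) (+-identityˡ (f (suc k)))

  -- The natural number N in `ℚ`, written as a sum so that `ones (suc N)` unfolds to `1ℚ + ones N`
  -- and row sums of all-ones matrices have this form.
  ones : ℕ → ℚ
  ones N = sum {N} (λ _ → 1ℚ)

  -- Cauchy-Schwarz against the all-ones vector: it is `qA≤row` for the matrix with every entry 1,
  -- whose rows all sum to `ones N`.
  square-sum≤ : ∀ {N} (σ : Fin N → ℚ) → sum σ * sum σ ≤ ones N * sum (λ c → σ c * σ c)
  square-sum≤ {N} σ = subst₂ _≤_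
    (trans (sum-cong-≗ (λ i → cong (σ i *_) (sum-cong-≗ (λ j → *-identityˡ (σ j))))) (sym (*-distribʳ-sum (sum σ) σ)))
    (sym (*-distribˡ-sum (ones N) (λ c → σ c * σ c)))
    (qA≤row (λ _ _ → refl) (λ _ _ → nonNegative⁻¹ 1ℚ) σ)
    where open BorderedForm {N} 0ℚ (λ _ → 0ℚ) (λ _ _ → 1ℚ)

  module Classes {n N : ℕ} (κ : Fin n → Fin N) where

    classSum : (Fin n → ℚ) → Fin N → ℚ
    classSum u c = sum (λ i → u i * δ (κ i) c)

    sum-classSum : ∀ u → sum (classSum u) ≡ sum u
    sum-classSum u = trans (∑-comm (λ c i → u i * δ (κ i) c)) (sum-cong-≗ λ i →
      trans (sum-cong-≗ (λ c → *-comm (u i) (δ (κ i) c))) (sum-δ (κ i) (λ _ → u i)))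

    sum-square-classSum : ∀ u → sum (λ i → u i * classSum u (κ i)) ≡ sum (λ c → classSum u c * classSum u c)
    sum-square-classSum u = sym (begin
      sum (λ c → classSum u c * classSum u c)
        ≡⟨ sum-cong-≗ (λ c → *-distribʳ-sum (classSum u c) (λ i → u i * δ (κ i) c)) ⟩
      sum (λ c → sum (λ i → u i * δ (κ i) c * classSum u c))
        ≡⟨ ∑-comm (λ c i → u i * δ (κ i) c * classSum u c) ⟩
      sum (λ i → sum (λ c → u i * δ (κ i) c * classSum u c))
        ≡⟨ sum-cong-≗ (λ i → trans (sum-cong-≗ (λ c → *-assoc (u i) (δ (κ i) c) (classSum u c)))
             (trans (sym (*-distribˡ-sum (u i) (λ c → δ (κ i) c * classSum u c))) (cong (u i *_) (sum-δ (κ i) (classSum u))))) ⟩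
      sum (λ i → u i * classSum u (κ i)) ∎)
      where open ≡-Reasoning

    -- By the hypothesis the form of B is (sum y)² minus a square for each class;
    -- Cauchy-Schwarz over the N classes does the rest.
    class-bound : ∀ {t} → 0ℚ ≤ t → t ≤ 1ℚ → (y θ : Fin n → ℚ) (B : Fin n → Fin n → ℚ) →
      (∀ i j → y i * (B i j * y j) ≡ y i * y j - (1ℚ - t) * (y i * (y j * δ (κ j) (κ i)))
                                     - t * (θ i * y i * (θ j * y j * δ (κ j) (κ i)))) →
      ones N * sum (λ i → sum (λ j → y i * (B i j * y j))) ≤ (ones N - 1ℚ + t) * (sum y * sum y)
    class-bound {t} 0≤t t≤1 y θ B B≡ = 0≤q-p⇒p≤q (subst (0ℚ ≤_) (sym difference)
      (+-nonneg (*-nonneg (p≤q⇒0≤q-p t≤1) (p≤q⇒0≤q-p CS))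
                (*-nonneg (sum-nonneg {N} (λ _ → nonNegative⁻¹ 1ℚ)) (*-nonneg 0≤t (sum-nonneg (λ c → square-nonneg (classSum θy c)))))))
      where
      open ≡-Reasoning
      θy : Fin n → ℚ
      θy i = θ i * y i
      S Q R M : ℚ
      S = sum y
      Q = sum (λ c → classSum y c * classSum y c)
      R = sum (λ c → classSum θy c * classSum θy c)
      M = sum (λ i → sum (λ j → y i * (B i j * y j)))
      CS : S * S ≤ ones N * Q
      CS = subst (λ s → s * s ≤ ones N * Q) (sum-classSum y) (square-sum≤ (classSum y))
      inner : ∀ i → sum (λ j → y i * (B i j * y j))
              ≡ y i * S - (1ℚ - t) * (y i * classSum y (κ i)) - t * (θy i * classSum θy (κ i))
      inner i = begin
        sum (λ j → y i * (B i j * y j))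
          ≡⟨ sum-cong-≗ (B≡ i) ⟩
        sum (λ j → y i * y j - (1ℚ - t) * (y i * (y j * δ (κ j) (κ i))) - t * (θy i * (θy j * δ (κ j) (κ i))))
          ≡⟨ sum-distrib-- (λ j → y i * y j - (1ℚ - t) * (y i * (y j * δ (κ j) (κ i)))) (λ j → t * (θy i * (θy j * δ (κ j) (κ i)))) ⟩
        sum (λ j → y i * y j - (1ℚ - t) * (y i * (y j * δ (κ j) (κ i)))) - sum (λ j → t * (θy i * (θy j * δ (κ j) (κ i))))
          ≡⟨ cong₂ _-_ (trans (sum-distrib-- (λ j → y i * y j) (λ j → (1ℚ - t) * (y i * (y j * δ (κ j) (κ i)))))
               (cong₂ _-_ (sym (*-distribˡ-sum (y i) y)) (pull (1ℚ - t) (y i) (λ j → y j * δ (κ j) (κ i)))))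
               (pull t (θy i) (λ j → θy j * δ (κ j) (κ i))) ⟩
        y i * S - (1ℚ - t) * (y i * classSum y (κ i)) - t * (θy i * classSum θy (κ i)) ∎
        where
        pull : ∀ p q (f : Fin n → ℚ) → sum (λ j → p * (q * f j)) ≡ p * (q * sum f)
        pull p q f = trans (sym (*-distribˡ-sum p (λ j → q * f j))) (cong (p *_) (sym (*-distribˡ-sum q f)))
      M≡ : M ≡ S * S - (1ℚ - t) * Q - t * R
      M≡ = begin
        M
          ≡⟨ sum-cong-≗ inner ⟩
        sum (λ i → y i * S - (1ℚ - t) * (y i * classSum y (κ i)) - t * (θy i * classSum θy (κ i)))
          ≡⟨ sum-distrib-- (λ i → y i * S - (1ℚ - t) * (y i * classSum y (κ i))) (λ i → t * (θy i * classSum θy (κ i))) ⟩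
        sum (λ i → y i * S - (1ℚ - t) * (y i * classSum y (κ i))) - sum (λ i → t * (θy i * classSum θy (κ i)))
          ≡⟨ cong₂ _-_ (sum-distrib-- (λ i → y i * S) (λ i → (1ℚ - t) * (y i * classSum y (κ i))))
               (trans (sym (*-distribˡ-sum t (λ i → θy i * classSum θy (κ i)))) (cong (t *_) (sum-square-classSum θy))) ⟩
        sum (λ i → y i * S) - sum (λ i → (1ℚ - t) * (y i * classSum y (κ i))) - t * R
          ≡⟨ cong₂ (λ p q → p - q - t * R) (sym (*-distribʳ-sum S y))
               (trans (sym (*-distribˡ-sum (1ℚ - t) (λ i → y i * classSum y (κ i)))) (cong ((1ℚ - t) *_) (sum-square-classSum y))) ⟩
        S * S - (1ℚ - t) * Q - t * R ∎
      -- The slack splits into 1 - t times the Cauchy-Schwarz deficit over the classes and t times a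
      -- sum of squares. The range of `t` is what makes both nonnegative, and the denominator p - 1
      -- + t originates here.
      difference : (ones N - 1ℚ + t) * (S * S) - ones N * M ≡ (1ℚ - t) * (ones N * Q - S * S) + ones N * (t * R)
      difference = trans (cong (λ m → (ones N - 1ℚ + t) * (S * S) - ones N * m) M≡) (expand (ones N) t S Q R)
        where
        expand : ∀ o t S Q R → (o - 1ℚ + t) * (S * S) - o * (S * S - (1ℚ - t) * Q - t * R)
                 ≡ (1ℚ - t) * (o * Q - S * S) + o * (t * R)
        expand = solve-∀ ringℚ

  weightℚ : ∀ {n} → (Fin n → ℚ) → Vec ℕ n → ℚ
  weightℚ ω a = VecF.foldr _*_ 1ℚ (λ i → ω i ^ lookup a i)

  weightℚ-+e : ∀ {n} (ω : Fin n → ℚ) a i → weightℚ ω (a +e i) ≡ ω i * weightℚ ω a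
  weightℚ-+e ω (x ∷ a) zero    = *-assoc (ω zero) (ω zero ^ x) (weightℚ (ω ∘ suc) a)
  weightℚ-+e ω (x ∷ a) (suc i) = trans (cong (ω zero ^ x *_) (weightℚ-+e (ω ∘ suc) a i))
                                       (rotate (ω zero ^ x) (ω (suc i)) (weightℚ (ω ∘ suc) a))
    where
    rotate : ∀ p q r → p * (q * r) ≡ q * (p * r)
    rotate = solve-∀ ringℚ

  ^-positive : ∀ {p} → 0ℚ < p → ∀ m → 0ℚ < p ^ m
  ^-positive 0<p zero    = positive⁻¹ 1ℚ
  ^-positive 0<p (suc m) = *-positive 0<p (^-positive 0<p m)

  weightℚ-positive : ∀ {n} {ω : Fin n → ℚ} → (∀ i → 0ℚ < ω i) → ∀ a → 0ℚ < weightℚ ω a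
  weightℚ-positive 0<ω []      = positive⁻¹ 1ℚ
  weightℚ-positive 0<ω (x ∷ a) = *-positive (^-positive (0<ω zero) x) (weightℚ-positive (0<ω ∘ suc) a)

  module Weighted {n : ℕ} (D : DiscretePolymatroid n) (ω : Fin n → ℚ) (t : ℚ) where
    open DiscretePolymatroid D hiding (p)
    open Polymatroid D

    term : Vec ℕ n → ℚ
    term a = t ^ π a * weightℚ ω a

    φ : Vec ℕ n → ℚ
    φ a = ind (a ∈𝒥?) * term a

    -- S m b is m! times the b-th derivative of Σ φ a xᵃ / a! at the all-ones
    -- point, restricted to degree |b| + m.
    S : ℕ → Vec ℕ n → ℚ
    S zero    a = φ a
    S (suc m) a = sum (λ i → S m (a +e i))

    -- The ratio of `term` at `a +e i` to `term` at `a`; the power of `t` is the increment of the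
    -- binomial coefficient in `π`.
    step : Vec ℕ n → Fin n → ℚ
    step a i = t ^ lookup a i * ω i

    -- Raising the same coordinate twice costs one more factor `t` than raising two different
    -- coordinates.
    diag : Fin n → Fin n → ℚ
    diag i j = if does (i ≟ᶠ j) then t else 1ℚ

    term-+e : ∀ a i → term (a +e i) ≡ step a i * term a
    term-+e a i = begin
      t ^ π (a +e i) * weightℚ ω (a +e i)
        ≡⟨ cong₂ _*_ (trans (cong (t ^_) (π-+e a i)) (^-homo-* t (lookup a i) (π a))) (weightℚ-+e ω a i) ⟩
      t ^ lookup a i * t ^ π a * (ω i * weightℚ ω a)
        ≡⟨ rearrange (t ^ lookup a i) (t ^ π a) (ω i) (weightℚ ω a) ⟩
      step a i * term a ∎
      where
      open ≡-Reasoning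
      rearrange : ∀ p q r s → p * q * (r * s) ≡ p * r * (q * s)
      rearrange = solve-∀ ringℚ

    step-+e : ∀ a i j → step (a +e i) j ≡ diag i j * step a j
    step-+e a i j with i ≟ᶠ j
    ... | yes refl = trans (cong (λ m → t ^ m * ω i) (lookup-+e a i)) (*-assoc t (t ^ lookup a i) (ω i))
    ... | no i≢j   = trans (cong (λ m → t ^ m * ω j) (lookup-+e-≢ a (i≢j ∘ sym))) (sym (*-identityˡ (step a j)))

    φ-∉ : ∀ {a} → a ∉ 𝒥 → φ a ≡ 0ℚ
    φ-∉ {a} a∉ = trans (cong (_* term a) (ind-no (a ∈𝒥?) a∉)) (*-zeroˡ (term a))

    φ-∈ : ∀ {a} → a ∈ 𝒥 → φ a ≡ term a
    φ-∈ {a} a∈ = trans (cong (_* term a) (ind-yes (a ∈𝒥?) a∈)) (*-identityˡ (term a))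

    S-∉ : ∀ m {a} → a ∉ 𝒥 → S m a ≡ 0ℚ
    S-∉ zero    a∉ = φ-∉ a∉
    S-∉ (suc m) a∉ = sum-zero {n} (λ i → S-∉ m (a∉ ∘ lower {i = i}))

    module Positive (0<ω : ∀ i → 0ℚ < ω i) (0<t : 0ℚ < t) (t≤1 : t ≤ 1ℚ) where

      term-positive : ∀ a → 0ℚ < term a
      term-positive a = *-positive (^-positive 0<t (π a)) (weightℚ-positive 0<ω a)

      S-nonneg : ∀ m a → 0ℚ ≤ S m a
      S-nonneg (suc m) a = sum-nonneg (λ i → S-nonneg m (a +e i))
      S-nonneg zero    a with a ∈𝒥?
      ... | yes a∈ = *-nonneg (nonNegative⁻¹ 1ℚ) (<⇒≤ (term-positive a))
      ... | no  a∉ = ≤-reflexive (sym (*-zeroˡ (term a)))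

      -- Below the rank some a + eᵢ stays in `𝒥`, so one summand is positive by induction and the
      -- others are nonnegative.
      S-positive : ∀ m {a} → a ∈ 𝒥 → Vec.sum a ℕ.+ m ℕ.≤ rk → 0ℚ < S m a
      S-positive zero    {a} a∈ ≤rk = subst (0ℚ <_) (sym (φ-∈ a∈)) (term-positive a)
      S-positive (suc m) {a} a∈ ≤rk with extend a∈ (ℕ.<-≤-trans (ℕ.m<m+n (Vec.sum a) ℕ.z<s) ≤rk)
      ... | i , a+i∈ = <-≤-trans (S-positive m a+i∈ (subst (ℕ._≤ rk) (trans (ℕ.+-suc (Vec.sum a) m) (cong (ℕ._+ m) (sym (sum-+e a i)))) ≤rk))
                                 (term≤sum (λ i → S-nonneg m (a +e i)) i)

      module _ (P K : ℕ) (K<rk : suc K ℕ.< rk)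
               (≤P : ∀ {a} → a ∈ 𝒥 → Vec.sum a ≡ K → length (Par a) ℕ.≤ suc P)
               (c : ℚ) (c≡ : c * (ones (suc P) - 1ℚ + t) ≡ ones (suc P)) where

        module F (m : ℕ) (a : Vec ℕ n) = BorderedForm (c * S m a) (λ i → S m (a +e i)) (λ i j → S m (a +e i +e j))

        F-sym : ∀ m a i j → S m (a +e i +e j) ≡ S m (a +e j +e i)
        F-sym m a i j = cong (S m) (+e-comm a i j)

        p den : ℚ
        p   = ones (suc P)
        den = p - 1ℚ + t

        0<p : 0ℚ < p
        0<p = <-≤-trans (positive⁻¹ 1ℚ) (term≤sum {suc P} (λ _ → nonNegative⁻¹ 1ℚ) zero)

        module _ {a : Vec ℕ n} (a∈ : a ∈ 𝒥) (|a|≡K : Vec.sum a ≡ K) where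
          private
            κ : Fin n → Fin (suc P)
            κ = label {a} (≤P a∈ |a|≡K)
            χ θ : Fin n → ℚ
            χ i = ind ((a +e i) ∈𝒥?)
            θ i = 1ℚ - ind ((a +e i +e i) ∈𝒥?)
            B : Fin n → Fin n → ℚ
            B i j = ind ((a +e i +e j) ∈𝒥?) * diag i j
            sw : Fin n → ℚ
            sw i = χ i * step a i

          -- By `no-square`, a coordinate equivalent to a different one cannot be raised twice.
          -- Hence within a class the entry is either the diagonal value `t` of a repeatable
          -- coordinate, where θ is 0, or it is 0 with θ equal to 1 at both ends, and 1 - (1 - t) -
          -- t = 0. Between different classes the entry is 1.
          B-classes : ∀ {i j} → a +e i ∈ 𝒥 → a +e j ∈ 𝒥 →
            B i j ≡ 1ℚ - (1ℚ - t) * δ (κ j) (κ i) - t * (θ i * (θ j * δ (κ j) (κ i)))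
          B-classes {i} {j} i∈ j∈ = case ((a +e i +e j) ∈𝒥?) (i ≟ᶠ j)
            where
            formula : ∀ {b b′ d d′ x x′ y y′} → b ≡ b′ → d ≡ d′ → x ≡ x′ → y ≡ y′ →
              b′ ≡ 1ℚ - (1ℚ - t) * d′ - t * ((1ℚ - x′) * ((1ℚ - y′) * d′)) →
              b ≡ 1ℚ - (1ℚ - t) * d - t * ((1ℚ - x) * ((1ℚ - y) * d))
            formula refl refl refl refl eq = eq
            diagonal : ∀ t → 1ℚ * t ≡ 1ℚ - (1ℚ - t) * 1ℚ - t * ((1ℚ - 1ℚ) * ((1ℚ - 1ℚ) * 1ℚ))
            diagonal = solve-∀ ringℚ
            off-class : ∀ t x y → 1ℚ * 1ℚ ≡ 1ℚ - (1ℚ - t) * 0ℚ - t * ((1ℚ - x) * ((1ℚ - y) * 0ℚ))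
            off-class = solve-∀ ringℚ
            in-class : ∀ t d → 0ℚ * d ≡ 1ℚ - (1ℚ - t) * 1ℚ - t * ((1ℚ - 0ℚ) * ((1ℚ - 0ℚ) * 1ℚ))
            in-class = solve-∀ ringℚ
            diag-≡ : ∀ {i} → diag i i ≡ t
            diag-≡ {i} = cong (if_then t else 1ℚ) (dec-true (i ≟ᶠ i) refl)
            diag-≢ : i ≢ j → diag i j ≡ 1ℚ
            diag-≢ i≢j = cong (if_then t else 1ℚ) (dec-false (i ≟ᶠ j) i≢j)
            no-square : ∀ {i j} → a +e j ∈ 𝒥 → a +e i +e j ∉ 𝒥 → a +e i +e i ∉ 𝒥
            no-square {i} {j} j∈ ∉ij ∈ii with exchange₂ j∈ ∈ii
            ... | inj₁ ∈ji = ∉ij (swap ∈ji)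
            ... | inj₂ ∈ji = ∉ij (swap ∈ji)
            case : Dec (a +e i +e j ∈ 𝒥) → Dec (i ≡ j) →
              B i j ≡ 1ℚ - (1ℚ - t) * δ (κ j) (κ i) - t * (θ i * (θ j * δ (κ j) (κ i)))
            case (yes ∈ij) (yes refl) = formula
              (cong₂ _*_ (ind-yes ((a +e i +e i) ∈𝒥?) ∈ij) (diag-≡ {i})) (ind-yes (κ i ≟ᶠ κ i) refl)
              (ind-yes ((a +e i +e i) ∈𝒥?) ∈ij) (ind-yes ((a +e i +e i) ∈𝒥?) ∈ij) (diagonal t)
            case (yes ∈ij) (no i≢j) = formula {x = ind ((a +e i +e i) ∈𝒥?)} {y = ind ((a +e j +e j) ∈𝒥?)}
              (cong₂ _*_ (ind-yes ((a +e i +e j) ∈𝒥?) ∈ij) (diag-≢ i≢j)) (ind-no (κ j ≟ᶠ κ i) distinct)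
              refl refl (off-class t (ind ((a +e i +e i) ∈𝒥?)) (ind ((a +e j +e j) ∈𝒥?)))
              where
              distinct : κ j ≢ κ i
              distinct eq with label-≡⇒∼ {a} (≤P a∈ |a|≡K) j∈ i∈ eq
              ... | inj₁ j≡i = i≢j (sym j≡i)
              ... | inj₂ ∉ji = ∉ji (swap ∈ij)
            case (no ∉ij) _ = formula
              (cong (_* diag i j) (ind-no ((a +e i +e j) ∈𝒥?) ∉ij))
              (ind-yes (κ j ≟ᶠ κ i) (∼⇒label-≡ {a} (≤P a∈ |a|≡K) j∈ i∈ (inj₂ (∉ij ∘ swap))))
              (ind-no ((a +e i +e i) ∈𝒥?) (no-square j∈ ∉ij)) (ind-no ((a +e j +e j) ∈𝒥?) (no-square i∈ (∉ij ∘ swap)))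
              (in-class t (diag i j))

          -- The indicators inside `sw` may be inserted because `𝒥` is hereditary. They confine the
          -- vector y i = sw i * v i below to the coordinates in `Cont a`, where `B-classes`
          -- applies.
          φ₂ : ∀ i j → φ (a +e i +e j) ≡ term a * (sw i * (B i j * sw j))
          φ₂ i j with (a +e i +e j) ∈𝒥?
          ... | no ∉ij = vanish (term (a +e i +e j)) (term a) (sw i) (diag i j) (sw j)
            where
            vanish : ∀ x y z d w → 0ℚ * x ≡ y * (z * (0ℚ * d * w))
            vanish = solve-∀ ringℚ
          ... | yes ∈ij = begin
            1ℚ * term (a +e i +e j)
              ≡⟨ cong (1ℚ *_) (trans (term-+e (a +e i) j) (cong₂ _*_ (step-+e a i j) (term-+e a i))) ⟩
            1ℚ * (diag i j * step a j * (step a i * term a))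
              ≡⟨ rearrange (diag i j) (step a j) (step a i) (term a) ⟩
            term a * (1ℚ * step a i * (1ℚ * diag i j * (1ℚ * step a j)))
              ≡⟨ cong₂ (λ x y → term a * (x * step a i * (1ℚ * diag i j * (y * step a j))))
                   (ind-yes ((a +e i) ∈𝒥?) (lower ∈ij)) (ind-yes ((a +e j) ∈𝒥?) (lower (swap ∈ij))) ⟨
            term a * (sw i * (1ℚ * diag i j * sw j)) ∎
            where
            open ≡-Reasoning
            rearrange : ∀ d s r x → 1ℚ * (d * s * (r * x)) ≡ x * (1ℚ * r * (1ℚ * d * (1ℚ * s)))
            rearrange = solve-∀ ringℚ

          φ₁ : ∀ i → φ (a +e i) ≡ term a * sw i
          φ₁ i = trans (cong (χ i *_) (term-+e a i)) (rotate (χ i) (step a i) (term a))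
            where
            rotate : ∀ p q r → p * (q * r) ≡ r * (p * q)
            rotate = solve-∀ ringℚ

          -- The hyperplane is the orthogonal complement of the corner direction. With Y the sum of
          -- the y i = sw i * v i, the form is τ (c v₀² + 2 v₀ Y + M) and the complement is c v₀ + Y
          -- = 0, multiplied here by `den` to avoid division. On it c v₀² + 2 v₀ Y = -(den / p) Y²,
          -- since c * den = p, and `class-bound` gives M ≤ (den / p) Y².
          base-hyperplane : ∀ v₀ v → v₀ * p + sum (λ i → den * sw i * v i) ≡ 0ℚ → F.q 0 a v₀ v ≤ 0ℚ
          base-hyperplane v₀ v on = cancel-*-≤ (p * p) (*-positive 0<p 0<p)
            (0≤q-p⇒p≤q (subst (0ℚ ≤_) (sym difference) (*-nonneg (<⇒≤ (*-positive (term-positive a) 0<p)) (p≤q⇒0≤q-p bound))))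
            where
            open ≡-Reasoning
            τ Sy M : ℚ
            τ = term a
            y : Fin n → ℚ
            y i = sw i * v i
            Sy = sum y
            M = sum (λ i → sum (λ j → y i * (B i j * y j)))
            y-zero : ∀ {i} → a +e i ∉ 𝒥 → y i ≡ 0ℚ
            y-zero {i} i∉ = trans (cong (λ x → x * step a i * v i) (ind-no ((a +e i) ∈𝒥?) i∉)) (vanish (step a i) (v i))
              where
              vanish : ∀ s v → 0ℚ * s * v ≡ 0ℚ
              vanish = solve-∀ ringℚ
            By : ∀ i j → y i * (B i j * y j) ≡ y i * y j - (1ℚ - t) * (y i * (y j * δ (κ j) (κ i)))
                                               - t * (θ i * y i * (θ j * y j * δ (κ j) (κ i)))
            By i j = case ((a +e i) ∈𝒥?) ((a +e j) ∈𝒥?)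
              where
              Goal : ℚ → ℚ → Set
              Goal x z = x * (B i j * z) ≡ x * z - (1ℚ - t) * (x * (z * δ (κ j) (κ i))) - t * (θ i * x * (θ j * z * δ (κ j) (κ i)))
              zeroˡ : ∀ z b u d h k t → 0ℚ * (b * z) ≡ 0ℚ * z - u * (0ℚ * (z * d)) - t * (h * 0ℚ * (k * z * d))
              zeroˡ = solve-∀ ringℚ
              zeroʳ : ∀ x b u d h k t → x * (b * 0ℚ) ≡ x * 0ℚ - u * (x * (0ℚ * d)) - t * (h * x * (k * 0ℚ * d))
              zeroʳ = solve-∀ ringℚ
              expand : ∀ x z t d h k → x * ((1ℚ - (1ℚ - t) * d - t * (h * (k * d))) * z)
                       ≡ x * z - (1ℚ - t) * (x * (z * d)) - t * (h * x * (k * z * d))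
              expand = solve-∀ ringℚ
              case : Dec (a +e i ∈ 𝒥) → Dec (a +e j ∈ 𝒥) → Goal (y i) (y j)
              case (no i∉) _ = subst (λ x → Goal x (y j)) (sym (y-zero i∉)) (zeroˡ (y j) (B i j) (1ℚ - t) (δ (κ j) (κ i)) (θ i) (θ j) t)
              case (yes _) (no j∉) = subst (Goal (y i)) (sym (y-zero j∉)) (zeroʳ (y i) (B i j) (1ℚ - t) (δ (κ j) (κ i)) (θ i) (θ j) t)
              case (yes i∈) (yes j∈) = trans (cong (λ b → y i * (b * y j)) (B-classes i∈ j∈)) (expand (y i) (y j) t (δ (κ j) (κ i)) (θ i) (θ j))
            bound : p * M ≤ den * (Sy * Sy)
            bound = Classes.class-bound κ (<⇒≤ 0<t) t≤1 y θ B By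
            pv₀ : v₀ * p ≡ - (den * Sy)
            pv₀ = begin
              v₀ * p
                ≡⟨ isolate (v₀ * p) (den * Sy) ⟩
              v₀ * p + den * Sy - den * Sy
                ≡⟨ cong (λ x → v₀ * p + x - den * Sy) (trans (*-distribˡ-sum den y) (sum-cong-≗ (λ i → sym (*-assoc den (sw i) (v i))))) ⟩
              v₀ * p + sum (λ i → den * sw i * v i) - den * Sy
                ≡⟨ trans (cong (_- den * Sy) on) (+-identityˡ (- (den * Sy))) ⟩
              - (den * Sy) ∎
              where
              isolate : ∀ x y → x ≡ x + y - y
              isolate = solve-∀ ringℚ
            bv≡ : sum (λ i → φ (a +e i) * v i) ≡ τ * Sy
            bv≡ = trans (sum-cong-≗ (λ i → trans (cong (_* v i) (φ₁ i)) (*-assoc τ (sw i) (v i)))) (sym (*-distribˡ-sum τ y))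
            vg≡ : sum (λ i → v i * F.grad 0 a v₀ v i) ≡ v₀ * (τ * Sy) + τ * M
            vg≡ = begin
              sum (λ i → v i * F.grad 0 a v₀ v i)
                ≡⟨ sum-cong-≗ (λ i → trans (cong (λ x → v i * (v₀ * x + sum (λ j → φ (a +e i +e j) * v j))) (φ₁ i))
                     (trans (expand (v i) v₀ τ (sw i) (sum (λ j → φ (a +e i +e j) * v j)))
                       (cong (v₀ * (τ * y i) +_) (inner i)))) ⟩
              sum (λ i → v₀ * (τ * y i) + τ * sum (λ j → y i * (B i j * y j)))
                ≡⟨ ∑-distrib-+ (λ i → v₀ * (τ * y i)) (λ i → τ * sum (λ j → y i * (B i j * y j))) ⟩
              sum (λ i → v₀ * (τ * y i)) + sum (λ i → τ * sum (λ j → y i * (B i j * y j)))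
                ≡⟨ cong₂ _+_ (trans (sym (*-distribˡ-sum v₀ (λ i → τ * y i))) (cong (v₀ *_) (sym (*-distribˡ-sum τ y))))
                             (sym (*-distribˡ-sum τ (λ i → sum (λ j → y i * (B i j * y j))))) ⟩
              v₀ * (τ * Sy) + τ * M ∎
              where
              expand : ∀ v v₀ τ s r → v * (v₀ * (τ * s) + r) ≡ v₀ * (τ * (s * v)) + v * r
              expand = solve-∀ ringℚ
              entry : ∀ τ s b r v w → v * (τ * (s * (b * r)) * w) ≡ τ * (s * v * (b * (r * w)))
              entry = solve-∀ ringℚ
              inner : ∀ i → v i * sum (λ j → φ (a +e i +e j) * v j) ≡ τ * sum (λ j → y i * (B i j * y j))
              inner i = begin
                v i * sum (λ j → φ (a +e i +e j) * v j)
                  ≡⟨ *-distribˡ-sum (v i) (λ j → φ (a +e i +e j) * v j) ⟩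
                sum (λ j → v i * (φ (a +e i +e j) * v j))
                  ≡⟨ sum-cong-≗ (λ j → trans (cong (λ x → v i * (x * v j)) (φ₂ i j)) (entry τ (sw i) (B i j) (sw j) (v i) (v j))) ⟩
                sum (λ j → τ * (y i * (B i j * y j)))
                  ≡⟨ *-distribˡ-sum τ (λ j → y i * (B i j * y j)) ⟨
                τ * sum (λ j → y i * (B i j * y j)) ∎
            q≡ : F.q 0 a v₀ v ≡ v₀ * (c * τ * v₀ + τ * Sy) + (v₀ * (τ * Sy) + τ * M)
            q≡ = cong₂ _+_ (cong₂ (λ x z → v₀ * (c * x * v₀ + z)) (φ-∈ a∈) bv≡) vg≡
            difference : p * p * 0ℚ - p * p * F.q 0 a v₀ v ≡ τ * p * (den * (Sy * Sy) - p * M)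
            difference = begin
              p * p * 0ℚ - p * p * F.q 0 a v₀ v
                ≡⟨ cong (λ x → p * p * 0ℚ - p * p * x) q≡ ⟩
              p * p * 0ℚ - p * p * (v₀ * (c * τ * v₀ + τ * Sy) + (v₀ * (τ * Sy) + τ * M))
                ≡⟨ expand₁ p v₀ c τ Sy M ⟩
              - τ * (c * (v₀ * p) * (v₀ * p) + 2ℚ * p * (v₀ * p) * Sy + p * p * M)
                ≡⟨ cong (λ x → - τ * (c * x * x + 2ℚ * p * x * Sy + p * p * M)) pv₀ ⟩
              - τ * (c * (- (den * Sy)) * (- (den * Sy)) + 2ℚ * p * (- (den * Sy)) * Sy + p * p * M)
                ≡⟨ expand₂ τ c den Sy p M ⟩
              - τ * (c * den * den * Sy * Sy - 2ℚ * p * den * Sy * Sy + p * p * M)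
                ≡⟨ cong (λ x → - τ * (x * den * Sy * Sy - 2ℚ * p * den * Sy * Sy + p * p * M)) c≡ ⟩
              - τ * (p * den * Sy * Sy - 2ℚ * p * den * Sy * Sy + p * p * M)
                ≡⟨ expand₃ τ p den Sy M ⟩
              τ * p * (den * (Sy * Sy) - p * M) ∎
              where
              expand₁ : ∀ p v₀ c τ S M → p * p * 0ℚ - p * p * (v₀ * (c * τ * v₀ + τ * S) + (v₀ * (τ * S) + τ * M))
                        ≡ - τ * (c * (v₀ * p) * (v₀ * p) + (1ℚ + 1ℚ) * p * (v₀ * p) * S + p * p * M)
              expand₁ = solve-∀ ringℚ
              expand₂ : ∀ τ c d S p M → - τ * (c * (- (d * S)) * (- (d * S)) + (1ℚ + 1ℚ) * p * (- (d * S)) * S + p * p * M)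
                        ≡ - τ * (c * d * d * S * S - (1ℚ + 1ℚ) * p * d * S * S + p * p * M)
              expand₂ = solve-∀ ringℚ
              expand₃ : ∀ τ p d S M → - τ * (p * d * S * S - (1ℚ + 1ℚ) * p * d * S * S + p * p * M) ≡ τ * p * (d * (S * S) - p * M)
              expand₃ = solve-∀ ringℚ

        -- `reversed-CS` asks for some hyperplane on which the form is nonpositive. At m = 0 it is
        -- the complement of the corner direction; for larger m it is the complement of the all-ones
        -- vector, in the shape given by `ℓ-as-row`. For a outside `𝒥` the left-hand side is 0.
        hyperbolic : ∀ m a → Vec.sum a ℕ.+ m ≡ K → ∀ v₀ v → S (2 ℕ.+ m) a * F.q m a v₀ v ≤ F.ℓ m a v₀ v * F.ℓ m a v₀ v
        hyperbolic m a eq v₀ v with a ∈𝒥?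
        ... | no a∉ = subst (_≤ F.ℓ m a v₀ v * F.ℓ m a v₀ v)
          (sym (trans (cong (_* F.q m a v₀ v) (S-∉ (2 ℕ.+ m) a∉)) (*-zeroˡ (F.q m a v₀ v)))) (square-nonneg (F.ℓ m a v₀ v))
        hyperbolic zero a eq v₀ v | yes a∈ =
          F.reversed-CS 0 a (F-sym 0 a) (S-nonneg 2 a) p (λ i → den * (ind ((a +e i) ∈𝒥?) * step a i)) (base-hyperplane a∈ (trans (sym (ℕ.+-identityʳ (Vec.sum a))) eq)) v₀ v
        hyperbolic (suc m) a eq v₀ v | yes a∈ =
          F.reversed-CS (suc m) a (F-sym (suc m) a) (S-nonneg (3 ℕ.+ m) a) (S (2 ℕ.+ m) a) (F.row (suc m) a)
            (λ v₀ v on → F.local-to-global (suc m) a (F-sym (suc m) a) (λ i j → S-nonneg (suc m) (a +e i +e j))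
              (λ i → F.q m (a +e i)) q-sums local zero-row v₀ v (orthogonal v₀ v on))
            v₀ v
          where
          size₁ : ∀ i → Vec.sum (a +e i) ℕ.+ m ≡ K
          size₁ i = trans (cong (ℕ._+ m) (sum-+e a i)) (trans (sym (ℕ.+-suc (Vec.sum a) m)) eq)

          -- The left side equals K + 2, which is at most the rank because `K<rk` compares K + 1
          -- strictly.
          suc-size : ∀ i → Vec.sum (a +e i) ℕ.+ suc (suc m) ℕ.≤ rk
          suc-size i = subst (ℕ._≤ rk) (sym (trans (ℕ.+-suc (Vec.sum (a +e i)) (suc m))
            (cong suc (trans (ℕ.+-suc (Vec.sum (a +e i)) m) (cong suc (size₁ i)))))) K<rk

          size₂ : ∀ i j → Vec.sum (a +e i +e j) ℕ.+ suc m ℕ.≤ rk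
          size₂ i j = subst (ℕ._≤ rk) (trans (ℕ.+-suc (Vec.sum (a +e i)) (suc m)) (cong (ℕ._+ suc m) (sym (sum-+e (a +e i) j)))) (suc-size i)

          q-sums : ∀ v₀ v → F.q (suc m) a v₀ v ≡ sum (λ i → F.q m (a +e i) v₀ v)
          q-sums = q-sum (λ i → c * S m (a +e i)) (λ i l → S m (a +e i +e l)) (λ i l j → S m (a +e i +e l +e j))
            (*-distribˡ-sum c (λ i → S m (a +e i)))
            (λ l → sum-cong-≗ (λ i → F-sym m a l i))
            (λ l j → sum-cong-≗ (λ i → cong (S m) (trans (+e-comm (a +e l) j i) (cong (_+e j) (+e-comm a l i)))))

          local : ∀ i v₀ v → S (2 ℕ.+ m) (a +e i) * F.q m (a +e i) v₀ v ≤ F.grad (suc m) a v₀ v i * F.grad (suc m) a v₀ v i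
          local i v₀ v = subst (λ x → S (2 ℕ.+ m) (a +e i) * F.q m (a +e i) v₀ v ≤ x * x)
            (F.ℓ-as-row m (a +e i) (F-sym m (a +e i)) v₀ v) (hyperbolic m (a +e i) (size₁ i) v₀ v)

          -- By `S-positive` the row can vanish only if a + eᵢ lies outside `𝒥`, and then every
          -- coefficient of its form is zero.
          zero-row : ∀ i v₀ v → S (2 ℕ.+ m) (a +e i) ≡ 0ℚ → F.q m (a +e i) v₀ v ≡ 0ℚ
          zero-row i v₀ v row≡0 = q-sum {N = 0} (λ ()) (λ ()) (λ ())
            (trans (cong (c *_) (S-∉ m a+i∉)) (*-zeroʳ c))
            (λ l → S-∉ m (a+i∉ ∘ lower))
            (λ l j → S-∉ m (a+i∉ ∘ lower ∘ lower)) v₀ v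
            where
            a+i∉ : a +e i ∉ 𝒥
            a+i∉ a+i∈ = <-irrefl (sym row≡0) (S-positive (2 ℕ.+ m) a+i∈ (suc-size i))

          orthogonal : ∀ v₀ v → v₀ * S (2 ℕ.+ m) a + sum (λ i → F.row (suc m) a i * v i) ≡ 0ℚ →
            ∀ (f : Fin n → ℚ) → (∀ i j → 0ℚ < S (suc m) (a +e i +e j) → f i ≡ f j) →
            sum (λ i → f i * (F.row (suc m) a i * v i + v₀ * S (suc m) (a +e i))) ≡ 0ℚ
          orthogonal v₀ v on f f-const = begin
            sum (λ i → f i * r i)
              ≡⟨ sum-cong-≗ same ⟩
            sum (λ i → f i₀ * r i)
              ≡⟨ *-distribˡ-sum (f i₀) r ⟨
            f i₀ * sum r
              ≡⟨ cong (f i₀ *_) (trans (∑-distrib-+ (λ i → F.row (suc m) a i * v i) (λ i → v₀ * S (suc m) (a +e i)))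
                   (trans (cong (sum (λ i → F.row (suc m) a i * v i) +_) (sym (*-distribˡ-sum v₀ (λ i → S (suc m) (a +e i)))))
                     (trans (+-comm (sum (λ i → F.row (suc m) a i * v i)) (v₀ * S (2 ℕ.+ m) a)) on))) ⟩
            f i₀ * 0ℚ
              ≡⟨ *-zeroʳ (f i₀) ⟩
            0ℚ ∎
            where
            open ≡-Reasoning
            r : Fin n → ℚ
            r i = F.row (suc m) a i * v i + v₀ * S (suc m) (a +e i)
            below : ∀ {b s} → Vec.sum b ℕ.+ suc s ℕ.≤ rk → Vec.sum b ℕ.< rk
            below {b} = ℕ.<-≤-trans (ℕ.m<m+n (Vec.sum b) ℕ.z<s)
            start : ∃ λ i → a +e i ∈ 𝒥
            start = extend a∈ (ℕ.<-trans (ℕ.≤-<-trans (ℕ.m≤m+n (Vec.sum a) (suc m)) (ℕ.≤-reflexive (cong suc eq))) K<rk)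
            i₀ = proj₁ start
            adjacent : ∀ {i j} → a +e i +e j ∈ 𝒥 → f i ≡ f j
            adjacent {i} {j} ∈ij = f-const i j (S-positive (suc m) ∈ij (size₂ i j))
            -- Adjacency means that both coordinates can be added together. With l a neighbour of
            -- i₀, exchange makes i a neighbour of i₀ or of l, so any i in `Cont a` is at most two
            -- edges from i₀.
            connected : ∀ {i} → a +e i ∈ 𝒥 → f i ≡ f i₀
            connected {i} i∈ with extend (proj₂ start) (below {a +e i₀} (suc-size i₀))
            ... | l , i₀l∈ with exchange₂ i∈ i₀l∈
            ... | inj₁ ii₀∈ = adjacent ii₀∈
            ... | inj₂ il∈  = trans (adjacent il∈) (sym (adjacent i₀l∈))
            -- Coordinates outside `Cont a` are isolated vertices where `f` is arbitrary, but there
            -- the right-hand side `r` vanishes.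
            same : ∀ i → f i * r i ≡ f i₀ * r i
            same i with (a +e i) ∈𝒥?
            ... | yes i∈ = cong (_* r i) (connected i∈)
            ... | no i∉  = trans (cong (f i *_) r≡0) (trans (*-zeroʳ (f i)) (sym (trans (cong (f i₀ *_) r≡0) (*-zeroʳ (f i₀)))))
              where
              vanish : ∀ v v₀ → 0ℚ * v + v₀ * 0ℚ ≡ 0ℚ
              vanish = solve-∀ ringℚ
              r≡0 : r i ≡ 0ℚ
              r≡0 = trans (cong₂ (λ x z → x * v i + v₀ * z) (S-∉ (2 ℕ.+ m) i∉) (S-∉ (suc m) i∉)) (vanish (v i) v₀)

        main : ∀ {b} → Vec.sum b ≡ 0 → S (2 ℕ.+ K) b * (c * S K b) ≤ S (suc K) b * S (suc K) b
        main {b} |b|≡0 = subst₂ (λ x y → S (2 ℕ.+ K) b * x ≤ y * y) q≡ ℓ≡ (hyperbolic K b (cong (ℕ._+ K) |b|≡0) 1ℚ (λ _ → 0ℚ))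
          where
          q≡ : F.q K b 1ℚ (λ _ → 0ℚ) ≡ c * S K b
          q≡ = trans (cong₂ (λ x y → 1ℚ * (c * S K b * 1ℚ + x) + y)
                       (sum-zero (λ i → *-zeroʳ (S K (b +e i)))) (sum-zero (λ i → *-zeroˡ (F.grad K b 1ℚ (λ _ → 0ℚ) i))))
                     (tidy (c * S K b))
            where
            tidy : ∀ x → 1ℚ * (x * 1ℚ + 0ℚ) + 0ℚ ≡ x
            tidy = solve-∀ ringℚ
          ℓ≡ : F.ℓ K b 1ℚ (λ _ → 0ℚ) ≡ S (suc K) b
          ℓ≡ = sum-cong-≗ λ i → trans (cong (1ℚ * S K (b +e i) +_) (sum-zero (λ j → *-zeroʳ (S K (b +e i +e j)))))
                 (tidy (S K (b +e i)))
            where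
            tidy : ∀ x → 1ℚ * x + 0ℚ ≡ x
            tidy = solve-∀ ringℚ

-- Euler's identity across levels, and the rational case of the theorem.

module Counting where
  open import Data.Fin using (Fin; zero; suc)
  import Data.Integer as ℤ
  open import Data.Integer.Tactic.RingSolver using () renaming (solve-∀ to solve-ℤ)
  open import Data.List using (List; []; _∷_; map; filter; foldr)
  open import Data.List.Membership.Propositional using (_∈_; _∉_)
  open import Data.List.Membership.Propositional.Properties using (∈-map⁺; ∈-map⁻; ∈-filter⁺; ∈-filter⁻)
  open import Data.List.Membership.Propositional.Properties.WithK using (unique∧set⇒bag)
  open import Data.List.Relation.Binary.BagAndSetEquality using (∼bag⇒↭)
  open import Data.List.Relation.Binary.Permutation.Propositional using (_↭_; refl; prep; swap; trans)
  open import Data.List.Relation.Unary.All using ([])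
  open import Data.List.Relation.Unary.AllPairs using ([]; _∷_)
  open import Data.List.Relation.Unary.Any using (here; there)
  open import Data.List.Relation.Unary.Unique.Propositional using (Unique)
  import Data.List.Relation.Unary.Unique.Propositional.Properties as Unique
  open import Data.Nat as ℕ using (ℕ; zero; suc; _!)
  import Data.Nat.Properties as ℕ
  open import Data.Product using (_×_; _,_; proj₁; proj₂)
  open import Data.Rational
  open import Data.Rational.Properties
  import Data.Rational.Unnormalised as ℚᵘ
  import Data.Rational.Unnormalised.Properties as ℚᵘ
  open import Data.Vec as Vec using (Vec; []; _∷_; lookup; replicate)
  open import Data.Vec.Properties using (∷-injective)
  open import Data.Vec.Relation.Binary.Pointwise.Inductive using (Pointwise; []; _∷_)
  open import Function using (_∘_; mk⇔)
  open import Relation.Binary.PropositionalEquality hiding (trans)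
  import Relation.Binary.PropositionalEquality as ≡
  open import Relation.Nullary using (yes; no; ¬_)
  open import Relation.Unary using (Decidable)
  open import Tactic.RingSolver using (solve-∀)
  open import Algebra.Bundles using (CommutativeRing)
  open import Algebra.Properties.Semiring.Sum (CommutativeRing.semiring +-*-commutativeRing) using (sum; sum-cong-≗; ∑-distrib-+; *-distribˡ-sum; *-distribʳ-sum)
  open Arithmetic
  open Exchange
  open Hyperbolicity
  open import Defs using (DiscretePolymatroid; _+e_; _!ᵛ; _!ᵛ≢0)

  /1-suc : ∀ m → ℤ.+ suc m / 1 ≡ 1ℚ + ℤ.+ m / 1
  /1-suc m = toℚᵘ-injective (begin
    toℚᵘ (ℤ.+ suc m / 1)                    ≈⟨ toℚᵘ-fromℚᵘ (ℚᵘ.mkℚᵘ (ℤ.+ suc m) 0) ⟩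
    ℚᵘ.mkℚᵘ (ℤ.+ suc m) 0                   ≈⟨ ℚᵘ.*≡* (arith (ℤ.+ m)) ⟩
    ℚᵘ.1ℚᵘ ℚᵘ.+ ℚᵘ.mkℚᵘ (ℤ.+ m) 0          ≈⟨ ℚᵘ.+-congʳ ℚᵘ.1ℚᵘ (toℚᵘ-fromℚᵘ (ℚᵘ.mkℚᵘ (ℤ.+ m) 0)) ⟨
    toℚᵘ 1ℚ ℚᵘ.+ toℚᵘ (ℤ.+ m / 1)           ≈⟨ toℚᵘ-homo-+ 1ℚ (ℤ.+ m / 1) ⟨
    toℚᵘ (1ℚ + ℤ.+ m / 1)                   ∎)
    where
    open ℚᵘ.≃-Reasoning
    arith : ∀ i → (ℤ.1ℤ ℤ.+ i) ℤ.* ℤ.1ℤ ≡ (ℤ.1ℤ ℤ.* ℤ.1ℤ ℤ.+ i ℤ.* ℤ.1ℤ) ℤ.* ℤ.1ℤ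
    arith = solve-ℤ

  ones-/1 : ∀ m → ones m ≡ ℤ.+ m / 1
  ones-/1 zero    = refl
  ones-/1 (suc m) = ≡.trans (cong (1ℚ +_) (ones-/1 m)) (sym (/1-suc m))

  ones-inverse : ∀ k .{{_ : ℕ.NonZero k}} → ones k * (ℤ.+ 1 / k) ≡ 1ℚ
  ones-inverse (suc k) = ≡.trans (cong (_* (ℤ.+ 1 / suc k)) (ones-/1 (suc k))) (toℚᵘ-injective (begin
    toℚᵘ ((ℤ.+ suc k / 1) * (ℤ.+ 1 / suc k))
      ≈⟨ toℚᵘ-homo-* (ℤ.+ suc k / 1) (ℤ.+ 1 / suc k) ⟩
    toℚᵘ (ℤ.+ suc k / 1) ℚᵘ.* toℚᵘ (ℤ.+ 1 / suc k)
      ≈⟨ ℚᵘ.*-cong (toℚᵘ-fromℚᵘ (ℚᵘ.mkℚᵘ (ℤ.+ suc k) 0)) (toℚᵘ-fromℚᵘ (ℚᵘ.mkℚᵘ (ℤ.+ 1) k)) ⟩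
    ℚᵘ.mkℚᵘ (ℤ.+ suc k) 0 ℚᵘ.* ℚᵘ.mkℚᵘ (ℤ.+ 1) k
      ≈⟨ ℚᵘ.*≡* (≡.trans (arith (ℤ.+ suc k)) (cong (λ m → ℤ.1ℤ ℤ.* ℤ.+ suc m) (sym (ℕ.+-identityʳ k)))) ⟩
    ℚᵘ.1ℚᵘ ∎))
    where
    open ℚᵘ.≃-Reasoning
    arith : ∀ i → i ℤ.* ℤ.1ℤ ℤ.* ℤ.1ℤ ≡ ℤ.1ℤ ℤ.* i
    arith = solve-ℤ

  ones-+ : ∀ m n → ones (m ℕ.+ n) ≡ ones m + ones n
  ones-+ zero    n = sym (+-identityˡ (ones n))
  ones-+ (suc m) n = ≡.trans (cong (1ℚ +_) (ones-+ m n)) (sym (+-assoc 1ℚ (ones m) (ones n)))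

  ones-* : ∀ m n → ones (m ℕ.* n) ≡ ones m * ones n
  ones-* zero    n = sym (*-zeroˡ (ones n))
  ones-* (suc m) n = ≡.trans (ones-+ n (m ℕ.* n)) (≡.trans (cong (ones n +_) (ones-* m n)) (collect (ones m) (ones n)))
    where
    collect : ∀ x y → y + x * y ≡ (1ℚ + x) * y
    collect = solve-∀ ringℚ

  ones-positive : ∀ m → 0ℚ < ones (suc m)
  ones-positive m = <-≤-trans (positive⁻¹ 1ℚ) (term≤sum {suc m} (λ _ → nonNegative⁻¹ 1ℚ) zero)

  ∑ℚ : ∀ {A : Set} → (A → ℚ) → List A → ℚ
  ∑ℚ f xs = foldr _+_ 0ℚ (map f xs)

  ∑ℚ-cong : ∀ {A : Set} {f g : A → ℚ} xs → (∀ {x} → x ∈ xs → f x ≡ g x) → ∑ℚ f xs ≡ ∑ℚ g xs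
  ∑ℚ-cong []       f≡g = refl
  ∑ℚ-cong (x ∷ xs) f≡g = cong₂ _+_ (f≡g (here refl)) (∑ℚ-cong xs (f≡g ∘ there))

  ∑ℚ-sum : ∀ {A : Set} {n} (f : Fin n → A → ℚ) xs → ∑ℚ (λ x → sum (λ i → f i x)) xs ≡ sum (λ i → ∑ℚ (f i) xs)
  ∑ℚ-sum f []       = sym (sum-zero (λ i → refl {x = ∑ℚ (f i) []}))
  ∑ℚ-sum f (x ∷ xs) = ≡.trans (cong (sum (λ i → f i x) +_) (∑ℚ-sum f xs)) (sym (∑-distrib-+ (λ i → f i x) (λ i → ∑ℚ (f i) xs)))

  *-distribˡ-∑ℚ : ∀ {A : Set} p (f : A → ℚ) xs → p * ∑ℚ f xs ≡ ∑ℚ (λ x → p * f x) xs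
  *-distribˡ-∑ℚ p f []       = *-zeroʳ p
  *-distribˡ-∑ℚ p f (x ∷ xs) = ≡.trans (*-distribˡ-+ p (f x) (∑ℚ f xs)) (cong (p * f x +_) (*-distribˡ-∑ℚ p f xs))

  ∑ℚ-map : ∀ {A B : Set} (f : B → ℚ) (g : A → B) xs → ∑ℚ f (map g xs) ≡ ∑ℚ (f ∘ g) xs
  ∑ℚ-map f g []       = refl
  ∑ℚ-map f g (x ∷ xs) = cong (f (g x) +_) (∑ℚ-map f g xs)

  ∑ℚ-filter : ∀ {A : Set} {P : A → Set} (P? : Decidable P) {f : A → ℚ} xs → (∀ {x} → ¬ P x → f x ≡ 0ℚ) →
    ∑ℚ f (filter P? xs) ≡ ∑ℚ f xs
  ∑ℚ-filter P? []       f≡0 = refl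
  ∑ℚ-filter P? {f} (x ∷ xs) f≡0 with P? x
  ... | yes _ = cong (f x +_) (∑ℚ-filter P? xs f≡0)
  ... | no ¬p = ≡.trans (∑ℚ-filter P? xs f≡0) (sym (≡.trans (cong (_+ ∑ℚ f xs) (f≡0 ¬p)) (+-identityˡ (∑ℚ f xs))))

  ∑ℚ-↭ : ∀ {A : Set} (f : A → ℚ) {xs ys} → xs ↭ ys → ∑ℚ f xs ≡ ∑ℚ f ys
  ∑ℚ-↭ f refl         = refl
  ∑ℚ-↭ f (prep x p)   = cong (f x +_) (∑ℚ-↭ f p)
  ∑ℚ-↭ f (swap {xs} {ys} x y p) = ≡.trans (cong (λ s → f x + (f y + s)) (∑ℚ-↭ f p)) (exchange (f x) (f y) (∑ℚ f ys))
    where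
    exchange : ∀ p q r → p + (q + r) ≡ q + (p + r)
    exchange = solve-∀ ringℚ
  ∑ℚ-↭ f (trans p q)  = ≡.trans (∑ℚ-↭ f p) (∑ℚ-↭ f q)

  +e-injective : ∀ {n} (i : Fin n) {a b : Vec ℕ n} → a +e i ≡ b +e i → a ≡ b
  +e-injective zero    {x ∷ a} {y ∷ b} eq with ∷-injective eq
  ... | sx≡sy , refl = cong (_∷ a) (ℕ.suc-injective sx≡sy)
  +e-injective (suc i) {x ∷ a} {y ∷ b} eq with ∷-injective eq
  ... | refl , a≡b = cong (x ∷_) (+e-injective i a≡b)

  sum-ones-lookup : ∀ {n} (a : Vec ℕ n) → sum (λ i → ones (lookup a i)) ≡ ones (Vec.sum a)
  sum-ones-lookup []      = refl
  sum-ones-lookup (x ∷ a) = ≡.trans (cong (ones x +_) (sum-ones-lookup a)) (sym (ones-+ x (Vec.sum a)))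

  sum≡0 : ∀ {n} (a : Vec ℕ n) → Vec.sum a ≡ 0 → a ≡ replicate n 0
  sum≡0 []         _  = refl
  sum≡0 (zero ∷ a) eq = cong (0 ∷_) (sum≡0 a eq)

  sum-replicate-0 : ∀ n → Vec.sum (replicate n 0) ≡ 0
  sum-replicate-0 zero    = refl
  sum-replicate-0 (suc n) = sum-replicate-0 n

  replicate-0-!ᵛ : ∀ n → replicate n 0 !ᵛ ≡ 1
  replicate-0-!ᵛ zero    = refl
  replicate-0-!ᵛ (suc n) = ≡.trans (ℕ.*-identityˡ _) (replicate-0-!ᵛ n)

  replicate-0-≤ : ∀ {n} (a : Vec ℕ n) → Pointwise ℕ._≤_ (replicate n 0) a
  replicate-0-≤ []      = []
  replicate-0-≤ (x ∷ a) = ℕ.z≤n ∷ replicate-0-≤ a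

  1/!ᵛ : ∀ {n} → Vec ℕ n → ℚ
  1/!ᵛ a = (ℤ.+ 1 / a !ᵛ) {{a !ᵛ≢0}}

  ones-1/!ᵛ : ∀ {n} (a : Vec ℕ n) → ones (a !ᵛ) * 1/!ᵛ a ≡ 1ℚ
  ones-1/!ᵛ a = ones-inverse (a !ᵛ) {{a !ᵛ≢0}}

  1/!ᵛ-+e : ∀ {n} (a : Vec ℕ n) i → ones (lookup (a +e i) i) * 1/!ᵛ (a +e i) ≡ 1/!ᵛ a
  1/!ᵛ-+e a i = begin
    ones (lookup (a +e i) i) * w′
      ≡⟨ cong (λ m → ones m * w′) (lookup-+e a i) ⟩
    s * w′
      ≡⟨ *-identityʳ (s * w′) ⟨
    s * w′ * 1ℚ
      ≡⟨ cong (s * w′ *_) (ones-1/!ᵛ a) ⟨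
    s * w′ * (f * w)
      ≡⟨ rearrange s w′ f w ⟩
    s * f * w′ * w
      ≡⟨ cong (λ x → x * w′ * w) (ones-* (suc (lookup a i)) (a !ᵛ)) ⟨
    ones (suc (lookup a i) ℕ.* a !ᵛ) * w′ * w
      ≡⟨ cong (λ m → ones m * w′ * w) (!ᵛ-+e a i) ⟨
    ones ((a +e i) !ᵛ) * w′ * w
      ≡⟨ ≡.trans (cong (_* w) (ones-1/!ᵛ (a +e i))) (*-identityˡ w) ⟩
    w ∎
    where
    open ≡-Reasoning
    s f w w′ : ℚ
    s  = ones (suc (lookup a i))
    f  = ones (a !ᵛ)
    w  = 1/!ᵛ a
    w′ = 1/!ᵛ (a +e i)
    rearrange : ∀ s w′ f w → s * w′ * (f * w) ≡ s * f * w′ * w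
    rearrange = solve-∀ ringℚ

  module Levels {n : ℕ} (D : DiscretePolymatroid n) (ω : Fin n → ℚ) (t : ℚ) where
    open DiscretePolymatroid D hiding (p)
    open Polymatroid D hiding (swap)
    open Weighted D ω t

    -- Interpolates between the value of `S s` at the origin, for m = 0, and the level sum `Jℚ m`,
    -- for s = 0.
    levelSum : ℕ → ℕ → ℚ
    levelSum m s = ∑ℚ (λ a → 1/!ᵛ a * S s a) (level m)

    level⁻ : ∀ {k a} → a ∈ level k → a ∈ 𝒥 × Vec.sum a ≡ k
    level⁻ {k} = ∈-filter⁻ (λ a → Vec.sum a ℕ.≟ k)

    level-unique : ∀ k → Unique (level k)
    level-unique k = Unique.filter⁺ (λ a → Vec.sum a ℕ.≟ k) unique

    -- Both lists are free of duplicates and have the same members, since b = a + eᵢ can be undone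
    -- exactly when the i-th entry of b is positive.
    raise-↭ : ∀ m i → map (_+e i) (filter (λ a → (a +e i) ∈𝒥?) (level m)) ↭ filter (λ b → 0 ℕ.<? lookup b i) (level (suc m))
    raise-↭ m i = ∼bag⇒↭ (unique∧set⇒bag
      (Unique.map⁺ (+e-injective i) (Unique.filter⁺ (λ a → (a +e i) ∈𝒥?) (level-unique m)))
      (Unique.filter⁺ (λ b → 0 ℕ.<? lookup b i) (level-unique (suc m)))
      (mk⇔ to from))
      where
      to : ∀ {b} → b ∈ map (_+e i) (filter (λ a → (a +e i) ∈𝒥?) (level m)) → b ∈ filter (λ b → 0 ℕ.<? lookup b i) (level (suc m))
      to b∈ with ∈-map⁻ (_+e i) b∈
      ... | a , a∈ , refl with ∈-filter⁻ (λ a → (a +e i) ∈𝒥?) a∈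
      ... | a∈level , a+i∈ = ∈-filter⁺ (λ b → 0 ℕ.<? lookup b i)
        (∈-level a+i∈ (≡.trans (sum-+e a i) (cong suc (proj₂ (level⁻ a∈level)))))
        (subst (0 ℕ.<_) (sym (lookup-+e a i)) ℕ.z<s)
      from : ∀ {b} → b ∈ filter (λ b → 0 ℕ.<? lookup b i) (level (suc m)) → b ∈ map (_+e i) (filter (λ a → (a +e i) ∈𝒥?) (level m))
      from {b} b∈ with ∈-filter⁻ (λ b → 0 ℕ.<? lookup b i) {xs = level (suc m)} b∈
      ... | b∈level , 0<bi with -e b i (sym (ℕ.suc-pred (lookup b i) {{ℕ.>-nonZero 0<bi}}))
      ... | a , refl = ∈-map⁺ (_+e i) (∈-filter⁺ (λ a → (a +e i) ∈𝒥?)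
        (∈-level (lower (proj₁ (level⁻ b∈level))) (ℕ.suc-injective (≡.trans (sym (sum-+e a i)) (proj₂ (level⁻ b∈level)))))
        (proj₁ (level⁻ b∈level)))

    -- Reindexing by b = a + eᵢ. The two vanishing hypotheses fill in the missing terms, so that
    -- both sums run over whole levels.
    raise : ∀ m i (g : Vec ℕ n → ℚ) → (∀ {b} → b ∉ 𝒥 → g b ≡ 0ℚ) → (∀ {b} → lookup b i ≡ 0 → g b ≡ 0ℚ) →
      ∑ℚ (λ a → g (a +e i)) (level m) ≡ ∑ℚ g (level (suc m))
    raise m i g g-∉ g-0 = begin
      ∑ℚ (λ a → g (a +e i)) (level m)
        ≡⟨ ∑ℚ-filter (λ a → (a +e i) ∈𝒥?) (level m) g-∉ ⟨
      ∑ℚ (λ a → g (a +e i)) (filter (λ a → (a +e i) ∈𝒥?) (level m))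
        ≡⟨ ∑ℚ-map g (_+e i) (filter (λ a → (a +e i) ∈𝒥?) (level m)) ⟨
      ∑ℚ g (map (_+e i) (filter (λ a → (a +e i) ∈𝒥?) (level m)))
        ≡⟨ ∑ℚ-↭ g (raise-↭ m i) ⟩
      ∑ℚ g (filter (λ b → 0 ℕ.<? lookup b i) (level (suc m)))
        ≡⟨ ∑ℚ-filter (λ b → 0 ℕ.<? lookup b i) (level (suc m)) (λ ≮ → g-0 (ℕ.n≤0⇒n≡0 (ℕ.≮⇒≥ ≮))) ⟩
      ∑ℚ g (level (suc m)) ∎
      where open ≡-Reasoning

    -- Double counting: b is reached from each b - eᵢ with weight 1/(b - eᵢ)! = bᵢ / b!, and the
    -- entries of b add up to m + 1.
    levelSum-suc : ∀ m s → levelSum m (suc s) ≡ ones (suc m) * levelSum (suc m) s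
    levelSum-suc m s = begin
      ∑ℚ (λ a → 1/!ᵛ a * S (suc s) a) (level m)
        ≡⟨ ∑ℚ-cong (level m) (λ {a} _ → ≡.trans (*-distribˡ-sum (1/!ᵛ a) (λ i → S s (a +e i)))
             (sum-cong-≗ (λ i → cong (_* S s (a +e i)) (sym (1/!ᵛ-+e a i))))) ⟩
      ∑ℚ (λ a → sum (λ i → g i (a +e i))) (level m)
        ≡⟨ ∑ℚ-sum (λ i a → g i (a +e i)) (level m) ⟩
      sum (λ i → ∑ℚ (λ a → g i (a +e i)) (level m))
        ≡⟨ sum-cong-≗ (λ i → raise m i (g i) (g-∉ i) (λ {b} → g-0 i {b})) ⟩
      sum (λ i → ∑ℚ (g i) (level (suc m)))
        ≡⟨ ∑ℚ-sum g (level (suc m)) ⟨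
      ∑ℚ (λ b → sum (λ i → g i b)) (level (suc m))
        ≡⟨ ∑ℚ-cong (level (suc m)) (λ {b} b∈ → ≡.trans
             (sum-cong-≗ (λ i → *-assoc (ones (lookup b i)) (1/!ᵛ b) (S s b)))
             (≡.trans (sym (*-distribʳ-sum (1/!ᵛ b * S s b) (λ i → ones (lookup b i))))
               (cong (_* (1/!ᵛ b * S s b)) (≡.trans (sum-ones-lookup b) (cong ones (proj₂ (level⁻ b∈))))))) ⟩
      ∑ℚ (λ b → ones (suc m) * (1/!ᵛ b * S s b)) (level (suc m))
        ≡⟨ *-distribˡ-∑ℚ (ones (suc m)) (λ b → 1/!ᵛ b * S s b) (level (suc m)) ⟨
      ones (suc m) * levelSum (suc m) s ∎
      where
      open ≡-Reasoning
      g : Fin n → Vec ℕ n → ℚ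
      g i b = ones (lookup b i) * 1/!ᵛ b * S s b
      g-∉ : ∀ i {b} → b ∉ 𝒥 → g i b ≡ 0ℚ
      g-∉ i {b} b∉ = ≡.trans (cong (ones (lookup b i) * 1/!ᵛ b *_) (S-∉ s b∉)) (*-zeroʳ (ones (lookup b i) * 1/!ᵛ b))
      g-0 : ∀ i {b} → lookup b i ≡ 0 → g i b ≡ 0ℚ
      g-0 i {b} eq = ≡.trans (cong (λ k → ones k * 1/!ᵛ b * S s b) eq) (vanish (1/!ᵛ b) (S s b))
        where
        vanish : ∀ w x → 0ℚ * w * x ≡ 0ℚ
        vanish = solve-∀ ringℚ

    0ᵛ : Vec ℕ n
    0ᵛ = replicate n 0

    levelSum-zero : ∀ s → levelSum 0 s ≡ S s 0ᵛ
    levelSum-zero s = begin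
      ∑ℚ (λ a → 1/!ᵛ a * S s a) (level 0)   ≡⟨ ∑ℚ-↭ (λ a → 1/!ᵛ a * S s a) level0↭ ⟩
      1/!ᵛ 0ᵛ * S s 0ᵛ + 0ℚ                 ≡⟨ cong (λ w → w * S s 0ᵛ + 0ℚ) 1/0!≡1 ⟩
      1ℚ * S s 0ᵛ + 0ℚ                       ≡⟨ ≡.trans (+-identityʳ (1ℚ * S s 0ᵛ)) (*-identityˡ (S s 0ᵛ)) ⟩
      S s 0ᵛ                                 ∎
      where
      open ≡-Reasoning
      1/0!≡1 : 1/!ᵛ 0ᵛ ≡ 1ℚ
      1/0!≡1 = ≡.trans (sym (*-identityˡ (1/!ᵛ 0ᵛ))) (≡.trans (cong (λ k → ones k * 1/!ᵛ 0ᵛ) (sym (replicate-0-!ᵛ n))) (ones-1/!ᵛ 0ᵛ))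
      0ᵛ∈ : 0ᵛ ∈ 𝒥
      0ᵛ∈ = hereditary (proj₂ nonempty) (replicate-0-≤ (proj₁ nonempty))
      level0↭ : level 0 ↭ 0ᵛ ∷ []
      level0↭ = ∼bag⇒↭ (unique∧set⇒bag (level-unique 0) ([] ∷ [])
        (mk⇔ (λ a∈ → here (sum≡0 _ (proj₂ (level⁻ a∈)))) λ where (here refl) → ∈-level 0ᵛ∈ (sum-replicate-0 n)))

    levelSum-! : ∀ m s → ones (m !) * levelSum m s ≡ S (m ℕ.+ s) 0ᵛ
    levelSum-! zero    s = ≡.trans (*-identityˡ (levelSum 0 s)) (levelSum-zero s)
    levelSum-! (suc m) s = begin
      ones (suc m ℕ.* m !) * levelSum (suc m) s
        ≡⟨ cong (_* levelSum (suc m) s) (ones-* (suc m) (m !)) ⟩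
      ones (suc m) * ones (m !) * levelSum (suc m) s
        ≡⟨ rearrange (ones (suc m)) (ones (m !)) (levelSum (suc m) s) ⟩
      ones (m !) * (ones (suc m) * levelSum (suc m) s)
        ≡⟨ cong (ones (m !) *_) (levelSum-suc m s) ⟨
      ones (m !) * levelSum m (suc s)
        ≡⟨ levelSum-! m (suc s) ⟩
      S (m ℕ.+ suc s) 0ᵛ
        ≡⟨ cong (λ k → S k 0ᵛ) (ℕ.+-suc m s) ⟩
      S (suc m ℕ.+ s) 0ᵛ ∎
      where
      open ≡-Reasoning
      rearrange : ∀ p q r → p * q * r ≡ q * (p * r)
      rearrange = solve-∀ ringℚ

    Jℚ : ℕ → ℚ
    Jℚ k = ∑ℚ (λ a → term a * 1/!ᵛ a) (level k)

    S-as-Jℚ : ∀ k → S k 0ᵛ ≡ ones (k !) * Jℚ k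
    S-as-Jℚ k = ≡.trans (cong (λ m → S m 0ᵛ) (sym (ℕ.+-identityʳ k))) (≡.trans (sym (levelSum-! k 0))
      (cong (ones (k !) *_) (∑ℚ-cong (level k) (λ {a} a∈ →
        ≡.trans (cong (1/!ᵛ a *_) (φ-∈ (proj₁ (level⁻ a∈)))) (*-comm (1/!ᵛ a) (term a))))))

    -- Substituting S k = k! J k at the origin into `main` and dividing by ((K + 1)!)² leaves (K +
    -- 2)/(K + 1) = 1 + 1/k with k = K + 1.
    log-concave : (∀ i → 0ℚ < ω i) → 0ℚ < t → t ≤ 1ℚ → ∀ P K → suc K ℕ.< rk → DiscretePolymatroid.p D K ≡ suc P →
      ∀ c → c * (ones (suc P) - 1ℚ + t) ≡ ones (suc P) →
      (1ℚ + ℤ.+ 1 / suc K) * c * Jℚ K * Jℚ (2 ℕ.+ K) ≤ Jℚ (suc K) * Jℚ (suc K)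
    log-concave 0<ω 0<t t≤1 P K K<rk p≡ c c≡ = cancel-*-≤ (f * f * (k * k)) 0<scale
      (subst₂ _≤_ lhs≡ rhs≡ (Weighted.Positive.main D ω t 0<ω 0<t t≤1 P K K<rk
        (λ {a} a∈ eq → subst (_ ℕ.≤_) p≡ (Par≤p a∈ eq)) c c≡ {0ᵛ} (sum-replicate-0 n)))
      where
      open ≡-Reasoning
      f k k⁻¹ : ℚ
      f   = ones (K !)
      k   = ones (suc K)
      k⁻¹ = ℤ.+ 1 / suc K
      0<f : 0ℚ < f
      0<f = subst (λ m → 0ℚ < ones m) (ℕ.suc-pred (K !) {{K ℕ.!≢0}}) (ones-positive (ℕ.pred (K !)))
      0<scale : 0ℚ < f * f * (k * k)
      0<scale = *-positive (*-positive 0<f 0<f) (*-positive (ones-positive K) (ones-positive K))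
      S₁≡ : S (suc K) 0ᵛ ≡ k * f * Jℚ (suc K)
      S₁≡ = ≡.trans (S-as-Jℚ (suc K)) (cong (_* Jℚ (suc K)) (ones-* (suc K) (K !)))
      S₂≡ : S (2 ℕ.+ K) 0ᵛ ≡ (1ℚ + k) * (k * f) * Jℚ (2 ℕ.+ K)
      S₂≡ = ≡.trans (S-as-Jℚ (2 ℕ.+ K)) (cong (_* Jℚ (2 ℕ.+ K))
        (≡.trans (ones-* (2 ℕ.+ K) (suc K !)) (cong ((1ℚ + k) *_) (ones-* (suc K) (K !)))))
      expand₁ : ∀ k f J₂ c J₀ → (1ℚ + k) * (k * f) * J₂ * (c * (f * J₀)) ≡ f * f * (k * (k + 1ℚ) * c * J₀ * J₂)
      expand₁ = solve-∀ ringℚ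
      expand₂ : ∀ k k⁻¹ f J₂ c J₀ → f * f * (k * (k + k * k⁻¹) * c * J₀ * J₂) ≡ f * f * (k * k) * ((1ℚ + k⁻¹) * c * J₀ * J₂)
      expand₂ = solve-∀ ringℚ
      expand₃ : ∀ k f J → k * f * J * (k * f * J) ≡ f * f * (k * k) * (J * J)
      expand₃ = solve-∀ ringℚ
      lhs≡ : S (2 ℕ.+ K) 0ᵛ * (c * S K 0ᵛ) ≡ f * f * (k * k) * ((1ℚ + k⁻¹) * c * Jℚ K * Jℚ (2 ℕ.+ K))
      lhs≡ = begin
        S (2 ℕ.+ K) 0ᵛ * (c * S K 0ᵛ)
          ≡⟨ cong₂ (λ x y → x * (c * y)) S₂≡ (S-as-Jℚ K) ⟩
        (1ℚ + k) * (k * f) * Jℚ (2 ℕ.+ K) * (c * (f * Jℚ K))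
          ≡⟨ expand₁ k f (Jℚ (2 ℕ.+ K)) c (Jℚ K) ⟩
        f * f * (k * (k + 1ℚ) * c * Jℚ K * Jℚ (2 ℕ.+ K))
          ≡⟨ cong (λ u → f * f * (k * (k + u) * c * Jℚ K * Jℚ (2 ℕ.+ K))) (ones-inverse (suc K)) ⟨
        f * f * (k * (k + k * k⁻¹) * c * Jℚ K * Jℚ (2 ℕ.+ K))
          ≡⟨ expand₂ k k⁻¹ f (Jℚ (2 ℕ.+ K)) c (Jℚ K) ⟩
        f * f * (k * k) * ((1ℚ + k⁻¹) * c * Jℚ K * Jℚ (2 ℕ.+ K)) ∎
      rhs≡ : S (suc K) 0ᵛ * S (suc K) 0ᵛ ≡ f * f * (k * k) * (Jℚ (suc K) * Jℚ (suc K))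
      rhs≡ = ≡.trans (cong₂ _*_ S₁≡ S₁≡) (expand₃ k f (Jℚ (suc K)))

open import Defs
open import Data.Nat using (ℕ; suc; pred; NonZero) renaming (_<_ to _<ᴺ_)
open import Data.Fin using (Fin)
open import Data.Product using (_×_)
open import Relation.Binary.PropositionalEquality using (_≡_)
import Data.Fin as Fin
import Data.Integer as ℤ
import Data.Integer.Properties as ℤ
open import Data.List using (List; []; _∷_; map)
open import Data.List.Membership.Propositional using (_∈_)
open import Data.List.Relation.Unary.Any using (here; there)
import Data.Nat as ℕ
import Data.Nat.Properties as ℕ
open import Data.Product using (∃-syntax; _,_; proj₁; proj₂)
open import Data.Rational as ℚ using (ℚ; 0ℚ; 1ℚ; ½; ∣_∣)
import Data.Rational.Properties as ℚ
import Data.Rational.Unnormalised as ℚᵘ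
import Data.Rational.Unnormalised.Properties as ℚᵘ
open import Data.Sum using (inj₁; inj₂)
open import Data.Vec using (Vec)
import Data.Vec as Vec
open import Function using (_∘_)
open import Relation.Binary.PropositionalEquality using (refl; sym; trans; cong; cong₂; subst; subst₂; module ≡-Reasoning)
open import Relation.Nullary using (contradiction)
open import Tactic.RingSolver using (solve-∀)
open import Algebra.Bundles using (CommutativeRing)
open import Algebra.Properties.Semiring.Exp (CommutativeRing.semiring ℚ.+-*-commutativeRing) using () renaming (_^_ to _^ℚ_)
open Arithmetic
open Exchange
open Hyperbolicity
open Counting

-- Limits and congruence rules for the Cauchy reals.

half-positive : ∀ {ε} → 0ℚ ℚ.< ε → 0ℚ ℚ.< ½ ℚ.* ε
half-positive = *-positive (ℚ.positive⁻¹ ½)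

halves : ∀ ε → ½ ℚ.* ε ℚ.+ ½ ℚ.* ε ≡ ε
halves ε = trans (sym (ℚ.*-distribʳ-+ ε ½ ½)) (ℚ.*-identityˡ ε)

half-< : ∀ {ε} → 0ℚ ℚ.< ε → ½ ℚ.* ε ℚ.< ε
half-< {ε} 0<ε = subst₂ ℚ._<_ (ℚ.+-identityʳ (½ ℚ.* ε)) (halves ε) (ℚ.+-monoʳ-< (½ ℚ.* ε) (half-positive 0<ε))

∣p-q∣<ε⇒p≤q+ε : ∀ {p q ε} → ∣ p ℚ.- q ∣ ℚ.< ε → p ℚ.≤ q ℚ.+ ε
∣p-q∣<ε⇒p≤q+ε {p} {q} {ε} lt = begin
  p                      ≡⟨ split p q ⟩
  q ℚ.+ (p ℚ.- q)       ≤⟨ ℚ.+-monoʳ-≤ q (ℚ.≤-trans (p≤∣p∣ (p ℚ.- q)) (ℚ.<⇒≤ lt)) ⟩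
  q ℚ.+ ε               ∎
  where
  open ℚ.≤-Reasoning
  split : ∀ p q → p ≡ q ℚ.+ (p ℚ.- q)
  split = solve-∀ ringℚ
  p≤∣p∣ : ∀ p → p ℚ.≤ ∣ p ∣
  p≤∣p∣ p with ℚ.≤-total 0ℚ p
  ... | inj₁ 0≤p = ℚ.≤-reflexive (sym (ℚ.0≤p⇒∣p∣≡p 0≤p))
  ... | inj₂ p≤0 = ℚ.≤-trans p≤0 (ℚ.0≤∣p∣ p)

∣p-q∣-comm : ∀ p q → ∣ p ℚ.- q ∣ ≡ ∣ q ℚ.- p ∣
∣p-q∣-comm p q = trans (sym (ℚ.∣-p∣≡∣p∣ (p ℚ.- q))) (cong ∣_∣ (flip p q))
  where
  flip : ∀ p q → ℚ.- (p ℚ.- q) ≡ q ℚ.- p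
  flip = solve-∀ ringℚ

∣p-q∣≤ : ∀ {p q e} → p ℚ.≤ q ℚ.+ e → q ℚ.≤ p ℚ.+ e → ∣ p ℚ.- q ∣ ℚ.≤ e
∣p-q∣≤ {p} {q} {e} p≤ q≤ with ℚ.∣p∣≡p∨∣p∣≡-p (p ℚ.- q)
... | inj₁ eq = subst (ℚ._≤ e) (sym eq) (0≤q-p⇒p≤q (subst (0ℚ ℚ.≤_) (move p q e) (p≤q⇒0≤q-p p≤)))
  where
  move : ∀ p q e → q ℚ.+ e ℚ.- p ≡ e ℚ.- (p ℚ.- q)
  move = solve-∀ ringℚ
... | inj₂ eq = subst (ℚ._≤ e) (sym eq) (0≤q-p⇒p≤q (subst (0ℚ ℚ.≤_) (move p q e) (p≤q⇒0≤q-p q≤)))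
  where
  move : ∀ p q e → p ℚ.+ e ℚ.- q ≡ e ℚ.- ℚ.- (p ℚ.- q)
  move = solve-∀ ringℚ

∣-∣-triangle : ∀ p q r → ∣ p ℚ.- r ∣ ℚ.≤ ∣ p ℚ.- q ∣ ℚ.+ ∣ q ℚ.- r ∣
∣-∣-triangle p q r = subst (λ x → ∣ x ∣ ℚ.≤ ∣ p ℚ.- q ∣ ℚ.+ ∣ q ℚ.- r ∣) (split p q r)
  (ℚ.∣p+q∣≤∣p∣+∣q∣ (p ℚ.- q) (q ℚ.- r))
  where
  split : ∀ p q r → (p ℚ.- q) ℚ.+ (q ℚ.- r) ≡ p ℚ.- r
  split = solve-∀ ringℚ

-- The relation `_≈_` on bare sequences; it is needed for approximations not yet known to be Cauchy,
-- which then inherit that property from their limit.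
_⟶_ : (ℕ → ℚ) → (ℕ → ℚ) → Set
s ⟶ u = ∀ ε → 0ℚ ℚ.< ε → ∃[ N ] (∀ m → N ℕ.≤ m → ∣ s m ℚ.- u m ∣ ℚ.< ε)

⟶-sym : ∀ {s u} → s ⟶ u → u ⟶ s
⟶-sym {s} {u} s⟶u ε 0<ε with s⟶u ε 0<ε
... | N , close = N , λ m N≤m → subst (ℚ._< ε) (∣p-q∣-comm (s m) (u m)) (close m N≤m)

⟶-trans : ∀ {s u v} → s ⟶ u → u ⟶ v → s ⟶ v
⟶-trans {s} {u} {v} s⟶u u⟶v ε 0<ε with s⟶u _ (half-positive 0<ε) | u⟶v _ (half-positive 0<ε)
... | M , su | N , uv = M ℕ.⊔ N , λ m ≤m → ℚ.≤-<-trans (∣-∣-triangle (s m) (u m) (v m))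
  (subst (∣ s m ℚ.- u m ∣ ℚ.+ ∣ u m ℚ.- v m ∣ ℚ.<_) (halves ε)
    (ℚ.+-mono-< (su m (ℕ.m⊔n≤o⇒m≤o M N ≤m)) (uv m (ℕ.m⊔n≤o⇒n≤o M N ≤m))))

⟶-cauchy : ∀ {s} x → s ⟶ seq x → ∀ ε → 0ℚ ℚ.< ε →
  ∃[ N ] (∀ m n → N ℕ.≤ m → N ℕ.≤ n → ∣ s m ℚ.- s n ∣ ℚ.< ε)
⟶-cauchy {s} x s⟶x ε 0<ε = M ℕ.⊔ N , λ m n ≤m ≤n → begin-strict
  ∣ s m ℚ.- s n ∣
    ≤⟨ ∣-∣-triangle (s m) (seq x m) (s n) ⟩
  ∣ s m ℚ.- seq x m ∣ ℚ.+ ∣ seq x m ℚ.- s n ∣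
    ≤⟨ ℚ.+-monoʳ-≤ ∣ s m ℚ.- seq x m ∣ (∣-∣-triangle (seq x m) (seq x n) (s n)) ⟩
  ∣ s m ℚ.- seq x m ∣ ℚ.+ (∣ seq x m ℚ.- seq x n ∣ ℚ.+ ∣ seq x n ℚ.- s n ∣)
    <⟨ ℚ.+-mono-< (near m (ℕ.m⊔n≤o⇒m≤o M N ≤m)) (ℚ.+-mono-<
         (close m n (ℕ.m⊔n≤o⇒n≤o M N ≤m) (ℕ.m⊔n≤o⇒n≤o M N ≤n))
         (subst (ℚ._< η) (∣p-q∣-comm (s n) (seq x n)) (near n (ℕ.m⊔n≤o⇒m≤o M N ≤n)))) ⟩
  η ℚ.+ (½ ℚ.* ε ℚ.+ η)
    ≡⟨ trans (rotate η (½ ℚ.* ε)) (trans (cong (ℚ._+ ½ ℚ.* ε) (halves (½ ℚ.* ε))) (halves ε)) ⟩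
  ε ∎
  where
  open ℚ.≤-Reasoning
  η : ℚ
  η = ½ ℚ.* (½ ℚ.* ε)
  s-near = s⟶x η (half-positive (half-positive 0<ε))
  M = proj₁ s-near
  near = proj₂ s-near
  x-close = cauchy x (½ ℚ.* ε) (half-positive 0<ε)
  N = proj₁ x-close
  close = proj₂ x-close
  rotate : ∀ p q → p ℚ.+ (q ℚ.+ p) ≡ p ℚ.+ p ℚ.+ q
  rotate = solve-∀ ringℚ

≈-sym : ∀ {x y} → x ≈ y → y ≈ x
≈-sym {x} {y} = ⟶-sym {seq x} {seq y}

≈-trans : ∀ {x y z} → x ≈ y → y ≈ z → x ≈ z
≈-trans {x} {y} {z} = ⟶-trans {seq x} {seq y} {seq z}

≈-eventually : ∀ {x y} N → (∀ m → N ℕ.≤ m → seq x m ≡ seq y m) → x ≈ y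
≈-eventually {x} {y} N eq ε 0<ε = N , λ m N≤m →
  subst (ℚ._< ε) (sym (cong ∣_∣ (trans (cong (ℚ._- seq y m) (eq m N≤m)) (ℚ.+-inverseʳ (seq y m))))) 0<ε

≈-pointwise : ∀ {x y} → (∀ m → seq x m ≡ seq y m) → x ≈ y
≈-pointwise {x} {y} eq = ≈-eventually {x} {y} 0 (λ m _ → eq m)

≈-refl : ∀ {x} → x ≈ x
≈-refl {x} = ≈-pointwise {x} {x} (λ _ → refl)

+-cong : ∀ {x x′ y y′} → x ≈ x′ → y ≈ y′ → x + y ≈ x′ + y′
+-cong {x} {x′} {y} {y′} x≈ y≈ ε 0<ε with x≈ _ (half-positive 0<ε) | y≈ _ (half-positive 0<ε)
... | M , cx | N , cy = M ℕ.⊔ N , λ m ≤m →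
  subst (λ d → ∣ d ∣ ℚ.< ε) (split (seq x m) (seq x′ m) (seq y m) (seq y′ m))
    (ℚ.≤-<-trans (ℚ.∣p+q∣≤∣p∣+∣q∣ (seq x m ℚ.- seq x′ m) (seq y m ℚ.- seq y′ m))
      (subst (∣ seq x m ℚ.- seq x′ m ∣ ℚ.+ ∣ seq y m ℚ.- seq y′ m ∣ ℚ.<_) (halves ε)
        (ℚ.+-mono-< (cx m (ℕ.m⊔n≤o⇒m≤o M N ≤m)) (cy m (ℕ.m⊔n≤o⇒n≤o M N ≤m)))))
  where
  split : ∀ a b c d → (a ℚ.- b) ℚ.+ (c ℚ.- d) ≡ (a ℚ.+ c) ℚ.- (b ℚ.+ d)
  split = solve-∀ ringℚ

-‿cong : ∀ {x y} → x ≈ y → - x ≈ - y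
-‿cong {x} {y} x≈y ε 0<ε with x≈y ε 0<ε
... | N , close = N , λ m N≤m → subst (ℚ._< ε)
  (trans (sym (ℚ.∣-p∣≡∣p∣ (seq x m ℚ.- seq y m))) (cong ∣_∣ (flip (seq x m) (seq y m)))) (close m N≤m)
  where
  flip : ∀ p q → ℚ.- (p ℚ.- q) ≡ ℚ.- p ℚ.- ℚ.- q
  flip = solve-∀ ringℚ

*-congˡ : ∀ x {y y′} → y ≈ y′ → x * y ≈ x * y′
*-congˡ x {y} {y′} y≈ ε 0<ε = M ℕ.⊔ N , λ m ≤m → begin-strict
    ∣ seq x m ℚ.* seq y m ℚ.- seq x m ℚ.* seq y′ m ∣
      ≡⟨ cong ∣_∣ (factor (seq x m) (seq y m) (seq y′ m)) ⟩
    ∣ seq x m ℚ.* (seq y m ℚ.- seq y′ m) ∣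
      ≡⟨ ℚ.∣p*q∣≡∣p∣*∣q∣ (seq x m) (seq y m ℚ.- seq y′ m) ⟩
    ∣ seq x m ∣ ℚ.* ∣ seq y m ℚ.- seq y′ m ∣
      ≤⟨ ℚ.*-monoʳ-≤-nonNeg ∣ seq y m ℚ.- seq y′ m ∣ {{ℚ.∣-∣-nonNeg (seq y m ℚ.- seq y′ m)}} (x≤B m (ℕ.m⊔n≤o⇒m≤o M N ≤m)) ⟩
    B ℚ.* ∣ seq y m ℚ.- seq y′ m ∣
      <⟨ ℚ.*-monoʳ-<-pos B {{ℚ.positive 0<B}} (close m (ℕ.m⊔n≤o⇒n≤o M N ≤m)) ⟩
    B ℚ.* (recip B ℚ.* ε)
      ≡⟨ trans (sym (ℚ.*-assoc B (recip B) ε)) (trans (cong (ℚ._* ε) (recip-inverse B 0<B)) (ℚ.*-identityˡ ε)) ⟩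
    ε ∎
  where
  open ℚ.≤-Reasoning
  B = proj₁ (bounded x)
  0<B = proj₁ (proj₂ (bounded x))
  M = proj₁ (proj₂ (proj₂ (bounded x)))
  x≤B = proj₂ (proj₂ (proj₂ (bounded x)))
  y-close = y≈ (recip B ℚ.* ε) (*-positive (recip-positive 0<B) 0<ε)
  N = proj₁ y-close
  close = proj₂ y-close
  factor : ∀ x y y′ → x ℚ.* y ℚ.- x ℚ.* y′ ≡ x ℚ.* (y ℚ.- y′)
  factor = solve-∀ ringℚ

*-comm : ∀ x y → x * y ≈ y * x
*-comm x y = ≈-pointwise {x * y} {y * x} (λ m → ℚ.*-comm (seq x m) (seq y m))

*-congʳ : ∀ {x x′} y → x ≈ x′ → x * y ≈ x′ * y
*-congʳ {x} {x′} y x≈ = ≈-trans {x * y} {y * x} {x′ * y} (*-comm x y)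
  (≈-trans {y * x} {y * x′} {x′ * y} (*-congˡ y {x} {x′} x≈) (*-comm y x′))

*-cong : ∀ {x x′ y y′} → x ≈ x′ → y ≈ y′ → x * y ≈ x′ * y′
*-cong {x} {x′} {y} {y′} x≈ y≈ = ≈-trans {x * y} {x′ * y} {x′ * y′} (*-congʳ {x} {x′} y x≈) (*-congˡ x′ {y} {y′} y≈)

^-cong : ∀ {x y} → x ≈ y → ∀ k → x ^ k ≈ y ^ k
^-cong {x} {y} x≈y ℕ.zero    = ≈-refl {1ℝ}
^-cong {x} {y} x≈y (suc k) = *-cong {x} {y} {x ^ k} {y ^ k} x≈y (^-cong {x} {y} x≈y k)

∑-cong : ∀ {A : Set} (f g : A → ℝ) xs → (∀ {a} → a ∈ xs → f a ≈ g a) → ∑ (map f xs) ≈ ∑ (map g xs)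
∑-cong f g []       f≈g = ≈-refl {0ℝ}
∑-cong f g (x ∷ xs) f≈g = +-cong {f x} {g x} {∑ (map f xs)} {∑ (map g xs)} (f≈g (here refl)) (∑-cong f g xs (f≈g ∘ there))

0<-eventually : ∀ {x} → 0ℝ < x → ∃[ N ] (∀ m → N ℕ.≤ m → 0ℚ ℚ.< seq x m)
0<-eventually {x} (ε , 0<ε , N , x≥) = N , λ m N≤m →
  ℚ.<-≤-trans 0<ε (subst (ℚ._≤ seq x m) (ℚ.+-identityˡ ε) (x≥ m N≤m))

0<-resp-≈ : ∀ {x y} → x ≈ y → 0ℝ < x → 0ℝ < y
0<-resp-≈ {x} {y} x≈y (ε , 0<ε , M , x≥) with x≈y _ (half-positive 0<ε)
... | N , close = ½ ℚ.* ε , half-positive 0<ε , M ℕ.⊔ N , λ m ≤m →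
  0≤q-p⇒p≤q (subst (0ℚ ℚ.≤_) (tidy (seq y m) (½ ℚ.* ε)) (p≤q⇒0≤q-p (begin
    ½ ℚ.* ε ℚ.+ ½ ℚ.* ε   ≡⟨ trans (halves ε) (sym (ℚ.+-identityˡ ε)) ⟩
    0ℚ ℚ.+ ε               ≤⟨ x≥ m (ℕ.m⊔n≤o⇒m≤o M N ≤m) ⟩
    seq x m                ≤⟨ ∣p-q∣<ε⇒p≤q+ε (close m (ℕ.m⊔n≤o⇒n≤o M N ≤m)) ⟩
    seq y m ℚ.+ ½ ℚ.* ε   ∎)))
  where
  open ℚ.≤-Reasoning
  tidy : ∀ y h → y ℚ.+ h ℚ.- (h ℚ.+ h) ≡ y ℚ.- (0ℚ ℚ.+ h)
  tidy = solve-∀ ringℚ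

-- Uniqueness of inverses: 1/x ≈ (1/x)(y/y) ≈ (1/x)(x/y) ≈ 1/y. No new estimate is made, and the two
-- positivity witnesses may be unrelated.
reciprocal-cong : ∀ {x y} (0<x : 0ℝ < x) (0<y : 0ℝ < y) → x ≈ y → reciprocal x 0<x ≈ reciprocal y 0<y
reciprocal-cong {x} {y} 0<x 0<y x≈y =
  ≈-trans {rx} {rx * (y * ry)} {ry}
    (≈-eventually {rx} {rx * (y * ry)} (proj₁ ev-y) λ m ≤m →
      sym (trans (cong (recip (seq x m) ℚ.*_) (recip-inverse (seq y m) (proj₂ ev-y m ≤m))) (ℚ.*-identityʳ (recip (seq x m)))))
    (≈-trans {rx * (y * ry)} {rx * (x * ry)} {ry}
      (*-congˡ rx {y * ry} {x * ry} (*-congʳ {y} {x} ry (≈-sym {x} {y} x≈y)))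
      (≈-eventually {rx * (x * ry)} {ry} (proj₁ ev-x) λ m ≤m →
        trans (move (recip (seq x m)) (seq x m) (recip (seq y m)))
          (trans (cong (ℚ._* recip (seq y m)) (recip-inverse (seq x m) (proj₂ ev-x m ≤m))) (ℚ.*-identityˡ (recip (seq y m))))))
  where
  rx ry : ℝ
  rx = reciprocal x 0<x
  ry = reciprocal y 0<y
  ev-x = 0<-eventually {x} 0<x
  ev-y = 0<-eventually {y} 0<y
  move : ∀ r x s → r ℚ.* (x ℚ.* s) ≡ x ℚ.* r ℚ.* s
  move = solve-∀ ringℚ

-- Carries rational inequalities to real ones: each side may first be replaced by an equal real, at
-- the price of half of ε, and only a tail is compared.
≤-from-eventually : ∀ {x x′ y y′} → x ≈ x′ → y′ ≈ y → ∃[ N ] (∀ m → N ℕ.≤ m → seq x′ m ℚ.≤ seq y′ m) → x ≤ y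
≤-from-eventually {x} {x′} {y} {y′} x≈ y≈ (L , x′≤y′) ε 0<ε with x≈ _ (half-positive 0<ε) | y≈ _ (half-positive 0<ε)
... | M , cx | N , cy = L ℕ.⊔ (M ℕ.⊔ N) , λ m ≤m →
  let ≤MN = ℕ.m⊔n≤o⇒n≤o L (M ℕ.⊔ N) ≤m in begin
    seq x m                               ≤⟨ ∣p-q∣<ε⇒p≤q+ε (cx m (ℕ.m⊔n≤o⇒m≤o M N ≤MN)) ⟩
    seq x′ m ℚ.+ ½ ℚ.* ε                 ≤⟨ ℚ.+-monoˡ-≤ (½ ℚ.* ε) (ℚ.≤-trans (x′≤y′ m (ℕ.m⊔n≤o⇒m≤o L (M ℕ.⊔ N) ≤m))
                                                (∣p-q∣<ε⇒p≤q+ε (cy m (ℕ.m⊔n≤o⇒n≤o M N ≤MN)))) ⟩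
    seq y m ℚ.+ ½ ℚ.* ε ℚ.+ ½ ℚ.* ε     ≡⟨ trans (ℚ.+-assoc (seq y m) (½ ℚ.* ε) (½ ℚ.* ε)) (cong (seq y m ℚ.+_) (halves ε)) ⟩
    seq y m ℚ.+ ε                         ∎
  where open ℚ.≤-Reasoning

-- Approximating `t` from within (0, 1].

1/suc : ℕ → ℚ
1/suc m = ℤ.+ 1 ℚ./ suc m

1/suc-positive : ∀ m → 0ℚ ℚ.< 1/suc m
1/suc-positive m = ℚ.positive⁻¹ (1/suc m) {{ℚ.normalize-pos 1 (suc m)}}

1/suc-small : ∀ ε → 0ℚ ℚ.< ε → ∃[ N ] (∀ m → N ℕ.≤ m → 1/suc m ℚ.≤ ε)
1/suc-small (ℚ.mkℚ (ℤ.+ ℕ.zero) d c) (ℚ.*<* (ℤ.+<+ ()))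
1/suc-small (ℚ.mkℚ ℤ.-[1+ p ] d c) (ℚ.*<* ())
-- `d` is the denominator of ε minus one, so m ≥ d gives 1/(m + 1) ≤ 1/(d + 1) ≤ ε.
1/suc-small ε@(ℚ.mkℚ (ℤ.+ suc p) d c) _ = d , λ m d≤m → ℚ.toℚᵘ-cancel-≤
  (ℚᵘ.≤-respˡ-≃ (ℚᵘ.≃-sym (ℚ.toℚᵘ-fromℚᵘ (ℚᵘ.mkℚᵘ (ℤ.+ 1) m)))
    (ℚᵘ.*≤* (subst₂ ℤ._≤_ (sym (ℤ.*-identityˡ (ℤ.+ suc d))) (ℤ.pos-* (suc p) (suc m))
      (ℤ.+≤+ (ℕ.≤-trans (ℕ.s≤s d≤m) (ℕ.m≤m+n (suc m) (p ℕ.* suc m)))))))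

-- t is replaced by a real that is equal to it and whose approximations all lie
-- in (0, 1]: positivity of t makes the support of the weights all of 𝒥.
module Clamp (t : ℝ) (0≤t : 0ℝ ≤ t) (t≤1 : t ≤ 1ℝ) where

  -- The floor tends to zero, so the limit is unchanged even at t = 0, where a fixed positive floor
  -- would alter it.
  clamp : ℕ → ℚ
  clamp m = (seq t m ℚ.⊓ 1ℚ) ℚ.⊔ 1/suc m

  clamp-positive : ∀ m → 0ℚ ℚ.< clamp m
  clamp-positive m = ℚ.<-≤-trans (1/suc-positive m) (ℚ.p≤q⊔p (seq t m ℚ.⊓ 1ℚ) (1/suc m))

  clamp≤1 : ∀ m → clamp m ℚ.≤ 1ℚ
  clamp≤1 m = ℚ.⊔-lub (ℚ.p⊓q≤q (seq t m) 1ℚ) (1/suc≤1 m)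
    where
    1/suc≤1 : ∀ m → 1/suc m ℚ.≤ 1ℚ
    1/suc≤1 m = proj₂ (1/suc-small 1ℚ (ℚ.positive⁻¹ 1ℚ)) m ℕ.z≤n

  clamp⟶t : clamp ⟶ seq t
  clamp⟶t ε 0<ε with 0≤t (½ ℚ.* (½ ℚ.* ε)) 0<η | t≤1 (½ ℚ.* (½ ℚ.* ε)) 0<η | 1/suc-small (½ ℚ.* (½ ℚ.* ε)) 0<η
    where
    0<η : 0ℚ ℚ.< ½ ℚ.* (½ ℚ.* ε)
    0<η = half-positive (half-positive 0<ε)
  ... | L , t≥ | M , t≤ | N , u≤ = L ℕ.⊔ (M ℕ.⊔ N) , λ m ≤m →
    let ≤MN = ℕ.m⊔n≤o⇒n≤o L (M ℕ.⊔ N) ≤m in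
    ℚ.≤-<-trans (bound (seq t m) (t≥ m (ℕ.m⊔n≤o⇒m≤o L (M ℕ.⊔ N) ≤m)) (t≤ m (ℕ.m⊔n≤o⇒m≤o M N ≤MN)) (u≤ m (ℕ.m⊔n≤o⇒n≤o M N ≤MN)))
                (half-< 0<ε)
    where
    open ℚ.≤-Reasoning
    h η : ℚ
    h = ½ ℚ.* ε
    η = ½ ℚ.* h
    0≤η : 0ℚ ℚ.≤ η
    0≤η = ℚ.<⇒≤ (half-positive (half-positive 0<ε))
    η≤h : η ℚ.≤ h
    η≤h = ℚ.<⇒≤ (half-< (half-positive 0<ε))
    p≤p+ : ∀ p {e} → 0ℚ ℚ.≤ e → p ℚ.≤ p ℚ.+ e
    p≤p+ p {e} 0≤e = subst (ℚ._≤ p ℚ.+ e) (ℚ.+-identityʳ p) (ℚ.+-monoʳ-≤ p 0≤e)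
    bound : ∀ τ {u} → 0ℚ ℚ.≤ τ ℚ.+ η → τ ℚ.≤ 1ℚ ℚ.+ η → u ℚ.≤ η → ∣ ((τ ℚ.⊓ 1ℚ) ℚ.⊔ u) ℚ.- τ ∣ ℚ.≤ h
    bound τ {u} 0≤τ τ≤1 u≤η = ∣p-q∣≤ (ℚ.⊔-lub upper₁ upper₂) lower
      where
      upper₁ : τ ℚ.⊓ 1ℚ ℚ.≤ τ ℚ.+ h
      upper₁ = ℚ.≤-trans (ℚ.p⊓q≤p τ 1ℚ) (p≤p+ τ (ℚ.≤-trans 0≤η η≤h))
      upper₂ : u ℚ.≤ τ ℚ.+ h
      upper₂ = begin
        u                    ≤⟨ u≤η ⟩
        η                    ≡⟨ ℚ.+-identityˡ η ⟨
        0ℚ ℚ.+ η             ≤⟨ ℚ.+-monoˡ-≤ η 0≤τ ⟩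
        τ ℚ.+ η ℚ.+ η        ≡⟨ trans (ℚ.+-assoc τ η η) (cong (τ ℚ.+_) (halves h)) ⟩
        τ ℚ.+ h              ∎
      below : τ ℚ.≤ (τ ℚ.⊓ 1ℚ) ℚ.+ η
      below with ℚ.⊓-sel τ 1ℚ
      ... | inj₁ eq = subst (λ x → τ ℚ.≤ x ℚ.+ η) (sym eq) (p≤p+ τ 0≤η)
      ... | inj₂ eq = subst (λ x → τ ℚ.≤ x ℚ.+ η) (sym eq) τ≤1
      lower : τ ℚ.≤ ((τ ℚ.⊓ 1ℚ) ℚ.⊔ u) ℚ.+ h
      lower = ℚ.≤-trans below (ℚ.+-mono-≤ (ℚ.p≤p⊔q (τ ℚ.⊓ 1ℚ) u) η≤h)

  t′ : ℝ
  t′ = mkℝ clamp (⟶-cauchy {clamp} t clamp⟶t)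

  t≈t′ : t ≈ t′
  t≈t′ = ⟶-sym {clamp} {seq t} clamp⟶t

-- Transfer from the rational inequality to the real one.

seq-^ : ∀ x k m → seq (x ^ k) m ≡ seq x m ^ℚ k
seq-^ x ℕ.zero  m = refl
seq-^ x (suc k) m = cong (seq x m ℚ.*_) (seq-^ x k m)

seq-weight : ∀ {n} (ω : Fin n → ℝ) a m → seq (weight ω a) m ≡ weightℚ (λ i → seq (ω i) m) a
seq-weight ω Vec.[]      m = refl
seq-weight ω (x Vec.∷ a) m = cong₂ ℚ._*_ (seq-^ (ω Fin.zero) x m) (seq-weight (ω ∘ Fin.suc) a m)

seq-∑ : ∀ {A : Set} (f : A → ℝ) (g : A → ℚ) m → (∀ a → seq (f a) m ≡ g a) → ∀ xs → seq (∑ (map f xs)) m ≡ ∑ℚ g xs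
seq-∑ f g m eq []       = refl
seq-∑ f g m eq (x ∷ xs) = cong₂ ℚ._+_ (eq x) (seq-∑ f g m eq xs)

power-vanishes : ∀ {t} → t ≈ 0ℝ → ∀ x {j} → 0 <ᴺ j → t ^ j * x ≈ 0ℝ
power-vanishes {t} t≈0 x {suc j} _ = ≈-trans {t * t ^ j * x} {0ℝ * t ^ j * x} {0ℝ}
  (*-congʳ {t * t ^ j} {0ℝ * t ^ j} x (*-congʳ {t} {0ℝ} (t ^ j) t≈0))
  (≈-pointwise {0ℝ * t ^ j * x} {0ℝ} (λ m → kill (seq (t ^ j) m) (seq x m)))
  where
  kill : ∀ p q → 0ℚ ℚ.* p ℚ.* q ≡ 0ℚ
  kill = solve-∀ ringℚ

module _ {n : ℕ} (D : DiscretePolymatroid n) where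
  open DiscretePolymatroid D
  open Polymatroid D using (π-positive)

  summand : (Fin n → ℝ) → ℝ → Vec ℕ n → ℝ
  summand ω t a = t ^ π a * (weight ω a * 1/ℕ (a !ᵛ) {{a !ᵛ≢0}})

  seq-J : ∀ ω t k m → seq (J D ω t k) m ≡ Levels.Jℚ D (λ i → seq (ω i) m) (seq t m) k
  seq-J ω t k m = seq-∑ (summand ω t) (λ a → Weighted.term D (λ i → seq (ω i) m) (seq t m) a ℚ.* 1/!ᵛ a) m
    (λ a → trans (cong₂ (λ p q → p ℚ.* (q ℚ.* 1/!ᵛ a)) (seq-^ t (π a) m) (seq-weight ω a m))
                 (sym (ℚ.*-assoc (seq t m ^ℚ π a) (weightℚ (λ i → seq (ω i) m) a) (1/!ᵛ a)))) (level k)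

  J-cong : ∀ ω {t t′} → t ≈ t′ → ∀ k → J D ω t k ≈ J D ω t′ k
  J-cong ω {t} {t′} t≈t′ k = ∑-cong (summand ω t) (summand ω t′) (level k) λ {a} _ →
    *-congʳ {t ^ π a} {t′ ^ π a} (weight ω a * 1/ℕ (a !ᵛ) {{a !ᵛ≢0}}) (^-cong {t} {t′} t≈t′ (π a))

  -- When there is at most one class, every vector two degrees higher repeats a coordinate, so each
  -- summand carries a positive power of `t`.
  J-vanishes : ∀ ω {t} K → t ≈ 0ℝ → p K ≡ 1 → J D ω t (2 ℕ.+ K) ≈ 0ℝ
  J-vanishes ω {t} K t≈0 p≡1 = ≈-trans {J D ω t (2 ℕ.+ K)} {∑ (map (λ _ → 0ℝ) (level (2 ℕ.+ K)))} {0ℝ}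
    (∑-cong (summand ω t) (λ _ → 0ℝ) (level (2 ℕ.+ K)) λ {a} a∈ →
      let a∈𝒥 , |a|≡ = Levels.level⁻ D (λ _ → 0ℚ) 0ℚ a∈ in vanish a (π-positive p≡1 a∈𝒥 |a|≡))
    (≈-pointwise {∑ (map (λ _ → 0ℝ) (level (2 ℕ.+ K)))} {0ℝ} (λ m → zeros (level (2 ℕ.+ K)) m))
    where
    zeros : ∀ (xs : List (Vec ℕ n)) m → seq (∑ (map (λ _ → 0ℝ) xs)) m ≡ 0ℚ
    zeros []       m = refl
    zeros (x ∷ xs) m = trans (ℚ.+-identityˡ _) (zeros xs m)
    vanish : ∀ a → 0 <ᴺ π a → summand ω t a ≈ 0ℝ
    vanish a 0<π = power-vanishes {t} t≈0 (weight ω a * 1/ℕ (a !ᵛ) {{a !ᵛ≢0}}) 0<π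

square-≥0 : ∀ x → 0ℝ ≤ x ^ 2
square-≥0 x = ≤-from-eventually {0ℝ} {0ℝ} {x ^ 2} {x ^ 2} (≈-refl {0ℝ}) (≈-refl {x ^ 2}) (0 , λ m _ →
  subst (λ y → 0ℚ ℚ.≤ seq x m ℚ.* y) (sym (ℚ.*-identityʳ (seq x m))) (square-nonneg (seq x m)))

eventually-all : ∀ {n} {P : Fin n → ℕ → Set} → (∀ i → ∃[ N ] (∀ m → N ℕ.≤ m → P i m)) →
  ∃[ N ] (∀ m → N ℕ.≤ m → ∀ i → P i m)
eventually-all {ℕ.zero} ev = 0 , λ _ _ ()
eventually-all {suc n}  ev with ev Fin.zero | eventually-all (ev ∘ Fin.suc)
... | M , p₀ | N , pₛ = M ℕ.⊔ N , λ where
  m ≤m Fin.zero    → p₀ m (ℕ.m⊔n≤o⇒m≤o M N ≤m)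
  m ≤m (Fin.suc i) → pₛ m (ℕ.m⊔n≤o⇒n≤o M N ≤m) i

-- For P = 0 the denominator would be t - 1, which is not positive. Thus p ≥ 1 is read off from the
-- positivity witness instead of from the level being nonempty.
denominator-positive⇒1≤p : ∀ {t} → t ≤ 1ℝ → ∀ P → 0ℝ < fromℕ P - 1ℝ + t → ∃[ P′ ] P ≡ suc P′
denominator-positive⇒1≤p t≤1 (suc P) _ = P , refl
denominator-positive⇒1≤p {t} t≤1 ℕ.zero (ε , 0<ε , M , d≥) = contradiction (ℚ.<-≤-trans (half-< 0<ε) ε≤½ε) (ℚ.<-irrefl refl)
  where
  open ℚ.≤-Reasoning
  t-bound = t≤1 (½ ℚ.* ε) (half-positive 0<ε)
  N = proj₁ t-bound
  t≤ = proj₂ t-bound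
  m = M ℕ.⊔ N
  ε≤½ε : ε ℚ.≤ ½ ℚ.* ε
  ε≤½ε = begin
    ε                                      ≡⟨ ℚ.+-identityˡ ε ⟨
    0ℚ ℚ.+ ε                               ≤⟨ d≥ m (ℕ.m≤m⊔n M N) ⟩
    0ℚ ℚ.- 1ℚ ℚ.+ seq t m                 ≤⟨ ℚ.+-monoʳ-≤ (0ℚ ℚ.- 1ℚ) (t≤ m (ℕ.m≤n⊔m M N)) ⟩
    0ℚ ℚ.- 1ℚ ℚ.+ (1ℚ ℚ.+ ½ ℚ.* ε)      ≡⟨ tidy (½ ℚ.* ε) ⟩
    ½ ℚ.* ε                                ∎
    where
    tidy : ∀ h → 0ℚ ℚ.- 1ℚ ℚ.+ (1ℚ ℚ.+ h) ≡ h
    tidy = solve-∀ ringℚ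

lhs-cong : ∀ a {s s′ d d′ x x′ y y′} (0<d : 0ℝ < d) (0<d′ : 0ℝ < d′) → s ≈ s′ → d ≈ d′ → x ≈ x′ → y ≈ y′ →
  a * (1ℝ + (1ℝ - s) ÷ d [ 0<d ]) * x * y ≈ a * (1ℝ + (1ℝ - s′) ÷ d′ [ 0<d′ ]) * x′ * y′
lhs-cong a {s} {s′} {d} {d′} {x} {x′} {y} {y′} 0<d 0<d′ s≈ d≈ x≈ y≈ =
  *-cong {a * (1ℝ + q) * x} {a * (1ℝ + q′) * x′} {y} {y′}
    (*-cong {a * (1ℝ + q)} {a * (1ℝ + q′)} {x} {x′}
      (*-congˡ a {1ℝ + q} {1ℝ + q′} (+-cong {1ℝ} {1ℝ} {q} {q′} (≈-refl {1ℝ})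
        (*-cong {1ℝ - s} {1ℝ - s′} {reciprocal d 0<d} {reciprocal d′ 0<d′}
          (+-cong {1ℝ} {1ℝ} { - s} { - s′} (≈-refl {1ℝ}) (-‿cong {s} {s′} s≈))
          (reciprocal-cong {d} {d′} 0<d 0<d′ d≈))))
      x≈)
    y≈
  where
  q q′ : ℝ
  q  = (1ℝ - s) ÷ d [ 0<d ]
  q′ = (1ℝ - s′) ÷ d′ [ 0<d′ ]

module _ {n : ℕ} (D : DiscretePolymatroid n) (ω : Fin n → ℝ) (0<ω : ∀ i → 0ℝ < ω i) (t : ℝ) (t≤1 : t ≤ 1ℝ)
         (t′ : ℝ) (t≈t′ : t ≈ t′) (0<t′ : ∀ m → 0ℚ ℚ.< seq t′ m) (t′≤1 : ∀ m → seq t′ m ℚ.≤ 1ℚ)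
         (K : ℕ) (K<rk : suc K <ᴺ DiscretePolymatroid.rk D) where

  open DiscretePolymatroid D using (p)

  den : ℝ → ℝ
  den t = fromℕ (p K) - 1ℝ + t
  lhs : (t : ℝ) → 0ℝ < den t → ℝ
  lhs t 0<d = (1ℝ + 1/ℕ (suc K)) * (1ℝ + (1ℝ - t) ÷ den t [ 0<d ]) * J D ω t K * J D ω t (2 ℕ.+ K)
  den-cong : den t ≈ den t′
  den-cong = +-cong {fromℕ (p K) - 1ℝ} {fromℕ (p K) - 1ℝ} {t} {t′} (≈-refl {fromℕ (p K) - 1ℝ}) t≈t′
  rhs-cong : J D ω t′ (suc K) ^ 2 ≈ J D ω t (suc K) ^ 2
  rhs-cong = ^-cong {J D ω t′ (suc K)} {J D ω t (suc K)} (J-cong D ω {t′} {t} (≈-sym {t} {t′} t≈t′) (suc K)) 2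
  inequality : (0<d : 0ℝ < den t) → lhs t 0<d ≤ J D ω t (suc K) ^ 2
  inequality 0<d = ≤-from-eventually {lhs t 0<d} {lhs t′ 0<d′} {J D ω t (suc K) ^ 2} {J D ω t′ (suc K) ^ 2}
    (lhs-cong (1ℝ + 1/ℕ (suc K)) {t} {t′} {den t} {den t′} {J D ω t K} {J D ω t′ K} {J D ω t (2 ℕ.+ K)} {J D ω t′ (2 ℕ.+ K)}
      0<d 0<d′ t≈t′ den-cong (J-cong D ω {t} {t′} t≈t′ K) (J-cong D ω {t} {t′} t≈t′ (2 ℕ.+ K))) rhs-cong (N , pointwise)
    where
    0<d′ : 0ℝ < den t′
    0<d′ = 0<-resp-≈ {den t} {den t′} den-cong 0<d
    P′ = proj₁ (denominator-positive⇒1≤p {t} t≤1 (p K) 0<d)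
    p≡ : p K ≡ suc P′
    p≡ = proj₂ (denominator-positive⇒1≤p {t} t≤1 (p K) 0<d)
    ω-positive = eventually-all (λ i → 0<-eventually {ω i} (0<ω i))
    N = proj₁ ω-positive
    pointwise : ∀ m → N ℕ.≤ m → seq (lhs t′ 0<d′) m ℚ.≤ seq (J D ω t′ (suc K) ^ 2) m
    pointwise m N≤m = subst₂ ℚ._≤_
      (sym (cong₂ (λ x y → (1ℚ ℚ.+ ℤ.+ 1 ℚ./ suc K) ℚ.* c ℚ.* x ℚ.* y) (seq-J D ω t′ K m) (seq-J D ω t′ (2 ℕ.+ K) m)))
      (sym (trans (cong (seq (J D ω t′ (suc K)) m ℚ.*_) (ℚ.*-identityʳ (seq (J D ω t′ (suc K)) m)))
                  (cong (λ x → x ℚ.* x) (seq-J D ω t′ (suc K) m))))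
      (Levels.log-concave D (λ i → seq (ω i) m) τ (proj₂ ω-positive m N≤m) (0<t′ m) (t′≤1 m) P′ K K<rk p≡ c c-den)
      where
      τ d c : ℚ
      τ = seq t′ m
      d = (ℤ.+ p K ℚ./ 1) ℚ.- 1ℚ ℚ.+ τ
      c = 1ℚ ℚ.+ (1ℚ ℚ.- τ) ℚ.* recip d
      o = ones (suc P′)
      d≡ : d ≡ o ℚ.- 1ℚ ℚ.+ τ
      d≡ = cong (λ x → x ℚ.- 1ℚ ℚ.+ τ) (trans (cong (λ k → ℤ.+ k ℚ./ 1) p≡) (sym (ones-/1 (suc P′))))
      -- Positivity is required at each index, not just in the limit; when p = 1 it rests on the
      -- clamped approximation τ being positive.
      0<o-1+τ : 0ℚ ℚ.< o ℚ.- 1ℚ ℚ.+ τ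
      0<o-1+τ = subst (0ℚ ℚ.<_) (cancel (ones P′) τ)
        (ℚ.+-mono-≤-< (sum-nonneg {P′} (λ _ → ℚ.nonNegative⁻¹ 1ℚ)) (0<t′ m))
        where
        cancel : ∀ x y → x ℚ.+ y ≡ 1ℚ ℚ.+ x ℚ.- 1ℚ ℚ.+ y
        cancel = solve-∀ ringℚ
      -- The factor 1 + (1 - τ)/d of the theorem is p/d, because d + (1 - τ) = p.
      c-den : c ℚ.* (o ℚ.- 1ℚ ℚ.+ τ) ≡ o
      c-den = begin
        c ℚ.* (o ℚ.- 1ℚ ℚ.+ τ)
          ≡⟨ cong (c ℚ.*_) d≡ ⟨
        (1ℚ ℚ.+ (1ℚ ℚ.- τ) ℚ.* recip d) ℚ.* d
          ≡⟨ expand τ (recip d) d ⟩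
        d ℚ.+ (1ℚ ℚ.- τ) ℚ.* (d ℚ.* recip d)
          ≡⟨ cong₂ (λ x y → x ℚ.+ (1ℚ ℚ.- τ) ℚ.* y) d≡ (recip-inverse d (subst (0ℚ ℚ.<_) (sym d≡) 0<o-1+τ)) ⟩
        o ℚ.- 1ℚ ℚ.+ τ ℚ.+ (1ℚ ℚ.- τ) ℚ.* 1ℚ
          ≡⟨ collect o τ ⟩
        o ∎
        where
        open ≡-Reasoning
        expand : ∀ τ r d → (1ℚ ℚ.+ (1ℚ ℚ.- τ) ℚ.* r) ℚ.* d ≡ d ℚ.+ (1ℚ ℚ.- τ) ℚ.* (d ℚ.* r)
        expand = solve-∀ ringℚ
        collect : ∀ o τ → o ℚ.- 1ℚ ℚ.+ τ ℚ.+ (1ℚ ℚ.- τ) ℚ.* 1ℚ ≡ o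
        collect = solve-∀ ringℚ

theorem1p21 : ∀ {n} (D : DiscretePolymatroid n) →
    let open DiscretePolymatroid D in
    (ω : Fin n → ℝ) → (∀ i → 0ℝ < ω i) →
    (t : ℝ) → 0ℝ ≤ t → t ≤ 1ℝ →
    (k : ℕ) → .{{_ : NonZero k}} → k <ᴺ rk →
    let denominator = fromℕ (p (pred k)) - 1ℝ + t in
    ((0<d : 0ℝ < denominator) →
    (1ℝ + 1/ℕ k) * (1ℝ + (1ℝ - t) ÷ denominator [ 0<d ]) * J D ω t (pred k) * J D ω t (suc k)
    ≤ J D ω t k ^ 2)
    ×
    (t ≈ 0ℝ → p (pred k) ≡ 1 →
    (J D ω t (suc k) ≈ 0ℝ) × (0ℝ ≤ J D ω t k ^ 2))
theorem1p21 D ω 0<ω t 0≤t t≤1 (suc K) k<rk =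
  inequality D ω 0<ω t t≤1 t′ t≈t′ clamp-positive clamp≤1 K k<rk ,
  λ t≈0 p≡1 → J-vanishes D ω {t} K t≈0 p≡1 , square-≥0 (J D ω t (suc K))
  where open Clamp t 0≤t t≤1
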